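{- There exists a positive absolute constant $c$ such that the following holds. Let $p$ be a prime and let $A,B\subseteq\mathbb{Z}/p\mathbb{Z}$ satisfy $1<|A|<p/2$ and $0<|B|<\min\{\sqrt{p/8},\,c|A|/\ln|A|\}$. Then for every mapping $\tau\colon B\to A$ we have $|A\stackrel{\tau}{+}B|\ge |A|+|B|-3$.
   Context: $\mathbb{Z}/p\mathbb{Z}$ is the cyclic group of prime order $p$; $\ln$ is the natural logarithm. For a mapping $\tau\colon B\to A$, the restricted sumset is $A\stackrel{\tau}{+}B:=\{a+b: a\in A,\ b\in B,\ a\ne\tau(b)\}$. -}

module Defs where

open import Data.Nat using (ℕ; zero; suc; _+_; _*_; _^_; _<_; NonZero)
open import Data.Nat.DivMod using (_mod_)
open import Data.Fin using (Fin; toℕ)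
open import Data.Fin.Properties using (any?) renaming (_≟_ to _≟ᶠ_)
open import Data.Fin.Subset using (Subset; _∈_)
open import Data.Fin.Subset.Properties using (_∈?_)
open import Data.Product using (∃)
open import Data.Vec using (tabulate)
open import Relation.Nullary using (does; ¬?)
open import Relation.Nullary.Decidable using (_×-dec_)

_⊕_ : ∀ {p} .{{_ : NonZero p}} → Fin p → Fin p → Fin p
_⊕_ {p} a b = (toℕ a + toℕ b) mod p

-- Restricted sumset  A +^τ B = { a + b : a ∈ A, b ∈ B, a ≠ τ(b) }.
-- (τ is given as a total function Fin p → Fin p; only its values on B matter.)
restrictedSumset : ∀ {p} .{{_ : NonZero p}} →
  Subset p → Subset p → (Fin p → Fin p) → Subset p
restrictedSumset A B τ = tabulate λ x →
  does (any? λ a → any? λ b →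
    (a ∈? A) ×-dec ((b ∈? B) ×-dec (¬? (a ≟ᶠ τ b) ×-dec ((a ⊕ b) ≟ᶠ x))))

-- expNum m k = Σ_{j=0}^{k} m^j · k!/j!  (= k! · Σ_{j≤k} m^j/j!)
expNum : ℕ → ℕ → ℕ
expNum m zero = 1
expNum m (suc k) = suc k * expNum m k + m ^ suc k

factorial : ℕ → ℕ
factorial zero = 1
factorial (suc k) = suc k * factorial k

-- N < e^m  (real exponential), expressed via partial sums of the exponential
-- series: N < e^m  iff  N < Σ_{j≤k} m^j/j!  for some k.
_<exp_ : ℕ → ℕ → Set
N <exp m = ∃ λ k → N * factorial k < expNum m k

{-# OPTIONS --safe #-}

-- Write λ(d) = |(A + d) ∖ A| (lam) and u = |B| − 1. If the bound fails, comparing two translates of A shows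
-- λ(d) < u on D = B − B, and |D| ≥ 2u + 1 by Cauchy–Davenport: A has too many popular differences.
--
-- λ is subadditive, so λ ≤ ju on the j-fold sumset jD, and Σ_d (|A| − λ(d)) = |A|² forces |jD| ≈ 2ju for
-- bounded j. This nearly minimal growth rectifies D: a geodesic in the balls jD yields z whose multiples run
-- away from 0; a system R of representatives of 6D modulo z is permuted by each d ∈ D up to multiples of z,
-- and summing over R gives |R| d ∈ ℤz. Hence after a dilation D lies in [−l, l] with l close to u.
--
-- Now A is nearly full on a long arc. An arc free of holes is impossible, since it gives λ(l) ≥ l ≥ u. So let H
-- be the holes in a sub-arc chosen such that enlarging it adds few holes; since their number cannot grow
-- geometrically, such a sub-arc exists (this needs ln |A| steps). Filling H gives d + λ_H(d) ≤ λ_A(d) + small,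
-- so the elements of D near l are popular differences of H. Their iterated sumsets are disjoint, and provide
-- more popular differences than H can have.

module Submission where

open import Defs
open import Data.Nat using (ℕ; zero; suc; _+_; _*_; _∸_; _^_; _<_; _≤_; z≤n; s≤s; NonZero)
import Data.Nat as ℕ
import Data.Nat.Properties as ℕₚ
open ℕₚ using
  (*-assoc; *-cancelʳ-<; *-cancelʳ-≤; *-cancelˡ-<; *-cancelˡ-≤; *-comm; *-distribʳ-+; *-distribˡ-+; *-distribˡ-∸;
   *-identityʳ; *-identityˡ; *-mono-≤; *-monoʳ-<; *-monoʳ-≤; *-monoˡ-<; *-monoˡ-≤; *-zeroʳ; +-assoc; +-cancelʳ-≡;
   +-cancelʳ-≤; +-cancelˡ-<; +-cancelˡ-≤; +-comm; +-distribˡ-⊓; +-identityʳ; +-mono-<-≤; +-mono-≤; +-mono-≤-<;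
   +-monoʳ-<; +-monoʳ-≤; +-monoˡ-<; +-monoˡ-≤; +-suc; 1+n≢0; <-cmp; <-irrefl; <-trans; <-≤-trans; <⇒≢; <⇒≤; <⇒≱;
   ^-*-assoc; ^-distribˡ-+-*; ^-monoʳ-≤; ^-monoˡ-≤; allUpTo?; anyUpTo?; m*n≢0; m+[n∸m]≡n; m+n≡0⇒m≡0; m+n≡0⇒n≡0;
   m+n≤o⇒m≤o∸n; m<1+n⇒m<n∨m≡n; m<n⇒0<n∸m; m^n>0; m∸n+n≡m; m∸n≤m; m≤m*n; m≤m+n; m≤m⊔n; m≤n*m; m≤n+m; m≤n+m∸n;
   m≤n+o⇒m∸n≤o; m≤n⇒m<n∨m≡n; m≤n⇒m≤1+n; m≤n⇒m⊓n≡m; m≤n⇒m⊔n≡n; m≤n⊔m; m≥n⇒m⊓n≡n; m⊓n≤m; m⊓n≤n; n<1+n; n≤0⇒n≡0;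
   n≤1+n; pred[m∸n]≡m∸[1+n]; suc-injective; suc-pred; ≤-<-trans; ≤-antisym; ≤-refl; ≤-reflexive; ≤-total;
   ≤-trans; ≮⇒≥; ≰⇒>; ≰⇒≥; ⊓-glb; ⊓-monoˡ-≤; ⊔-lub)
import Data.Nat.DivMod as ℕDM
open import Data.Nat.Primality using (Prime)
open import Data.Nat.Coprimality using (prime⇒coprime; coprime-Bézout)
open import Data.Nat.GCD using (module Bézout)
open import Data.Nat.Tactic.RingSolver using () renaming (solve-∀ to ℕ-solve)
open import Data.Integer using (ℤ; +_; -[1+_]) renaming (_+_ to _⊹_; _*_ to _·_; _-_ to _⊝_; -_ to ⊖_; ∣_∣ to abs)
import Data.Integer.Properties as ℤₚ
import Data.Integer.DivMod as ℤDM
open import Data.Integer.Tactic.RingSolver using () renaming (solve-∀ to ℤ-solve)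
open import Data.Fin using (Fin; toℕ; fromℕ<) renaming (zero to fzero; suc to fsuc)
import Data.Fin.Properties as Finₚ
open import Data.Fin.Subset using (Subset; ∣_∣) renaming (_∈_ to _∈ˢ_)
open import Data.Fin.Subset.Properties using (drop-there) renaming (_∈?_ to _∈ˢ?_)
open import Data.Bool using (true; false)
open import Data.Vec using ([]; _∷_; here; there)
import Data.Vec.Properties as Vecₚ
open import Data.List using (List; []; _∷_; length)
open import Data.List.Relation.Unary.All using (All; []; _∷_)
import Data.List.Relation.Unary.All as All
open import Data.List.Relation.Unary.Any using (Any; here; there)
open import Data.List.Relation.Unary.AllPairs using (AllPairs; []; _∷_)
open import Data.Product using (Σ; ∃; _×_; _,_; proj₁; proj₂)
open import Data.Sum using (_⊎_; inj₁; inj₂)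
open import Data.Empty using (⊥; ⊥-elim)
open import Relation.Nullary using (Dec; yes; no; ¬_; ¬?)
open import Relation.Nullary.Decidable using (map′; _×-dec_; _⊎-dec_; dec-true)
open import Relation.Binary.Definitions using (Tri; tri<; tri≈; tri>)
open import Relation.Binary.PropositionalEquality using (_≡_; _≢_; refl; sym; trans; cong; cong₂; subst; subst₂; module ≡-Reasoning)

-- Finite sums and indicators

-- If A is an interval and D = [-u, u], then λ(d) = |d| on D, so λ < u on D fails by a single unit.
-- A stability argument that loses a constant factor cannot see this, and the last step has to be
-- exact. Exactness comes from λ(d) ≥ d, valid for d ≤ l once A contains an arc of length l and
-- misses l + 1 consecutive points. The missed points exist if λ(1) + ... + λ(l) + |A| < p; the sum
-- is of order u², and this is the main use of 8|B|² < p. The arc need not exist, so holes are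
-- filled; this costs twice the number of holes that the enlarged arc adds, and a level with slow
-- growth makes this cost a small fraction of |H|. The estimate |jD| ≈ 2ju has this source: if |jD|
-- exceeds (2j + 1)u + 1, Cauchy-Davenport carries the growth to every ijD, and the representation
-- counts |A| - iju on these balls add up to more than |A|². All inequalities are over ℕ; ln |A| is
-- represented by an integer a with 2^a ≤ |A| < 2^(2a).

≤-cancel : ∀ {a b x y} c → a ≤ b → x + b + c ≡ y + a → x ≤ y
-- Linear arithmetic by certificate: the hypotheses are added up to one inequality `a ≤ b`, `c` is
-- the slack, and the ring solver checks the identity.
≤-cancel {a} {b} {x} {y} c a≤b eq = +-cancelʳ-≤ b x y (begin
  x + b      ≤⟨ m≤m+n (x + b) c ⟩
  x + b + c  ≡⟨ eq ⟩
  y + a      ≤⟨ +-monoʳ-≤ y a≤b ⟩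
  y + b      ∎)
  where open ℕₚ.≤-Reasoning

∑ : ℕ → (ℕ → ℕ) → ℕ
∑ zero    f = 0
∑ (suc n) f = f n + ∑ n f

∑-cong : ∀ n {f g} → (∀ i → i < n → f i ≡ g i) → ∑ n f ≡ ∑ n g
∑-cong zero    h = refl
∑-cong (suc n) h = cong₂ _+_ (h n ≤-refl) (∑-cong n λ i i<n → h i (m≤n⇒m≤1+n i<n))

∑-mono : ∀ n {f g} → (∀ i → i < n → f i ≤ g i) → ∑ n f ≤ ∑ n g
∑-mono zero    h = z≤n
∑-mono (suc n) h = +-mono-≤ (h n ≤-refl) (∑-mono n λ i i<n → h i (m≤n⇒m≤1+n i<n))

∑-+ : ∀ n f g → ∑ n (λ i → f i + g i) ≡ ∑ n f + ∑ n g
∑-+ zero    f g = refl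
∑-+ (suc n) f g = trans (cong (_+_ (f n + g n)) (∑-+ n f g)) (aux (f n) (g n) (∑ n f) (∑ n g))
  where
  aux : ∀ a b c d → a + b + (c + d) ≡ a + c + (b + d)
  aux = ℕ-solve

∑-*ˡ : ∀ n c f → ∑ n (λ i → c * f i) ≡ c * ∑ n f
∑-*ˡ zero    c f = sym (*-zeroʳ c)
∑-*ˡ (suc n) c f = trans (cong (_+_ (c * f n)) (∑-*ˡ n c f)) (sym (*-distribˡ-+ c (f n) (∑ n f)))

∑-*ʳ : ∀ n c f → ∑ n (λ i → f i * c) ≡ ∑ n f * c
∑-*ʳ n c f = trans (∑-cong n λ i _ → *-comm (f i) c) (trans (∑-*ˡ n c f) (*-comm c (∑ n f)))

∑-const : ∀ n c → ∑ n (λ _ → c) ≡ n * c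
∑-const zero    c = refl
∑-const (suc n) c = cong (_+_ c) (∑-const n c)

∑-zero : ∀ n → ∑ n (λ _ → 0) ≡ 0
∑-zero n = trans (∑-const n 0) (*-zeroʳ n)

∑-swap : ∀ m n (f : ℕ → ℕ → ℕ) → ∑ m (λ i → ∑ n (f i)) ≡ ∑ n (λ j → ∑ m (λ i → f i j))
∑-swap zero    n f = sym (∑-zero n)
∑-swap (suc m) n f = trans (cong (_+_ (∑ n (f m))) (∑-swap m n f)) (sym (∑-+ n (f m) _))

∑-split : ∀ m n f → ∑ (m + n) f ≡ ∑ m f + ∑ n (λ i → f (m + i))
∑-split m zero    f = trans (cong (λ k → ∑ k f) (+-identityʳ m)) (sym (+-identityʳ _))
∑-split m (suc n) f = begin
  ∑ (m + suc n) f                                     ≡⟨ cong (λ k → ∑ k f) (+-suc m n) ⟩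
  f (m + n) + ∑ (m + n) f                             ≡⟨ cong (_+_ (f (m + n))) (∑-split m n f) ⟩
  f (m + n) + (∑ m f + ∑ n (λ i → f (m + i)))         ≡⟨ aux (f (m + n)) (∑ m f) _ ⟩
  ∑ m f + (f (m + n) + ∑ n (λ i → f (m + i)))         ∎
  where
  open ≡-Reasoning
  aux : ∀ a b c → a + (b + c) ≡ b + (a + c)
  aux = ℕ-solve

∑-extend : ∀ {m n} f → m ≤ n → ∑ m f ≤ ∑ n f
∑-extend {m} {n} f m≤n = subst (λ k → ∑ m f ≤ ∑ k f) (m+[n∸m]≡n m≤n)
  (subst (∑ m f ≤_) (sym (∑-split m (n ∸ m) f)) (m≤m+n (∑ m f) _))

∑-term : ∀ n f i → i < n → f i ≤ ∑ n f
∑-term (suc n) f i i<1+n with m<1+n⇒m<n∨m≡n i<1+n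
... | inj₁ i<n  = ≤-trans (∑-term n f i i<n) (m≤n+m (∑ n f) (f n))
... | inj₂ refl = m≤m+n (f n) (∑ n f)

∑-vanish : ∀ n f → (∀ i → i < n → f i ≡ 0) → ∑ n f ≡ 0
∑-vanish n f h = trans (∑-cong n h) (∑-zero n)

∑-≤* : ∀ n c f → (∀ i → i < n → f i ≤ c) → ∑ n f ≤ n * c
∑-≤* n c f h = subst (∑ n f ≤_) (∑-const n c) (∑-mono n h)

∑-≥* : ∀ n c f → (∀ i → i < n → c ≤ f i) → n * c ≤ ∑ n f
∑-≥* n c f h = subst (_≤ ∑ n f) (∑-const n c) (∑-mono n h)

∑-<-witness : ∀ n f g → ∑ n f < ∑ n g → ∃ λ i → i < n × f i < g i
∑-<-witness n f g lt with anyUpTo? (λ i → f i ℕₚ.<? g i) n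
... | yes w = w
... | no ¬w = ⊥-elim (<⇒≱ lt (∑-mono n λ i i<n → ≮⇒≥ λ fi<gi → ¬w (i , i<n , fi<gi)))

∑-positive : ∀ n f → 0 < ∑ n f → ∃ λ i → i < n × 0 < f i
∑-positive n f lt = ∑-<-witness n (λ _ → 0) f (subst (_< ∑ n f) (sym (∑-zero n)) lt)

-- Pigeonhole principle for counting functions: it turns an injection between sets of equal size
-- into a bijection.
∑-≡-pointwise : ∀ n f g → (∀ i → i < n → f i ≤ g i) → ∑ n g ≤ ∑ n f → ∀ i → i < n → f i ≡ g i
∑-≡-pointwise (suc n) f g le ge i i<1+n = case (m<1+n⇒m<n∨m≡n i<1+n)
  where
  le′ : ∀ i → i < n → f i ≤ g i
  le′ i i<n = le i (m≤n⇒m≤1+n i<n)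
  ge′ : ∑ n g ≤ ∑ n f
  ge′ = +-cancelˡ-≤ (g n) _ _ (≤-trans ge (+-monoˡ-≤ (∑ n f) (le n ≤-refl)))
  last : g n ≤ f n
  last = +-cancelʳ-≤ (∑ n g) _ _ (≤-trans ge (+-monoʳ-≤ (f n) (∑-mono n le′)))
  case : i < n ⊎ i ≡ n → f i ≡ g i
  case (inj₁ i<n)  = ∑-≡-pointwise n f g le′ ge′ i i<n
  case (inj₂ refl) = ≤-antisym (le n ≤-refl) last

-- Disjointness is always used through this bound: at a fixed point, the indicators of disjoint sets
-- add up to at most the indicator of any set that contains them all.
∑-atMostOne : ∀ n f c → (∀ i → i < n → f i ≤ c) →
  (∀ i j → i < n → j < n → 0 < f i → 0 < f j → i ≡ j) → ∑ n f ≤ c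
∑-atMostOne zero    f c h u = z≤n
∑-atMostOne (suc n) f c h u with f n in eq
... | zero  = ∑-atMostOne n f c (λ i i<n → h i (m≤n⇒m≤1+n i<n))
                (λ i j i<n j<n → u i j (m≤n⇒m≤1+n i<n) (m≤n⇒m≤1+n j<n))
... | suc k = subst (_≤ c) (sym total) (subst (_≤ c) eq (h n ≤-refl))
  where
  others : ∀ i → i < n → f i ≡ 0
  others i i<n with f i in eqi
  ... | zero   = refl
  ... | suc k′ = ⊥-elim (<⇒≢ i<n (u i n (m≤n⇒m≤1+n i<n) ≤-refl
                   (subst (0 <_) (sym eqi) (s≤s z≤n)) (subst (0 <_) (sym eq) (s≤s z≤n))))
  total : suc k + ∑ n f ≡ suc k
  total = trans (cong (_+_ (suc k)) (∑-vanish n f others)) (+-identityʳ (suc k))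

𝟙 : {P : Set} → Dec P → ℕ
𝟙 (yes _) = 1
𝟙 (no _)  = 0

𝟙≤1 : {P : Set} (d : Dec P) → 𝟙 d ≤ 1
𝟙≤1 (yes _) = ≤-refl
𝟙≤1 (no _)  = z≤n

𝟙-mono : {P Q : Set} (d : Dec P) (e : Dec Q) → (P → Q) → 𝟙 d ≤ 𝟙 e
𝟙-mono (yes a) (yes b) h = ≤-refl
𝟙-mono (yes a) (no ¬b) h = ⊥-elim (¬b (h a))
𝟙-mono (no ¬a) e       h = z≤n

𝟙-cong : {P Q : Set} (d : Dec P) (e : Dec Q) → (P → Q) → (Q → P) → 𝟙 d ≡ 𝟙 e
𝟙-cong d e f g = ≤-antisym (𝟙-mono d e f) (𝟙-mono e d g)

𝟙-true : {P : Set} (d : Dec P) → P → 𝟙 d ≡ 1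
𝟙-true (yes _) a = refl
𝟙-true (no ¬a) a = ⊥-elim (¬a a)

𝟙-false : {P : Set} (d : Dec P) → ¬ P → 𝟙 d ≡ 0
𝟙-false (yes a) ¬a = ⊥-elim (¬a a)
𝟙-false (no _)  ¬a = refl

𝟙-pos : {P : Set} (d : Dec P) → 0 < 𝟙 d → P
𝟙-pos (yes a) _ = a

𝟙-pos-* : {P Q : Set} (d : Dec P) (e : Dec Q) → 0 < 𝟙 d * 𝟙 e → P × Q
𝟙-pos-* (yes a) (yes b) _ = a , b

largest : {Q : ℕ → Set} → (∀ i → Dec (Q i)) → Q 0 → ∀ n → ∃ λ m → m ≤ n × Q m × (∀ k → k ≤ n → Q k → k ≤ m)
largest Q? q₀ zero = 0 , z≤n , q₀ , λ k k≤0 _ → k≤0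
largest Q? q₀ (suc n) with Q? (suc n)
... | yes q = suc n , ≤-refl , q , λ k k≤ _ → k≤
... | no ¬q with largest Q? q₀ n
...   | m , m≤n , q , max = m , m≤n⇒m≤1+n m≤n , q , below
  where
  below : ∀ k → k ≤ suc n → _ → k ≤ m
  below k k≤ qk with m≤n⇒m<n∨m≡n k≤
  ... | inj₁ (s≤s k≤n) = max k k≤n qk
  ... | inj₂ refl      = ⊥-elim (¬q qk)

-- Subsets of ℤ/pℤ

abs-difference : ∀ a b c → a ≤ b + c → b ≤ a + c → abs (+ a ⊝ + b) ≤ c
abs-difference a b c a≤ b≤ with ≤-total a b
... | inj₁ a≤b = subst (_≤ c) (sym (trans (cong abs (ℤₚ.m-n≡m⊖n a b)) (ℤₚ.∣⊖∣-≤ a≤b))) (m≤n+o⇒m∸n≤o b a b≤)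
... | inj₂ b≤a = subst (_≤ c) (sym (trans (cong abs (trans (ℤₚ.m-n≡m⊖n a b) (ℤₚ.⊖-≥ b≤a))) refl)) (m≤n+o⇒m∸n≤o a b a≤)

module Residues (p : ℕ) .{{nz : NonZero p}} where

  P : ℤ
  P = + p

  infix 4 _≈_ _≈?_

  -- The quotient is kept as data, so that each rule for `≈` reduces to a ring identity in ℤ.
  record _≈_ (x y : ℤ) : Set where
    constructor mod≈
    field
      quot : ℤ
      eq   : x ≡ y ⊹ quot · P

  ≡⇒≈ : ∀ {x y} → x ≡ y → x ≈ y
  ≡⇒≈ {x} refl = mod≈ (+ 0) (aux x P)
    where
    aux : ∀ x P → x ≡ x ⊹ + 0 · P
    aux = ℤ-solve

  ≈-refl : ∀ {x} → x ≈ x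
  ≈-refl = ≡⇒≈ refl

  ≈-sym : ∀ {x y} → x ≈ y → y ≈ x
  ≈-sym {x} {y} (mod≈ k refl) = mod≈ (⊖ k) (aux y k P)
    where
    aux : ∀ y k P → y ≡ y ⊹ k · P ⊹ ⊖ k · P
    aux = ℤ-solve

  ≈-trans : ∀ {x y z} → x ≈ y → y ≈ z → x ≈ z
  ≈-trans {z = z} (mod≈ k refl) (mod≈ l refl) = mod≈ (k ⊹ l) (aux z k l P)
    where
    aux : ∀ z k l P → z ⊹ l · P ⊹ k · P ≡ z ⊹ (k ⊹ l) · P
    aux = ℤ-solve

  ≈-+ : ∀ {x x′ y y′} → x ≈ x′ → y ≈ y′ → x ⊹ y ≈ x′ ⊹ y′
  ≈-+ {x′ = x} {y′ = y} (mod≈ k refl) (mod≈ l refl) = mod≈ (k ⊹ l) (aux x y k l P)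
    where
    aux : ∀ x y k l P → x ⊹ k · P ⊹ (y ⊹ l · P) ≡ x ⊹ y ⊹ (k ⊹ l) · P
    aux = ℤ-solve

  ≈-* : ∀ {x x′ y y′} → x ≈ x′ → y ≈ y′ → x · y ≈ x′ · y′
  ≈-* {x′ = x} {y′ = y} (mod≈ k refl) (mod≈ l refl) =
    mod≈ (k · y ⊹ l · x ⊹ k · l · P) (aux x y k l P)
    where
    aux : ∀ x y k l P → (x ⊹ k · P) · (y ⊹ l · P) ≡ x · y ⊹ (k · y ⊹ l · x ⊹ k · l · P) · P
    aux = ℤ-solve

  ≈-neg : ∀ {x x′} → x ≈ x′ → ⊖ x ≈ ⊖ x′
  ≈-neg {x′ = x} (mod≈ k refl) = mod≈ (⊖ k) (aux x k P)
    where
    aux : ∀ x k P → ⊖ (x ⊹ k · P) ≡ ⊖ x ⊹ ⊖ k · P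
    aux = ℤ-solve

  ≈-+ʳ : ∀ {x x′} c → x ≈ x′ → x ⊹ c ≈ x′ ⊹ c
  ≈-+ʳ c e = ≈-+ e (≈-refl {c})

  ≈-+ˡ : ∀ {x x′} c → x ≈ x′ → c ⊹ x ≈ c ⊹ x′
  ≈-+ˡ c e = ≈-+ (≈-refl {c}) e

  ≈-−ˡ : ∀ {x x′} c → x ≈ x′ → c ⊝ x ≈ c ⊝ x′
  ≈-−ˡ c e = ≈-+ (≈-refl {c}) (≈-neg e)

  ≈-−ʳ : ∀ {x x′} c → x ≈ x′ → x ⊝ c ≈ x′ ⊝ c
  ≈-−ʳ c e = ≈-+ e (≈-refl {⊖ c})

  ≈-− : ∀ {x x′ y y′} → x ≈ x′ → y ≈ y′ → x ⊝ y ≈ x′ ⊝ y′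
  ≈-− e f = ≈-+ e (≈-neg f)

  ρ : ℤ → ℕ
  ρ x = x ℤDM.%ℕ p

  ρ<p : ∀ x → ρ x < p
  ρ<p x = ℤDM.n%ℕd<d x p

  ≈ρ : ∀ x → x ≈ + ρ x
  ≈ρ x = mod≈ (x ℤDM./ℕ p) (ℤDM.a≡a%ℕn+[a/ℕn]*n x p)

  private
    multiple-small : ∀ k d → + d ≡ k · P → d < p → d ≡ 0
    multiple-small (+ zero)    d e lt = ℤₚ.+-injective e
    multiple-small (+ (suc k)) d e lt = ⊥-elim (<⇒≱ lt (≤-trans (m≤m+n p (k * p))
      (≤-reflexive (sym (ℤₚ.+-injective (trans e (sym (ℤₚ.pos-* (suc k) p))))))))
    multiple-small -[1+ k ]    d e lt = go p (trans e (ℤₚ.*-comm -[1+ k ] P)) lt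
      where
      go : ∀ q → + d ≡ + q · -[1+ k ] → d < q → d ≡ 0
      go (suc q) () lt

  ≈-unique-≤ : ∀ {i j} → j ≤ i → i < j + p → + i ≈ + j → i ≡ j
  ≈-unique-≤ {i} {j} j≤i i<j+p (mod≈ k e) = trans (sym (m+[n∸m]≡n j≤i)) (trans (cong (_+_ j) d≡0) (+-identityʳ j))
    where
    d : ℕ
    d = i ∸ j
    aux : ∀ j d kp → j ⊹ d ≡ j ⊹ kp → d ≡ kp
    aux j d kp h = trans (back j d) (trans (cong (_⊝ j) h) (sym (back j kp)))
      where
      back : ∀ j d → d ≡ j ⊹ d ⊝ j
      back = ℤ-solve
    d≡ : + d ≡ k · P
    d≡ = aux (+ j) (+ d) (k · P) (trans (trans (sym (ℤₚ.pos-+ j d)) (cong +_ (m+[n∸m]≡n j≤i))) e)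
    d≡0 : d ≡ 0
    d≡0 = multiple-small k d d≡ (+-cancelˡ-< j _ _ (subst (_< j + p) (sym (m+[n∸m]≡n j≤i)) i<j+p))

  ≈-unique : ∀ {i j} → i < p → j < p → + i ≈ + j → i ≡ j
  ≈-unique {i} {j} i<p j<p e with ≤-total j i
  ... | inj₁ j≤i = ≈-unique-≤ j≤i (≤-trans i<p (m≤n+m p j)) e
  ... | inj₂ i≤j = sym (≈-unique-≤ i≤j (≤-trans j<p (m≤n+m p i)) (≈-sym e))

  _≈?_ : ∀ x y → Dec (x ≈ y)
  x ≈? y = map′ to from (ρ x ℕₚ.≟ ρ y)
    where
    to : ρ x ≡ ρ y → x ≈ y
    to e = ≈-trans (≈ρ x) (≈-trans (≡⇒≈ (cong +_ e)) (≈-sym (≈ρ y)))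
    from : x ≈ y → ρ x ≡ ρ y
    from e = ≈-unique (ρ<p x) (ρ<p y) (≈-trans (≈-sym (≈ρ x)) (≈-trans e (≈ρ y)))

  Per : (ℤ → ℕ) → Set
  Per g = ∀ {x y} → x ≈ y → g x ≡ g y

  S : (ℤ → ℕ) → ℕ
  S g = ∑ p (λ i → g (+ i))

  S-cong : ∀ {f g} → (∀ x → f x ≡ g x) → S f ≡ S g
  S-cong h = ∑-cong p λ i _ → h (+ i)

  S-mono : ∀ {f g} → (∀ x → f x ≤ g x) → S f ≤ S g
  S-mono h = ∑-mono p λ i _ → h (+ i)

  δ-total : ∀ c → ∑ p (λ i → 𝟙 (c ≈? + i)) ≡ 1
  δ-total c = ≤-antisym
    (∑-atMostOne p _ 1 (λ i _ → 𝟙≤1 (c ≈? + i))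
      λ i j i<p j<p a b → ≈-unique i<p j<p (≈-trans (≈-sym (𝟙-pos (c ≈? + i) a)) (𝟙-pos (c ≈? + j) b)))
    (≤-trans (≤-reflexive (sym (𝟙-true (c ≈? + ρ c) (≈ρ c)))) (∑-term p (λ i → 𝟙 (c ≈? + i)) (ρ c) (ρ<p c)))

  sift : ∀ {g} → Per g → ∀ c → ∑ p (λ i → 𝟙 (c ≈? + i) * g (+ i)) ≡ g c
  sift {g} per c = begin
    ∑ p (λ i → 𝟙 (c ≈? + i) * g (+ i)) ≡⟨ ∑-cong p (λ i _ → point i) ⟩
    ∑ p (λ i → 𝟙 (c ≈? + i) * g c)     ≡⟨ ∑-*ʳ p (g c) _ ⟩
    ∑ p (λ i → 𝟙 (c ≈? + i)) * g c     ≡⟨ cong (_* g c) (δ-total c) ⟩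
    1 * g c                            ≡⟨ *-identityˡ (g c) ⟩
    g c                                ∎
    where
    open ≡-Reasoning
    point : ∀ i → 𝟙 (c ≈? + i) * g (+ i) ≡ 𝟙 (c ≈? + i) * g c
    point i with c ≈? + i
    ... | yes e = cong (1 *_) (sym (per e))
    ... | no _  = refl

  -- Double counting: `sift` expands `g (φ x)` over its possible values, and after the swap each
  -- value is hit once, at the point given by `ψ`.
  S-bij : ∀ {g} → Per g → (φ ψ : ℤ → ℤ) → (∀ x y → φ x ≈ y → ψ y ≈ x) → (∀ x y → ψ y ≈ x → φ x ≈ y) →
          S (λ x → g (φ x)) ≡ S g
  S-bij {g} per φ ψ to from = begin
    S (λ x → g (φ x))                                            ≡⟨ ∑-cong p (λ i _ → sym (sift per (φ (+ i)))) ⟩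
    ∑ p (λ i → ∑ p (λ j → 𝟙 (φ (+ i) ≈? + j) * g (+ j)))         ≡⟨ ∑-swap p p _ ⟩
    ∑ p (λ j → ∑ p (λ i → 𝟙 (φ (+ i) ≈? + j) * g (+ j)))         ≡⟨ ∑-cong p (λ j _ → ∑-*ʳ p (g (+ j)) _) ⟩
    ∑ p (λ j → ∑ p (λ i → 𝟙 (φ (+ i) ≈? + j)) * g (+ j))         ≡⟨ ∑-cong p (λ j _ → fibre j) ⟩
    S g                                                          ∎
    where
    open ≡-Reasoning
    fibre : ∀ j → ∑ p (λ i → 𝟙 (φ (+ i) ≈? + j)) * g (+ j) ≡ g (+ j)
    fibre j = trans (cong (_* g (+ j)) (trans
      (∑-cong p λ i _ → 𝟙-cong (φ (+ i) ≈? + j) (ψ (+ j) ≈? + i) (to (+ i) (+ j)) (from (+ i) (+ j)))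
      (δ-total (ψ (+ j))))) (*-identityˡ (g (+ j)))

  S-shift : ∀ {g} → Per g → ∀ c → S (λ x → g (x ⊹ c)) ≡ S g
  S-shift per c = S-bij per (_⊹ c) (_⊝ c)
    (λ x y e → ≈-trans (≈-−ʳ c (≈-sym e)) (≡⇒≈ (aux₁ x c)))
    (λ x y e → ≈-trans (≈-+ʳ c (≈-sym e)) (≡⇒≈ (aux₂ y c)))
    where
    aux₁ : ∀ x c → x ⊹ c ⊝ c ≡ x
    aux₁ = ℤ-solve
    aux₂ : ∀ x c → x ⊝ c ⊹ c ≡ x
    aux₂ = ℤ-solve

  S-reflect : ∀ {g} → Per g → ∀ c → S (λ x → g (c ⊝ x)) ≡ S g
  S-reflect per c = S-bij per (c ⊝_) (c ⊝_)
    (λ x y e → ≈-trans (≈-−ˡ c (≈-sym e)) (≡⇒≈ (aux c x)))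
    (λ x y e → ≈-trans (≈-−ˡ c (≈-sym e)) (≡⇒≈ (aux c y)))
    where
    aux : ∀ c x → c ⊝ (c ⊝ x) ≡ x
    aux = ℤ-solve

  ∑-window : ∀ {g} → Per g → ∀ c n → n ≤ p → ∑ n (λ i → g (c ⊹ + i)) ≤ S g
  ∑-window {g} per c n n≤p = ≤-trans (∑-extend _ n≤p) (≤-reflexive
    (trans (S-cong λ x → cong g (ℤₚ.+-comm c x)) (S-shift per c)))

  -- Subsets of ℤ/pℤ are periodic predicates on ℤ, so that elements are computed in ℤ, where the
  -- ring solver applies.
  record ZSet : Set₁ where
    constructor zset
    field
      Mem  : ℤ → Set
      dec  : ∀ x → Dec (Mem x)
      resp : ∀ {x y} → x ≈ y → Mem x → Mem y

  open ZSet public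

  infix 4 _∈_ _∉_

  _∈_ _∉_ : ℤ → ZSet → Set
  x ∈ X = Mem X x
  x ∉ X = ¬ Mem X x

  χ : ZSet → ℤ → ℕ
  χ X x = 𝟙 (dec X x)

  χ-per : ∀ X → Per (χ X)
  χ-per X {x} {y} e = 𝟙-cong (dec X x) (dec X y) (resp X e) (resp X (≈-sym e))

  χ≤1 : ∀ X x → χ X x ≤ 1
  χ≤1 X x = 𝟙≤1 (dec X x)

  card : ZSet → ℕ
  card X = S (χ X)

  card≤p : ∀ X → card X ≤ p
  card≤p X = subst (card X ≤_) (*-identityʳ p) (∑-≤* p 1 _ λ i _ → χ≤1 X (+ i))

  card-mono : ∀ X Y → (∀ x → x ∈ X → x ∈ Y) → card X ≤ card Y
  card-mono X Y h = S-mono λ x → 𝟙-mono (dec X x) (dec Y x) (h x)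

  ∃? : (X : ZSet) → Dec (∃ λ x → x ∈ X)
  ∃? X = map′ (λ { (i , _ , m) → + i , m }) (λ { (x , m) → ρ x , ρ<p x , resp X (≈ρ x) m })
    (anyUpTo? (λ i → dec X (+ i)) p)

  card-pos : ∀ X x → x ∈ X → 0 < card X
  card-pos X x m = ≤-trans (≤-reflexive (sym (𝟙-true (dec X (+ ρ x)) (resp X (≈ρ x) m))))
    (∑-term p (λ i → χ X (+ i)) (ρ x) (ρ<p x))

  card-witness : ∀ X → 0 < card X → ∃ λ x → x ∈ X
  card-witness X lt with ∃? X
  ... | yes w = w
  ... | no ¬w = ⊥-elim (<⇒≢ lt (sym (∑-vanish p _ λ i _ → 𝟙-false (dec X (+ i)) λ m → ¬w (+ i , m))))

  singleton : ℤ → ZSet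
  singleton c = zset (_≈ c) (_≈? c) (λ e m → ≈-trans (≈-sym e) m)

  card-singleton : ∀ c → card (singleton c) ≡ 1
  card-singleton c = trans (S-cong λ x → 𝟙-cong (x ≈? c) (c ≈? x) ≈-sym ≈-sym) (δ-total c)

  infixl 6 _⊞_

  _⊞_ : ZSet → ZSet → ZSet
  X ⊞ Y = zset (λ x → ∃ λ y → y ∈ Y × x ⊝ y ∈ X)
    (λ x → ∃? (zset (λ y → y ∈ Y × x ⊝ y ∈ X) (λ y → dec Y y ×-dec dec X (x ⊝ y))
      λ { e (a , b) → resp Y e a , resp X (≈-−ˡ x e) b }))
    (λ { e (y , a , b) → y , a , resp X (≈-−ʳ y e) b })

  translate : ZSet → ℤ → ZSet
  translate X c = zset (λ x → x ⊹ c ∈ X) (λ x → dec X (x ⊹ c)) (λ e → resp X (≈-+ʳ c e))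

  card-translate : ∀ X c → card (translate X c) ≡ card X
  card-translate X c = S-shift (χ-per X) c

  leaving : ZSet → ℤ → ZSet
  leaving X d = zset (λ x → x ∈ X × x ⊹ d ∉ X) (λ x → dec X x ×-dec ¬? (dec X (x ⊹ d)))
    λ { e (a , b) → resp X e a , λ m → b (resp X (≈-+ʳ d (≈-sym e)) m) }

  staying : ZSet → ℤ → ZSet
  staying X d = zset (λ x → x ∈ X × x ⊹ d ∈ X) (λ x → dec X x ×-dec dec X (x ⊹ d))
    λ { e (a , b) → resp X e a , resp X (≈-+ʳ d e) b }

  -- lam X d = |(X + d) ∖ X|
  lam : ZSet → ℤ → ℕ
  lam X d = card (leaving X d)

  rep : ZSet → ℤ → ℕ
  rep X d = card (staying X d)

  lam+rep : ∀ X d → lam X d + rep X d ≡ card X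
  lam+rep X d = trans (sym (∑-+ p _ _)) (S-cong point)
    where
    point : ∀ x → χ (leaving X d) x + χ (staying X d) x ≡ χ X x
    point x with dec X x | dec X (x ⊹ d)
    ... | yes _ | yes _ = refl
    ... | yes _ | no _  = refl
    ... | no _  | _     = refl

  lam-resp : ∀ X {d e} → d ≈ e → lam X d ≡ lam X e
  lam-resp X {d} {e} d≈e = S-cong λ x → 𝟙-cong (dec (leaving X d) x) (dec (leaving X e) x)
    (λ { (a , b) → a , λ m → b (resp X (≈-+ˡ x (≈-sym d≈e)) m) })
    (λ { (a , b) → a , λ m → b (resp X (≈-+ˡ x d≈e) m) })

  -- A point that leaves X under d + e leaves under d already, or d takes it to a point of X that
  -- leaves under e.
  lam-subadd : ∀ X d e → lam X (d ⊹ e) ≤ lam X d + lam X e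
  lam-subadd X d e = ≤-trans (S-mono point) (≤-reflexive (trans (∑-+ p _ _)
      (cong (_+_ (lam X d)) (S-shift (χ-per (leaving X e)) d))))
    where
    aux : ∀ x d e → x ⊹ d ⊹ e ≡ x ⊹ (d ⊹ e)
    aux = ℤ-solve
    point : ∀ x → χ (leaving X (d ⊹ e)) x ≤ χ (leaving X d) x + χ (leaving X e) (x ⊹ d)
    point x with dec X x | dec X (x ⊹ d) | dec X (x ⊹ (d ⊹ e)) | dec X (x ⊹ d ⊹ e)
    ... | no _  | _     | _     | _     = z≤n
    ... | yes _ | _     | yes _ | _     = z≤n
    ... | yes _ | no _  | no _  | _     = s≤s z≤n
    ... | yes _ | yes _ | no _  | no _  = s≤s z≤n
    ... | yes _ | yes _ | no ¬a | yes a = ⊥-elim (¬a (resp X (≡⇒≈ (aux x d e)) a))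

  rep-neg : ∀ X d → rep X (⊖ d) ≡ rep X d
  rep-neg X d = trans (S-cong point) (S-shift (χ-per (staying X d)) (⊖ d))
    where
    aux : ∀ x d → x ⊹ ⊖ d ⊹ d ≡ x
    aux = ℤ-solve
    point : ∀ x → χ (staying X (⊖ d)) x ≡ χ (staying X d) (x ⊹ ⊖ d)
    point x = 𝟙-cong (dec (staying X (⊖ d)) x) (dec (staying X d) (x ⊹ ⊖ d))
      (λ { (a , b) → b , resp X (≡⇒≈ (sym (aux x d))) a })
      (λ { (a , b) → resp X (≡⇒≈ (aux x d)) b , a })

  lam-neg : ∀ X d → lam X (⊖ d) ≡ lam X d
  lam-neg X d = +-cancelʳ-≡ (rep X d) (lam X (⊖ d)) (lam X d)
    (trans (cong (_+_ (lam X (⊖ d))) (sym (rep-neg X d))) (trans (lam+rep X (⊖ d)) (sym (lam+rep X d))))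

  -- Each ordered pair of elements of X is counted once, at its difference.
  ∑-rep : ∀ X → S (rep X) ≡ card X * card X
  ∑-rep X = begin
    ∑ p (λ d → ∑ p (λ i → χ (staying X (+ d)) (+ i)))       ≡⟨ ∑-swap p p _ ⟩
    ∑ p (λ i → ∑ p (λ d → χ (staying X (+ d)) (+ i)))       ≡⟨ ∑-cong p (λ i _ → row i) ⟩
    ∑ p (λ i → χ X (+ i) * card X)                          ≡⟨ ∑-*ʳ p (card X) _ ⟩
    card X * card X                                         ∎
    where
    open ≡-Reasoning
    product : ∀ x d → χ (staying X d) x ≡ χ X x * χ X (x ⊹ d)
    product x d with dec X x | dec X (x ⊹ d)
    ... | yes _ | yes _ = refl
    ... | yes _ | no _  = refl
    ... | no _  | _     = refl
    row : ∀ i → ∑ p (λ d → χ (staying X (+ d)) (+ i)) ≡ χ X (+ i) * card X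
    row i = trans (∑-cong p λ d _ → product (+ i) (+ d)) (trans (∑-*ˡ p (χ X (+ i)) _)
      (cong (_*_ (χ X (+ i))) (trans (S-cong λ d → cong (χ X) (ℤₚ.+-comm (+ i) d)) (S-shift (χ-per X) (+ i)))))

  pow : ZSet → ℕ → ZSet
  pow X zero    = singleton (+ 0)
  pow X (suc j) = pow X j ⊞ X

  pow-intro : ∀ X i j {x y} → x ∈ pow X i → y ∈ pow X j → x ⊹ y ∈ pow X (i + j)
  pow-intro X i zero    {x} {y} a b = subst (λ k → x ⊹ y ∈ pow X k) (sym (+-identityʳ i))
    (resp (pow X i) (≈-trans (≡⇒≈ (sym (ℤₚ.+-identityʳ x))) (≈-+ˡ x (≈-sym b))) a)
  pow-intro X i (suc j) {x} {y} a (z , m , b) = subst (λ k → x ⊹ y ∈ pow X k) (sym (+-suc i j))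
    (z , m , resp (pow X (i + j)) (≡⇒≈ (aux x y z)) (pow-intro X i j a b))
    where
    aux : ∀ x y z → x ⊹ (y ⊝ z) ≡ x ⊹ y ⊝ z
    aux = ℤ-solve

  pow-elim : ∀ X i j {x} → x ∈ pow X (i + j) → ∃ λ y → y ∈ pow X i × x ⊝ y ∈ pow X j
  pow-elim X i zero    {x} m = x , subst (λ k → x ∈ pow X k) (+-identityʳ i) m , ≡⇒≈ (aux x)
    where
    aux : ∀ x → x ⊝ x ≡ + 0
    aux = ℤ-solve
  pow-elim X i (suc j) {x} m with subst (λ k → x ∈ pow X k) (+-suc i j) m
  ... | z , zX , b with pow-elim X i j b
  ...   | y , yX , c = y , yX , z , zX , resp (pow X j) (≡⇒≈ (aux x y z)) c
    where
    aux : ∀ x y z → x ⊝ z ⊝ y ≡ x ⊝ y ⊝ z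
    aux = ℤ-solve

  lam-zero : ∀ X {d} → d ≈ + 0 → lam X d ≡ 0
  lam-zero X m = trans (lam-resp X m) (∑-vanish p _ λ i _ → 𝟙-false (dec (leaving X (+ 0)) (+ i))
    λ { (a , b) → b (resp X (≡⇒≈ (sym (ℤₚ.+-identityʳ (+ i)))) a) })

  lam-pow : ∀ X D w → (∀ d → d ∈ D → lam X d ≤ w) → ∀ j d → d ∈ pow D j → lam X d ≤ j * w
  lam-pow X D w h zero    d m = ≤-reflexive (lam-zero X m)
  lam-pow X D w h (suc j) d (y , yD , m) = subst (_≤ w + j * w) (cong (lam X) (aux d y))
    (≤-trans (lam-subadd X y (d ⊝ y)) (+-mono-≤ (h y yD) (lam-pow X D w h j (d ⊝ y) m)))
    where
    aux : ∀ d y → y ⊹ (d ⊝ y) ≡ d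
    aux = ℤ-solve

-- The Cauchy–Davenport theorem

module PrimeResidues (p : ℕ) .{{nz : NonZero p}} (pr : Prime p) where

  open Residues p public

  inverse : ∀ c → ¬ c ≈ + 0 → ∃ λ c′ → c · c′ ≈ + 1
  inverse c c≉0 = find (ρ c) (≈ρ c) (ρ<p c)
    where
    find : ∀ n → c ≈ + n → n < p → ∃ λ c′ → c · c′ ≈ + 1
    find zero    e _   = ⊥-elim (c≉0 e)
    find (suc n) e lt with coprime-Bézout (prime⇒coprime pr lt)
    ... | Bézout.+- x y eq = ⊖ + y , ≈-trans (≈-* e ≈-refl) (mod≈ (⊖ + x) (begin
        + suc n · ⊖ + y                   ≡⟨ aux (+ suc n) (+ y) ⟩
        + 1 ⊝ (+ 1 ⊹ + y · + suc n)       ≡⟨ cong (_⊝_ (+ 1)) lift ⟩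
        + 1 ⊝ + x · P                     ≡⟨ aux′ (+ x) P ⟩
        + 1 ⊹ ⊖ + x · P                   ∎))
      where
      open ≡-Reasoning
      aux : ∀ a b → a · ⊖ b ≡ + 1 ⊝ (+ 1 ⊹ b · a)
      aux = ℤ-solve
      aux′ : ∀ a b → + 1 ⊝ a · b ≡ + 1 ⊹ ⊖ a · b
      aux′ = ℤ-solve
      lift : + 1 ⊹ + y · + suc n ≡ + x · P
      lift = trans (cong (_⊹_ (+ 1)) (sym (ℤₚ.pos-* y (suc n)))) (trans (cong +_ eq) (ℤₚ.pos-* x p))
    ... | Bézout.-+ x y eq = + y , ≈-trans (≈-* e ≈-refl) (mod≈ (+ x) (begin
        + suc n · + y                     ≡⟨ ℤₚ.*-comm (+ suc n) (+ y) ⟩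
        + y · + suc n                     ≡⟨ sym (ℤₚ.pos-* y (suc n)) ⟩
        + (y * suc n)                     ≡⟨ cong +_ (sym eq) ⟩
        + 1 ⊹ + (x * p)                   ≡⟨ cong (_⊹_ (+ 1)) (ℤₚ.pos-* x p) ⟩
        + 1 ⊹ + x · P                     ∎))
      where open ≡-Reasoning

  -- Since δ generates the group, a proper nonempty subset is not invariant under translation by δ.
  leaving-point : ∀ X δ → ¬ δ ≈ + 0 → ∀ {a b} → a ∈ X → b ∉ X → ∃ λ x → x ∈ X × x ⊹ δ ∉ X
  leaving-point X δ δ≉0 {a} {b} aX b∉X with ∃? (leaving X δ)
  ... | yes w = w
  ... | no ¬w = ⊥-elim (b∉X (resp X reach (orbit (ρ c))))
    where
    δ′ : ℤ
    δ′ = proj₁ (inverse δ δ≉0)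
    c : ℤ
    c = δ′ · (b ⊝ a)
    closed : ∀ x → x ∈ X → x ⊹ δ ∈ X
    closed x m with dec X (x ⊹ δ)
    ... | yes m′ = m′
    ... | no ¬m′ = ⊥-elim (¬w (x , m , ¬m′))
    orbit : ∀ i → a ⊹ + i · δ ∈ X
    orbit zero    = resp X (≡⇒≈ (aux a δ)) aX
      where
      aux : ∀ a δ → a ≡ a ⊹ + 0 · δ
      aux = ℤ-solve
    orbit (suc i) = resp X (≡⇒≈ (aux a δ (+ i))) (closed _ (orbit i))
      where
      aux : ∀ a δ i → a ⊹ i · δ ⊹ δ ≡ a ⊹ (+ 1 ⊹ i) · δ
      aux = ℤ-solve
    reach : a ⊹ + ρ c · δ ≈ b
    reach = ≈-trans (≈-+ˡ a (≈-trans (≈-* (≈-sym (≈ρ c)) (≈-refl {δ})) (≈-trans (≡⇒≈ (aux δ′ (b ⊝ a) δ))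
              (≈-* (proj₂ (inverse δ δ≉0)) (≈-refl {b ⊝ a}))))) (≡⇒≈ (aux′ a b))
      where
      aux : ∀ x y δ → x · y · δ ≡ δ · x · y
      aux = ℤ-solve
      aux′ : ∀ a b → a ⊹ + 1 · (b ⊝ a) ≡ b
      aux′ = ℤ-solve

  card-strict : ∀ X Y → (∀ x → x ∈ X → x ∈ Y) → ∀ {y} → y ∈ Y → y ∉ X → card X < card Y
  card-strict X Y h {y} yY y∉X = begin-strict
    card X                                         <⟨ n<1+n _ ⟩
    1 + card X                                     ≡⟨ cong (_+ card X) (sym (δ-total y)) ⟩
    ∑ p (λ i → 𝟙 (y ≈? + i)) + card X              ≡⟨ sym (∑-+ p _ _) ⟩
    ∑ p (λ i → 𝟙 (y ≈? + i) + χ X (+ i))           ≤⟨ ∑-mono p (λ i _ → point (+ i)) ⟩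
    card Y                                         ∎
    where
    open ℕₚ.≤-Reasoning
    point : ∀ x → 𝟙 (y ≈? x) + χ X x ≤ χ Y x
    point x with y ≈? x | dec X x | dec Y x
    ... | yes e | yes m | _     = ⊥-elim (y∉X (resp X (≈-sym e) m))
    ... | yes e | no _  | yes _ = s≤s z≤n
    ... | yes e | no _  | no ¬m = ⊥-elim (¬m (resp Y e yY))
    ... | no _  | yes m | yes _ = s≤s z≤n
    ... | no _  | yes m | no ¬m = ⊥-elim (¬m (h x m))
    ... | no _  | no _  | _     = z≤n

  full : ∀ X → (∀ x → x ∈ X) → p ≤ card X
  full X h = ≤-trans (≤-reflexive (sym (*-identityʳ p)))
    (∑-≥* p 1 _ λ i _ → ≤-reflexive (sym (𝟙-true (dec X (+ i)) (h (+ i)))))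

  -- Dyson's e-transform: X ∪ (Y + e) and Y ∩ (X - e) have the same total size as X and Y, and their
  -- sumset is not larger.
  dyson-∪ : ZSet → ZSet → ℤ → ZSet
  dyson-∪ X Y e = zset (λ v → v ∈ X ⊎ v ⊝ e ∈ Y) (λ v → dec X v ⊎-dec dec Y (v ⊝ e))
    λ { q (inj₁ m) → inj₁ (resp X q m) ; q (inj₂ m) → inj₂ (resp Y (≈-−ʳ e q) m) }

  dyson-∩ : ZSet → ZSet → ℤ → ZSet
  dyson-∩ X Y e = zset (λ y → y ∈ Y × y ⊹ e ∈ X) (λ y → dec Y y ×-dec dec X (y ⊹ e))
    λ { q (a , b) → resp Y q a , resp X (≈-+ʳ e q) b }

  dyson-card : ∀ X Y e → card (dyson-∪ X Y e) + card (dyson-∩ X Y e) ≡ card X + card Y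
  dyson-card X Y e = begin
    card X′ + card Y′                                  ≡⟨ cong (_+_ (card X′)) (sym (S-shift (χ-per Y′) (⊖ e))) ⟩
    card X′ + S (λ v → χ Y′ (v ⊝ e))                   ≡⟨ sym (∑-+ p _ _) ⟩
    S (λ v → χ X′ v + χ Y′ (v ⊝ e))                    ≡⟨ S-cong point ⟩
    S (λ v → χ X v + χ Y (v ⊝ e))                      ≡⟨ ∑-+ p _ _ ⟩
    card X + S (λ v → χ Y (v ⊝ e))                     ≡⟨ cong (_+_ (card X)) (S-shift (χ-per Y) (⊖ e)) ⟩
    card X + card Y                                    ∎
    where
    open ≡-Reasoning
    X′ Y′ : ZSet
    X′ = dyson-∪ X Y e
    Y′ = dyson-∩ X Y e
    aux : ∀ v e → v ⊝ e ⊹ e ≡ v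
    aux = ℤ-solve
    point : ∀ v → χ X′ v + χ Y′ (v ⊝ e) ≡ χ X v + χ Y (v ⊝ e)
    point v with dec X v | dec Y (v ⊝ e) | dec X (v ⊝ e ⊹ e)
    ... | yes _ | yes _ | yes _ = refl
    ... | yes m | yes _ | no ¬m = ⊥-elim (¬m (resp X (≡⇒≈ (sym (aux v e))) m))
    ... | yes _ | no _  | _     = refl
    ... | no ¬m | yes _ | yes m = ⊥-elim (¬m (resp X (≡⇒≈ (aux v e)) m))
    ... | no _  | yes _ | no _  = refl
    ... | no _  | no _  | _     = refl

  private
    -- Induction on a bound for |Y|. If Y contains y₀ and y₁ and X is proper, some x ∈ X has x + (y₁
    -- - y₀) outside X; the transform with e = x - y₀ keeps y₀ in the second set and removes y₁.
    CD-fuel : ∀ k X Y → card Y ≤ k → 0 < card X → 0 < card Y →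
      card X + card Y ≤ card (X ⊞ Y) + 1 ⊎ p ≤ card (X ⊞ Y)
    CD-fuel zero    X Y le _ pos = ⊥-elim (<⇒≱ pos le)
    CD-fuel (suc k) X Y le posX posY with card-witness Y posY
    ... | y₀ , y₀Y with ∃? (zset (λ y → y ∈ Y × ¬ y ≈ y₀) (λ y → dec Y y ×-dec ¬? (y ≈? y₀))
                        λ { q (a , b) → resp Y q a , λ c → b (≈-trans q c) })
    ...   | no only = inj₁ (+-mono-≤ X≤ Y≤1)
      where
      Y≤1 : card Y ≤ 1
      Y≤1 = subst (card Y ≤_) (card-singleton y₀) (card-mono Y (singleton y₀) inside)
        where
        inside : ∀ x → x ∈ Y → x ≈ y₀
        inside x m with x ≈? y₀
        ... | yes e = e
        ... | no ¬e = ⊥-elim (only (x , m , ¬e))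
      X≤ : card X ≤ card (X ⊞ Y)
      X≤ = subst (_≤ card (X ⊞ Y)) (card-translate X (⊖ y₀))
        (card-mono (translate X (⊖ y₀)) (X ⊞ Y) λ x m → y₀ , y₀Y , m)
    ...   | yes (y₁ , y₁Y , y₁≉y₀) with ∃? (zset (_∉ X) (λ x → ¬? (dec X x)) λ q ∉ m → ∉ (resp X (≈-sym q) m))
    ...     | no all = inj₂ (full (X ⊞ Y) λ x → y₀ , y₀Y , inside (x ⊝ y₀))
      where
      inside : ∀ x → x ∈ X
      inside x with dec X x
      ... | yes m = m
      ... | no ¬m = ⊥-elim (all (x , ¬m))
    ...     | yes (b , b∉X) with card-witness X posX
    ...       | a , aX with leaving-point X (y₁ ⊝ y₀) δ≉0 aX b∉X
      where
      aux : ∀ y₁ y₀ → y₁ ≡ y₁ ⊝ y₀ ⊹ y₀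
      aux = ℤ-solve
      δ≉0 : ¬ y₁ ⊝ y₀ ≈ + 0
      δ≉0 q = y₁≉y₀ (≈-trans (≡⇒≈ (aux y₁ y₀)) (≈-trans (≈-+ʳ y₀ q) (≡⇒≈ (ℤₚ.+-identityˡ y₀))))
    ...         | x , xX , x∉ = conclude (CD-fuel k X′ Y′ le′
                                   (≤-trans posX (card-mono X X′ λ _ → inj₁)) (card-pos Y′ y₀ y₀Y′))
      where
      e : ℤ
      e = x ⊝ y₀
      X′ Y′ : ZSet
      X′ = dyson-∪ X Y e
      Y′ = dyson-∩ X Y e
      aux₁ : ∀ x y₀ → x ≡ y₀ ⊹ (x ⊝ y₀)
      aux₁ = ℤ-solve
      aux₂ : ∀ x y₀ y₁ → y₁ ⊹ (x ⊝ y₀) ≡ x ⊹ (y₁ ⊝ y₀)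
      aux₂ = ℤ-solve
      y₀Y′ : y₀ ∈ Y′
      y₀Y′ = y₀Y , resp X (≡⇒≈ (aux₁ x y₀)) xX
      le′ : card Y′ ≤ k
      le′ = ℕ.s≤s⁻¹ (≤-trans (card-strict Y′ Y (λ _ → proj₁) y₁Y
              λ { (_ , m) → x∉ (resp X (≡⇒≈ (aux₂ x y₀ y₁)) m) }) le)
      aux₃ : ∀ v y e → v ⊝ y ⊝ e ≡ v ⊝ (y ⊹ e)
      aux₃ = ℤ-solve
      aux₄ : ∀ v y e → y ⊹ e ≡ v ⊝ (v ⊝ y ⊝ e)
      aux₄ = ℤ-solve
      sub : ∀ v → v ∈ X′ ⊞ Y′ → v ∈ X ⊞ Y
      sub v (y , (yY , ye) , inj₁ m) = y , yY , m
      sub v (y , (yY , ye) , inj₂ m) = v ⊝ y ⊝ e , m , resp X (≡⇒≈ (aux₄ v y e)) ye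
      conclude : card X′ + card Y′ ≤ card (X′ ⊞ Y′) + 1 ⊎ p ≤ card (X′ ⊞ Y′) →
                 card X + card Y ≤ card (X ⊞ Y) + 1 ⊎ p ≤ card (X ⊞ Y)
      conclude (inj₁ h) = inj₁ (subst (_≤ card (X ⊞ Y) + 1) (dyson-card X Y e)
        (≤-trans h (+-monoˡ-≤ 1 (card-mono (X′ ⊞ Y′) (X ⊞ Y) sub))))
      conclude (inj₂ h) = inj₂ (≤-trans h (card-mono (X′ ⊞ Y′) (X ⊞ Y) sub))

  cauchy-davenport : ∀ X Y → 0 < card X → 0 < card Y →
    card X + card Y ≤ card (X ⊞ Y) + 1 ⊎ p ≤ card (X ⊞ Y)
  cauchy-davenport X Y = CD-fuel (card Y) X Y ≤-refl

  pow-⊞ : ∀ D i j → card (pow D i ⊞ pow D j) ≤ card (pow D (i + j))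
  pow-⊞ D i j = card-mono (pow D i ⊞ pow D j) (pow D (i + j))
    λ { x (y , b , a) → resp (pow D (i + j)) (≡⇒≈ (aux x y)) (pow-intro D i j a b) }
    where
    aux : ∀ x y → x ⊝ y ⊹ y ≡ x
    aux = ℤ-solve

  -- Iterated Cauchy-Davenport. A saturated sumset has p elements, and then `i * c + 1 ≤ p`
  -- finishes.
  pow-growth : ∀ D j c → c + 1 ≤ card (pow D j) → ∀ i → i * c + 1 ≤ p → i * c + 1 ≤ card (pow D (i * j))
  pow-growth D j c h zero    _  = ≤-reflexive (sym (card-singleton (+ 0)))
  pow-growth D j c h (suc i) le =
    conclude (cauchy-davenport (pow D j) (pow D (i * j)) (≤-trans (m≤n+m 1 c) h) (≤-trans (m≤n+m 1 (i * c)) ih))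
    where
    ih : i * c + 1 ≤ card (pow D (i * j))
    ih = pow-growth D j c h i (≤-trans (+-monoˡ-≤ 1 (m≤n+m (i * c) c)) le)
    arith : ∀ c d x y z → c + d + 1 + (x + y + (z + 1)) + 0 ≡ z + (c + 1 + (d + 1) + (x + y))
    arith = ℕ-solve
    conclude : card (pow D j) + card (pow D (i * j)) ≤ card (pow D j ⊞ pow D (i * j)) + 1 ⊎ p ≤ card (pow D j ⊞ pow D (i * j)) →
               suc i * c + 1 ≤ card (pow D (suc i * j))
    conclude (inj₂ all) = ≤-trans le (≤-trans all (pow-⊞ D j (i * j)))
    conclude (inj₁ big) = ≤-cancel 0 (+-mono-≤ (+-mono-≤ h ih) (≤-trans big (+-monoˡ-≤ 1 (pow-⊞ D j (i * j)))))
      (arith c (i * c) (card (pow D j)) (card (pow D (i * j))) (card (pow D (j + i * j))))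

  dilate : ZSet → ℤ → ZSet
  dilate X h = zset (λ x → x · h ∈ X) (λ x → dec X (x · h)) (λ e → resp X (≈-* e (≈-refl {h})))

  S-dilate : ∀ {g} → Per g → ∀ h → ¬ h ≈ + 0 → S (λ x → g (x · h)) ≡ S g
  S-dilate per h h≉0 with inverse h h≉0
  ... | h′ , hh′≈1 = S-bij per (_· h) (_· h′)
    (λ x y q → ≈-trans (≈-* (≈-sym q) (≈-refl {h′})) (≈-trans (≡⇒≈ (aux₁ x h h′))
      (≈-trans (≈-* hh′≈1 (≈-refl {x})) (≡⇒≈ (ℤₚ.*-identityˡ x)))))
    (λ x y q → ≈-trans (≈-* (≈-sym q) (≈-refl {h})) (≈-trans (≡⇒≈ (aux₂ y h h′))
      (≈-trans (≈-* hh′≈1 (≈-refl {y})) (≡⇒≈ (ℤₚ.*-identityˡ y)))))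
    where
    aux₁ : ∀ x h h′ → x · h · h′ ≡ h · h′ · x
    aux₁ = ℤ-solve
    aux₂ : ∀ x h h′ → x · h′ · h ≡ h · h′ · x
    aux₂ = ℤ-solve

  card-dilate : ∀ X h → ¬ h ≈ + 0 → card (dilate X h) ≡ card X
  card-dilate X = S-dilate (χ-per X)

  lam-dilate : ∀ X h → ¬ h ≈ + 0 → ∀ d → lam (dilate X h) d ≡ lam X (d · h)
  lam-dilate X h h≉0 d = trans (S-cong point) (S-dilate (χ-per (leaving X (d · h))) h h≉0)
    where
    aux : ∀ x d h → (x ⊹ d) · h ≡ x · h ⊹ d · h
    aux = ℤ-solve
    point : ∀ x → χ (leaving (dilate X h) d) x ≡ χ (leaving X (d · h)) (x · h)
    point x = 𝟙-cong (dec (leaving (dilate X h) d) x) (dec (leaving X (d · h)) (x · h))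
      (λ { (a , b) → a , λ m → b (resp X (≡⇒≈ (sym (aux x d h))) m) })
      (λ { (a , b) → a , λ m → b (resp X (≡⇒≈ (aux x d h)) m) })

-- Growth of the balls jD

private
  -- Arithmetic of the Abel summation. N = n - Kw is the representation count left on the K-th ball,
  -- E its size and Σ the total size of the earlier balls. Growth by b per step gives Kb(n + N) ≤
  -- 2n² + 2nw, and Kb > 2n - b turns this into N < w + b.
  abel-bound : ∀ n N K w b E Σ → N + K * w ≡ n → n * E + w * Σ ≤ n * n + K * w * E → K * b ≤ E →
    K * K * b ≤ 2 * Σ + K * b → K * b ≤ 2 * n → 2 * n < K * b + b → N < w + b
  abel-bound n N K w b E Σ refl h₂ h₃ h₄ h₅ h₆ = ≰⇒> λ w+b≤N → <-irrefl refl (begin-strict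
    2 * n * (n + N)                     <⟨ *-monoˡ-< (n + N) {{ℕ.>-nonZero (pos w+b≤N)}} h₆ ⟩
    (K * b + b) * (n + N)               ≡⟨ *-distribʳ-+ (n + N) (K * b) b ⟩
    K * b * (n + N) + b * (n + N)       ≤⟨ +-mono-≤ step₂ (*-monoʳ-≤ b (+-monoʳ-≤ n (m≤m+n N (K * w)))) ⟩
    2 * n * n + w * (2 * n) + b * (n + n) ≡⟨ arith₃ n w b ⟩
    2 * n * n + 2 * n * (w + b)         ≤⟨ +-monoʳ-≤ (2 * n * n) (*-monoʳ-≤ (2 * n) w+b≤N) ⟩
    2 * n * n + 2 * n * N               ≡⟨ sym (*-distribˡ-+ (2 * n) n N) ⟩
    2 * n * (n + N)                     ∎)
    where
    open ℕₚ.≤-Reasoning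
    arith₃ : ∀ n w b → 2 * n * n + w * (2 * n) + b * (n + n) ≡ 2 * n * n + 2 * n * (w + b)
    arith₃ = ℕ-solve
    b-pos : 0 < b
    b-pos = +-cancelˡ-< (K * b) 0 b (≤-<-trans (≤-reflexive (+-identityʳ (K * b))) (≤-<-trans h₅ h₆))
    pos : w + b ≤ N → 0 < n + N
    pos le = ≤-trans b-pos (≤-trans (m≤n+m b w) (≤-trans le (m≤n+m N n)))
    step₁ : N * E + w * Σ ≤ n * n
    step₁ = ≤-cancel 0 h₂ (arith N K w E Σ (n * n))
      where
      arith : ∀ N K w E Σ nn → N * E + w * Σ + (nn + K * w * E) + 0 ≡ nn + ((N + K * w) * E + w * Σ)
      arith = ℕ-solve
    step₂ : K * b * (n + N) ≤ 2 * n * n + w * (2 * n)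
    step₂ = begin
      K * b * (n + N)                             ≡⟨ arith N K w b ⟩
      2 * N * (K * b) + w * (K * K * b)           ≤⟨ +-mono-≤ (*-monoʳ-≤ (2 * N) h₃) (*-monoʳ-≤ w h₄) ⟩
      2 * N * E + w * (2 * Σ + K * b)             ≡⟨ arith′ N E w Σ (K * b) ⟩
      2 * (N * E + w * Σ) + w * (K * b)           ≤⟨ +-mono-≤ (*-monoʳ-≤ 2 step₁) (*-monoʳ-≤ w h₅) ⟩
      2 * (n * n) + w * (2 * n)                   ≡⟨ cong (_+ w * (2 * n)) (sym (*-assoc 2 n n)) ⟩
      2 * n * n + w * (2 * n)                     ∎
      where
      arith : ∀ N K w b → K * b * (N + K * w + N) ≡ 2 * N * (K * b) + w * (K * K * b)
      arith = ℕ-solve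
      arith′ : ∀ N E w Σ k → 2 * N * E + w * (2 * Σ + k) ≡ 2 * (N * E + w * Σ) + w * k
      arith′ = ℕ-solve

  qN-bound : ∀ n N kw q → N + kw ≡ n → kw * q + n ≤ q * n → n ≤ q * N
  qN-bound n N kw q refl h = ≤-cancel 0 h (arith N kw q)
    where
    arith : ∀ N kw q → N + kw + q * (N + kw) + 0 ≡ q * N + (kw * q + (N + kw))
    arith = ℕ-solve

module Balls (p : ℕ) .{{nz : NonZero p}} (pr : Prime p)
  (D : Residues.ZSet p) (0∈D : Residues.Mem D (+ 0)) (neg∈D : ∀ d → Residues.Mem D d → Residues.Mem D (⊖ d)) where

  open PrimeResidues p pr public

  -- Abstract, so that balls of numeral radius are never unfolded.
  abstract
    B : ℕ → ZSet
    B = pow D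

    B⇒pow : ∀ j {x} → x ∈ B j → x ∈ pow D j
    B⇒pow j m = m

    pow⇒B : ∀ j {x} → x ∈ pow D j → x ∈ B j
    pow⇒B j m = m

  card-B : ∀ j → card (B j) ≡ card (pow D j)
  card-B j = ≤-antisym (card-mono (B j) (pow D j) λ _ → B⇒pow j) (card-mono (pow D j) (B j) λ _ → pow⇒B j)

  B-zero : ∀ {x} → x ≈ + 0 → x ∈ B 0
  B-zero = pow⇒B 0

  zero-B : ∀ {x} → x ∈ B 0 → x ≈ + 0
  zero-B = B⇒pow 0

  B-+ : ∀ i j {x y} → x ∈ B i → y ∈ B j → x ⊹ y ∈ B (i + j)
  B-+ i j a b = pow⇒B (i + j) (pow-intro D i j (B⇒pow i a) (B⇒pow j b))

  B-split : ∀ i j {x} → x ∈ B (i + j) → ∃ λ y → y ∈ B i × x ⊝ y ∈ B j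
  B-split i j m with pow-elim D i j (B⇒pow (i + j) m)
  ... | y , a , b = y , pow⇒B i a , pow⇒B j b

  B-one : ∀ {x} → x ∈ D → x ∈ B 1
  B-one {x} m = pow⇒B 1 (x , m , ≡⇒≈ (ℤₚ.+-inverseʳ x))

  one-B : ∀ {x} → x ∈ B 1 → x ∈ D
  one-B {x} m with B⇒pow 1 m
  ... | y , yD , e = resp D (≈-sym (≈-trans (≡⇒≈ (aux x y)) (≈-trans (≈-+ʳ y e) (≡⇒≈ (ℤₚ.+-identityˡ y))))) yD
    where
    aux : ∀ x y → x ≡ x ⊝ y ⊹ y
    aux = ℤ-solve

  B-mono : ∀ {i j} → i ≤ j → ∀ {x} → x ∈ B i → x ∈ B j
  B-mono {i} {j} i≤j {x} m = subst (λ k → x ∈ B k) (m+[n∸m]≡n i≤j) (go (j ∸ i))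
    where
    go : ∀ k → x ∈ B (i + k)
    go zero    = subst (λ k → x ∈ B k) (sym (+-identityʳ i)) m
    go (suc k) = subst (λ k → x ∈ B k) (trans (+-comm (i + k) 1) (sym (+-suc i k)))
      (resp (B (i + k + 1)) (≡⇒≈ (ℤₚ.+-identityʳ x)) (B-+ (i + k) 1 (go k) (B-one 0∈D)))

  B-neg : ∀ j {x} → x ∈ B j → ⊖ x ∈ B j
  B-neg zero    m = B-zero (≈-neg (zero-B m))
  B-neg (suc j) {x} m with B-split 1 j m
  ... | y , yB , m′ = resp (B (suc j)) (≡⇒≈ (aux x y)) (B-+ 1 j (B-one (neg∈D y (one-B yB))) (B-neg j m′))
    where
    aux : ∀ x y → ⊖ y ⊹ ⊖ (x ⊝ y) ≡ ⊖ x
    aux = ℤ-solve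

  B-− : ∀ i j {x y} → x ∈ B i → y ∈ B j → x ⊝ y ∈ B (i + j)
  B-− i j a b = B-+ i j a (B-neg j b)

  B-multiple : ∀ i {x} → x ∈ B i → ∀ k → + k · x ∈ B (k * i)
  B-multiple i {x} m zero    = B-zero (≡⇒≈ (ℤₚ.*-zeroˡ x))
  B-multiple i {x} m (suc k) = resp (B (i + k * i)) (≡⇒≈ (aux x (+ k))) (B-+ i (k * i) m (B-multiple i m k))
    where
    aux : ∀ x k → x ⊹ k · x ≡ (+ 1 ⊹ k) · x
    aux = ℤ-solve

  B-multipleℤ : ∀ i {x} → x ∈ B i → ∀ k → k · x ∈ B (abs k * i)
  B-multipleℤ i {x} m (+ k)    = B-multiple i m k
  B-multipleℤ i {x} m -[1+ k ] = resp (B (suc k * i)) (≡⇒≈ (aux (+ suc k) x)) (B-neg (suc k * i) (B-multiple i m (suc k)))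
    where
    aux : ∀ k x → ⊖ (k · x) ≡ ⊖ k · x
    aux = ℤ-solve

  -- Abel summation of n² = Σ rep over the balls j-fold, 2j-fold, ...: the representation
  -- counts on the i-th ball are at least n − iw, and the balls grow linearly.
  module Upper (A : ZSet) (u : ℕ) (0<u : 0 < u) (lam≤u : ∀ d → d ∈ D → lam A d ≤ u)
    (2n<p : 2 * card A < p) (j : ℕ) (big : (2 * j + 1) * (3 * j + 1) * u < card A) where

    private
      n b w : ℕ
      n = card A
      b = (2 * j + 1) * u
      w = j * u

      e : ℕ → ℕ
      e i = card (B (i * j))

      s : ℕ → ℕ
      s i = S (λ x → χ (B (i * j)) x * rep A x)

      rep-large : ∀ i x → x ∈ B (i * j) → n ≤ rep A x + i * w
      rep-large i x m = begin
        n                            ≡⟨ sym (lam+rep A x) ⟩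
        lam A x + rep A x            ≡⟨ +-comm (lam A x) (rep A x) ⟩
        rep A x + lam A x            ≤⟨ +-monoʳ-≤ (rep A x) (lam-pow A D u lam≤u (i * j) x (B⇒pow (i * j) m)) ⟩
        rep A x + i * j * u          ≡⟨ cong (_+_ (rep A x)) (*-assoc i j u) ⟩
        rep A x + i * w              ∎
        where open ℕₚ.≤-Reasoning

      -- Each point of the shell between two balls has at least n - (i + 1)w representations. The
      -- products are expanded and the subtractions moved to the other side.
      shell : ∀ i → s i + n * e (suc i) + suc i * w * e i ≤ s (suc i) + suc i * w * e (suc i) + n * e i
      shell i = begin
        s i + n * e (suc i) + suc i * w * e i
          ≡⟨ cong₂ (λ a b → s i + a + b) (sym (∑-*ˡ p n _)) (sym (∑-*ˡ p (suc i * w) _)) ⟩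
        s i + S (λ x → n * χ₁ x) + S (λ x → suc i * w * χ₀ x)
          ≡⟨ trans (cong (_+ S (λ x → suc i * w * χ₀ x)) (sym (∑-+ p _ _))) (sym (∑-+ p _ _)) ⟩
        S (λ x → χ₀ x * rep A x + n * χ₁ x + suc i * w * χ₀ x)
          ≤⟨ S-mono point ⟩
        S (λ x → χ₁ x * rep A x + suc i * w * χ₁ x + n * χ₀ x)
          ≡⟨ trans (∑-+ p _ _) (cong (_+ S (λ x → n * χ₀ x)) (∑-+ p _ _)) ⟩
        s (suc i) + S (λ x → suc i * w * χ₁ x) + S (λ x → n * χ₀ x)
          ≡⟨ cong₂ (λ a b → s (suc i) + a + b) (∑-*ˡ p (suc i * w) _) (∑-*ˡ p n _) ⟩
        s (suc i) + suc i * w * e (suc i) + n * e i ∎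
        where
        open ℕₚ.≤-Reasoning
        χ₀ χ₁ : ℤ → ℕ
        χ₀ = χ (B (i * j))
        χ₁ = χ (B (suc i * j))
        arith₀ : ∀ r n w → 1 * r + n * 1 + w * 1 ≡ 1 * r + w * 1 + n * 1
        arith₀ = ℕ-solve
        arith₁ : ∀ r n w → 0 * r + n * 1 + w * 0 ≡ n
        arith₁ = ℕ-solve
        arith₂ : ∀ r n w → r + w ≡ 1 * r + w * 1 + n * 0
        arith₂ = ℕ-solve
        arith₃ : ∀ r n w → 0 * r + n * 0 + w * 0 ≡ 0
        arith₃ = ℕ-solve
        point : ∀ x → χ₀ x * rep A x + n * χ₁ x + suc i * w * χ₀ x ≤ χ₁ x * rep A x + suc i * w * χ₁ x + n * χ₀ x
        point x with dec (B (i * j)) x | dec (B (suc i * j)) x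
        ... | yes _ | yes _ = ≤-reflexive (arith₀ (rep A x) n (suc i * w))
        ... | yes m | no ¬m = ⊥-elim (¬m (B-mono (m≤n+m (i * j) j) m))
        ... | no _  | yes m = subst (_≤ 1 * rep A x + suc i * w * 1 + n * 0) (sym (arith₁ (rep A x) n (suc i * w)))
                (≤-trans (rep-large (suc i) x m) (≤-reflexive (arith₂ (rep A x) n (suc i * w))))
        ... | no _  | no _  = subst (_≤ 0 * rep A x + suc i * w * 0 + n * 0) (sym (arith₃ (rep A x) n (suc i * w))) z≤n

      -- The shell bounds summed by parts; the term i w e(i) on the right stands for a subtraction
      -- on the left.
      abel : ∀ i → n * e i + w * ∑ i e ≤ s i + i * w * e i
      abel zero = ≤-trans (≤-reflexive (trans (cong (_+_ (n * e 0)) (*-zeroʳ w)) (+-identityʳ (n * e 0))))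
        (≤-trans base (m≤m+n (s 0) _))
        where
        base : n * e 0 ≤ s 0
        base = subst (_≤ s 0) (∑-*ˡ p n _) (S-mono point)
          where
          point : ∀ x → n * χ (B 0) x ≤ χ (B 0) x * rep A x
          point x with dec (B 0) x
          ... | yes m = subst (_≤ 1 * rep A x) (sym (*-identityʳ n)) (≤-trans (rep-large 0 x m)
                          (≤-reflexive (trans (+-identityʳ _) (sym (*-identityˡ _)))))
          ... | no _  = ≤-reflexive (*-zeroʳ n)
      abel (suc i) = ≤-cancel 0 (+-mono-≤ (abel i) (shell i))
        (arith (n * e (suc i)) (w * e i) (w * ∑ i e) (s i) (i * w * e i) (s (suc i)) (suc i * w * e (suc i)) (n * e i)
          (w * (e i + ∑ i e)) (suc i * w * e i) (*-distribˡ-+ w (e i) (∑ i e)) (distr w i (e i)))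
        where
        distr : ∀ w i e → suc i * w * e ≡ w * e + i * w * e
        distr = ℕ-solve
        arith : ∀ N₁ we wΣ sᵢ iwe s₁ W₁ N₀ X Y → X ≡ we + wΣ → Y ≡ we + iwe →
          N₁ + X + (sᵢ + iwe + (s₁ + W₁ + N₀)) + 0 ≡ s₁ + W₁ + (N₀ + wΣ + (sᵢ + N₁ + Y))
        arith N₁ we wΣ sᵢ iwe s₁ W₁ N₀ X Y refl refl = poly N₁ we wΣ sᵢ iwe s₁ W₁ N₀
          where
          poly : ∀ N₁ we wΣ sᵢ iwe s₁ W₁ N₀ →
            N₁ + (we + wΣ) + (sᵢ + iwe + (s₁ + W₁ + N₀)) + 0 ≡ s₁ + W₁ + (N₀ + wΣ + (sᵢ + N₁ + (we + iwe)))
          poly = ℕ-solve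

      s≤n² : ∀ i → s i ≤ n * n
      s≤n² i = subst (s i ≤_) (∑-rep A) (S-mono λ x → subst (χ (B (i * j)) x * rep A x ≤_) (*-identityˡ (rep A x))
        (*-monoˡ-≤ (rep A x) (χ≤1 (B (i * j)) x)))

      gauss : ∀ K → 2 * ∑ K (λ i → i * b) + K * b ≡ K * K * b
      gauss zero    = refl
      gauss (suc K) = trans (arith K b (∑ K (λ i → i * b))) (trans (cong (_+ (2 * K * b + b)) (gauss K)) (arith′ K b))
        where
        arith : ∀ K b s → 2 * (K * b + s) + suc K * b ≡ 2 * s + K * b + (2 * K * b + b)
        arith = ℕ-solve
        arith′ : ∀ K b → K * K * b + (2 * K * b + b) ≡ suc K * suc K * b
        arith′ = ℕ-solve

      0<b : 0 < b
      0<b = *-mono-≤ (m≤n+m 1 (2 * j)) 0<u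

      instance
        b≢0 : NonZero b
        b≢0 = ℕ.>-nonZero 0<b

      K : ℕ
      -- Kb ≤ 2n < p keeps Cauchy-Davenport usable up to i = K, while Kw ≤ 2jn / (2j + 1) keeps the
      -- counts n - iw positive.
      K = 2 * n ℕDM./ b

      Kb≤2n : K * b ≤ 2 * n
      Kb≤2n = ℕDM.m/n*n≤m (2 * n) b

      2n<Kb+b : 2 * n < K * b + b
      2n<Kb+b = begin-strict
        2 * n                        ≡⟨ ℕDM.m≡m%n+[m/n]*n (2 * n) b ⟩
        2 * n ℕDM.% b + K * b        <⟨ +-monoˡ-< (K * b) (ℕDM.m%n<n (2 * n) b) ⟩
        b + K * b                    ≡⟨ +-comm b (K * b) ⟩
        K * b + b                    ∎
        where open ℕₚ.≤-Reasoning

      q : ℕ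
      q = 2 * j + 1

      -- Kw ≤ (1 − 1/q) n
      Kwq+n≤qn : K * w * q + n ≤ q * n
      Kwq+n≤qn = ≤-trans (+-monoˡ-≤ n (subst (_≤ j * (2 * n)) (arith K j u) (*-monoʳ-≤ j Kb≤2n)))
        (≤-reflexive (arith′ j n))
        where
        arith : ∀ K j u → j * (K * ((2 * j + 1) * u)) ≡ K * (j * u) * (2 * j + 1)
        arith = ℕ-solve
        arith′ : ∀ j n → j * (2 * n) + n ≡ (2 * j + 1) * n
        arith′ = ℕ-solve

      Kw≤n : K * w ≤ n
      Kw≤n = *-cancelʳ-≤ (K * w) n q {{ℕ.>-nonZero (m≤n+m 1 (2 * j))}} (≤-trans (m≤m+n (K * w * q) n)
        (≤-trans Kwq+n≤qn (≤-reflexive (*-comm q n))))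

      N : ℕ
      N = n ∸ K * w

      N+Kw : N + K * w ≡ n
      N+Kw = m∸n+n≡m Kw≤n

      -- Growth by b at every step forces N < w + b, whereas N ≥ n / (2j + 1); `big` excludes that
      -- both hold.
      contradiction′ : (∀ i → i ≤ K → i * b ≤ e i) → ⊥
      contradiction′ growth = <-irrefl refl (begin-strict
        q * (3 * j + 1) * u  <⟨ big ⟩
        n                    ≤⟨ n≤qN ⟩
        q * N                ≤⟨ *-monoʳ-≤ q (<⇒≤ N<w+b) ⟩
        q * (w + b)          ≡⟨ arith j u ⟩
        q * (3 * j + 1) * u  ∎)
        where
        open ℕₚ.≤-Reasoning
        arith : ∀ j u → (2 * j + 1) * (j * u + (2 * j + 1) * u) ≡ (2 * j + 1) * (3 * j + 1) * u
        arith = ℕ-solve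
        n≤qN : n ≤ q * N
        n≤qN = qN-bound n N (K * w) q N+Kw Kwq+n≤qn
        N<w+b : N < w + b
        N<w+b = abel-bound n N K w b (e K) (∑ K e) N+Kw (≤-trans (abel K) (+-monoˡ-≤ (K * w * e K) (s≤n² K)))
          (growth K ≤-refl)
          (≤-trans (≤-reflexive (sym (gauss K))) (+-monoˡ-≤ (K * b)
            (*-monoʳ-≤ 2 (∑-mono K λ i i<K → growth i (<⇒≤ i<K)))))
          Kb≤2n 2n<Kb+b

    upper : card (B j) ≤ (2 * j + 1) * u + 1
    upper = ≮⇒≥ λ lt → contradiction′ λ i i≤K → ≤-trans (m≤m+n (i * b) 1)
      (subst (i * b + 1 ≤_) (sym (card-B (i * j))) (pow-growth D j b (subst (b + 1 ≤_) (card-B j) (<⇒≤ lt)) i (≤-trans (≤-reflexive (+-comm (i * b) 1))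
        (≤-<-trans (≤-trans (*-monoˡ-≤ b i≤K) Kb≤2n) 2n<p))))

-- Rectification

module Geodesic (p : ℕ) .{{nz : NonZero p}} (pr : Prime p)
  (D : Residues.ZSet p) (0∈D : Residues.Mem D (+ 0)) (neg∈D : ∀ d → Residues.Mem D d → Residues.Mem D (⊖ d))
  (u J₀ N : ℕ) (0<u : 0 < u) (0<N : 0 < N) (N≤J₀ : 11 * N * 10 ≤ J₀) where

  open Balls p pr D 0∈D neg∈D public

  module Direction
    (lower : ∀ j → j ≤ J₀ → 2 * j * u + 1 ≤ card (B j))
    (upper : ∀ j → j ≤ J₀ → card (B j) ≤ (2 * j + 1) * u + 1) where

    sumℤ : List ℤ → ℤ
    sumℤ []       = + 0
    sumℤ (z ∷ zs) = z ⊹ sumℤ zs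

    decompose : ∀ M {y} → y ∈ B (M * 10) → ∃ λ zs → length zs ≡ M × All (_∈ B 10) zs × y ≈ sumℤ zs
    decompose zero    m = [] , refl , [] , zero-B m
    decompose (suc M) {y} m with B-split 10 (M * 10) m
    ... | z , zB , rest with decompose M rest
    ...   | zs , len , all , e = z ∷ zs , cong suc len , zB ∷ all , ≈-trans (≡⇒≈ (aux y z)) (≈-+ˡ z e)
      where
      aux : ∀ y z → y ≡ z ⊹ (y ⊝ z)
      aux = ℤ-solve

    Far : ℤ → ℤ → Set
    Far w w′ = w ⊝ w′ ∉ B 2

    Near : ℤ → ℤ → Set
    Near z w = z ⊝ w ∈ B 2

    near? : ∀ z w → Dec (Near z w)
    near? z w = dec (B 2) (z ⊝ w)

    split : ∀ z ws → Any (Near z) ws ⊎ All (Far z) ws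
    split z []       = inj₂ []
    split z (w ∷ ws) with near? z w | split z ws
    ... | yes c | _      = inj₁ (here c)
    ... | no _  | inj₁ a = inj₁ (there a)
    ... | no ¬c | inj₂ a = inj₂ (¬c ∷ a)

    -- Greedy choice: an element is kept only if it is `Far` from those kept before; otherwise it is
    -- `Near` one of them.
    representatives : ∀ zs → All (_∈ B 10) zs →
      ∃ λ ws → All (_∈ B 10) ws × AllPairs Far ws × All (λ z → Any (Near z) ws) zs
    representatives []       []       = [] , [] , [] , []
    representatives (z ∷ zs) (m ∷ ms) with representatives zs ms
    ... | ws , wB , far , cover with split z ws
    ...   | inj₁ a = ws , wB , far , a ∷ cover
    ...   | inj₂ a = z ∷ ws , m ∷ wB , a ∷ far , here (≡⇒B2 z) ∷ All.map there cover
      where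
      ≡⇒B2 : ∀ z → z ⊝ z ∈ B 2
      ≡⇒B2 z = B-mono {0} {2} z≤n (B-zero (≡⇒≈ (ℤₚ.+-inverseʳ z)))

    private
      mult : List ℤ → ℤ → ℕ
      mult []       x = 0
      mult (w ∷ ws) x = χ D (x ⊝ w) + mult ws x

      mult-total : ∀ ws → S (mult ws) ≡ length ws * card D
      mult-total []       = ∑-zero p
      mult-total (w ∷ ws) = trans (∑-+ p _ _) (cong₂ _+_ (S-shift (χ-per D) (⊖ w)) (mult-total ws))

      -- If translates of D by w and w′ meet, then w - w′ ∈ D - D, which lies in `B 2`; so
      -- translates by `Far` points of `B 10` are disjoint, and they stay in `B 11`.
      mult≤ : ∀ ws → All (_∈ B 10) ws → AllPairs Far ws → ∀ x → mult ws x ≤ χ (B 11) x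
      mult≤ []       _        _          x = z≤n
      mult≤ (w ∷ ws) (m ∷ ms) (far ∷ fs) x with dec D (x ⊝ w)
      ... | no _   = mult≤ ws ms fs x
      ... | yes xw = ≤-trans (≤-reflexive (cong suc (others ws far))) (≤-reflexive
                       (sym (𝟙-true (dec (B 11) x) (resp (B 11) (≡⇒≈ (aux x w)) (B-+ 10 1 m (B-one xw))))))
        where
        aux : ∀ x w → w ⊹ (x ⊝ w) ≡ x
        aux = ℤ-solve
        aux′ : ∀ x w v → x ⊝ v ⊝ (x ⊝ w) ≡ w ⊝ v
        aux′ = ℤ-solve
        others : ∀ vs → All (Far w) vs → mult vs x ≡ 0
        others []       _        = refl
        others (v ∷ vs) (f ∷ fs) with dec D (x ⊝ v)
        ... | yes xv = ⊥-elim (f (resp (B 2) (≡⇒≈ (aux′ x w v)) (B-− 1 1 (B-one xv) (B-one xw))))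
        ... | no _   = others vs fs

    within : ∀ k → k ≤ 110 → k ≤ J₀
    within k k≤110 = ≤-trans k≤110 (≤-trans (subst (110 ≤_) (arith N) (*-monoʳ-≤ 110 0<N)) N≤J₀)
      where
      arith : ∀ N → 110 * N ≡ 11 * N * 10
      arith = ℕ-solve

    card-D : 2 * u + 1 ≤ card D
    card-D = ≤-trans (lower 1 (within 1 (m≤m+n 1 109))) (card-mono (B 1) D λ _ → one-B)

    -- Packing: 12 disjoint translates of D, with at least 2u + 1 points each, do not fit into
    -- `B 11`.
    few-representatives : ∀ ws → All (_∈ B 10) ws → AllPairs Far ws → length ws ≤ 11
    few-representatives ws wB far = ≮⇒≥ λ 11<len → <-irrefl refl (begin-strict
      23 * u + 1                  <⟨ ≤-cancel {a = 0} (u + 10) z≤n (arith u) ⟩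
      12 * (2 * u + 1)            ≤⟨ *-mono-≤ 11<len card-D ⟩
      length ws * card D          ≡⟨ sym (mult-total ws) ⟩
      S (mult ws)                 ≤⟨ S-mono (mult≤ ws wB far) ⟩
      card (B 11)                 ≤⟨ upper 11 (within 11 (m≤m+n 11 99)) ⟩
      23 * u + 1                  ∎)
      where
      open ℕₚ.≤-Reasoning
      arith : ∀ u → suc (23 * u + 1) + 0 + (u + 10) ≡ 12 * (2 * u + 1) + 0
      arith = ℕ-solve

    count : ℤ → List ℤ → ℕ
    count w []       = 0
    count w (z ∷ zs) = 𝟙 (near? z w) + count w zs

    -- Collects i steps near w into x. Replacing each of them by w costs an error in `B 2`, and the
    -- other r steps are left as they are.
    extract : ∀ w zs → All (_∈ B 10) zs → ∀ i → i ≤ count w zs →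
      ∃ λ x → ∃ λ y → ∃ λ r → sumℤ zs ≡ x ⊹ y × i + r ≡ length zs × x ⊝ + i · w ∈ B (i * 2) × y ∈ B (r * 10)
    extract w []       []       zero    _  = + 0 , + 0 , 0 , refl , refl , B-zero (≡⇒≈ (aux w)) , B-zero ≈-refl
      where
      aux : ∀ w → + 0 ⊝ + 0 · w ≡ + 0
      aux = ℤ-solve
    extract w (z ∷ zs) (m ∷ ms) i le with near? z w
    extract w (z ∷ zs) (m ∷ ms) i le | no _ with extract w zs ms i le
    ... | x , y , r , e , len , a , b = x , z ⊹ y , suc r , trans (cong (_⊹_ z) e) (aux z x y) , trans (+-suc i r) (cong suc len) , a , B-+ 10 (r * 10) m b
      where
      aux : ∀ z x y → z ⊹ (x ⊹ y) ≡ x ⊹ (z ⊹ y)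
      aux = ℤ-solve
    extract w (z ∷ zs) (m ∷ ms) zero le | yes near with extract w zs ms zero z≤n
    ... | x , y , r , e , len , a , b = x , z ⊹ y , suc r , trans (cong (_⊹_ z) e) (aux z x y) , cong suc len , a , B-+ 10 (r * 10) m b
      where
      aux : ∀ z x y → z ⊹ (x ⊹ y) ≡ x ⊹ (z ⊹ y)
      aux = ℤ-solve
    extract w (z ∷ zs) (m ∷ ms) (suc i) le | yes near with extract w zs ms i (ℕ.s≤s⁻¹ le)
    ... | x , y , r , e , len , a , b = z ⊹ x , y , r , trans (cong (_⊹_ z) e) (sym (ℤₚ.+-assoc z x y)) , cong suc len ,
          resp (B (2 + i * 2)) (≡⇒≈ (aux z w x (+ i))) (B-+ 2 (i * 2) near a) , b
      where
      aux : ∀ z w x i → z ⊝ w ⊹ (x ⊝ i · w) ≡ z ⊹ x ⊝ (+ 1 ⊹ i) · w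
      aux = ℤ-solve

    private
      counts : List ℤ → List ℤ → ℕ
      counts []       zs = 0
      counts (w ∷ ws) zs = count w zs + counts ws zs

      cover-count : ∀ ws zs → All (λ z → Any (Near z) ws) zs → length zs ≤ counts ws zs
      cover-count ws []       []       = z≤n
      cover-count ws (z ∷ zs) (c ∷ cs) = ≤-trans (+-mono-≤ (one ws c) (cover-count ws zs cs)) (≤-reflexive (sym (peel ws)))
        where
        hits : List ℤ → ℕ
        hits []       = 0
        hits (w ∷ ws) = 𝟙 (near? z w) + hits ws
        one : ∀ ws → Any (Near z) ws → 1 ≤ hits ws
        one (w ∷ ws) (here c)  = ≤-trans (≤-reflexive (sym (𝟙-true (near? z w) c))) (m≤m+n _ (hits ws))
        one (w ∷ ws) (there c) = ≤-trans (one ws c) (m≤n+m (hits ws) _)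
        arith : ∀ a b c d → a + b + (c + d) ≡ a + c + (b + d)
        arith = ℕ-solve
        peel : ∀ ws → counts ws (z ∷ zs) ≡ hits ws + counts ws zs
        peel []       = refl
        peel (w ∷ ws) = trans (cong (_+_ (𝟙 (near? z w) + count w zs)) (peel ws)) (arith (𝟙 (near? z w)) (count w zs) (hits ws) (counts ws zs))

      popular : ∀ ws zs k → length ws * k < counts ws zs → Any (λ w → k < count w zs) ws
      popular (w ∷ ws) zs k lt with k ℕₚ.<? count w zs
      ... | yes c = here c
      ... | no ¬c = there (popular ws zs k (+-cancelˡ-< k _ _ (<-≤-trans lt (+-monoˡ-≤ (counts ws zs) (≮⇒≥ ¬c)))))

      lookup∈ : ∀ {ws} {Q : ℤ → Set} → All (_∈ B 10) ws → Any Q ws → ∃ λ w → w ∈ B 10 × Q w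
      lookup∈ (m ∷ _)  (here q)  = _ , m , q
      lookup∈ (_ ∷ ms) (there q) = lookup∈ ms q

    private
      -- The lower bound at radius m + 1 exceeds the upper bound at radius m by u. So y has word
      -- length exactly k, and a decomposition of y into steps is a geodesic.
      ball-gap : ∀ m k → suc m ≡ k → k ≤ J₀ → ∃ λ y → y ∈ B k × y ∉ B m
      ball-gap m k refl k≤J₀ = locate (∑-<-witness p (λ i → χ (B m) (+ i)) (λ i → χ (B (suc m)) (+ i)) (begin-strict
          card (B m)                ≤⟨ upper m (≤-trans (n≤1+n m) k≤J₀) ⟩
          (2 * m + 1) * u + 1       <⟨ ≤-cancel {a = 1} {b = u} 0 0<u (arith m u) ⟩
          2 * suc m * u + 1         ≤⟨ lower (suc m) k≤J₀ ⟩
          card (B (suc m))          ∎))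
        where
        open ℕₚ.≤-Reasoning
        arith : ∀ m u → suc ((2 * m + 1) * u + 1) + u + 0 ≡ 2 * suc m * u + 1 + 1
        arith = ℕ-solve
        locate : (∃ λ i → i < p × χ (B m) (+ i) < χ (B (suc m)) (+ i)) → ∃ λ y → y ∈ B (suc m) × y ∉ B m
        locate (i , _ , lt) = + i , 𝟙-pos (dec (B (suc m)) (+ i)) (≤-<-trans z≤n lt) ,
          λ a → <⇒≱ lt (≤-trans (χ≤1 (B (suc m)) (+ i)) (≤-reflexive (sym (𝟙-true (dec (B m) (+ i)) a))))

      -- A step of the geodesic that could be shortened would shorten the geodesic.
      no-shortcut : ∀ m k y zs w i → suc m ≡ k → length zs * 10 ≡ k → y ∉ B m → y ≈ sumℤ zs → All (_∈ B 10) zs →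
        suc i ≤ count w zs → + suc i · w ∉ B (8 * i + 7)
      no-shortcut m k y zs w i refl len y∉ y≈ zB le sh = absurd (extract w zs zB (suc i) le)
        where
        absurd : (∃ λ x → ∃ λ v → ∃ λ r → sumℤ zs ≡ x ⊹ v × suc i + r ≡ length zs × x ⊝ + suc i · w ∈ B (suc i * 2) × v ∈ B (r * 10)) → ⊥
        absurd (x , v , r , e , lenr , a , b) = y∉ (subst (λ k → y ∈ B k) index
          (resp (B (suc i * 2 + (8 * i + 7) + r * 10)) back
            (B-+ (suc i * 2 + (8 * i + 7)) (r * 10) (B-+ (suc i * 2) (8 * i + 7) a sh) b)))
          where
          aux : ∀ x s v → x ⊝ s ⊹ s ⊹ v ≡ x ⊹ v
          aux = ℤ-solve
          back : x ⊝ + suc i · w ⊹ + suc i · w ⊹ v ≈ y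
          back = ≈-trans (≡⇒≈ (aux x (+ suc i · w) v)) (≈-trans (≡⇒≈ (sym e)) (≈-sym y≈))
          -- Origin of 8i + 7: the new word spends 2(i + 1) + (8i + 7) = 10(i + 1) - 1 on the i + 1
          -- steps, one less than the geodesic.
          arith : ∀ i r → suc (suc i * 2 + (8 * i + 7) + r * 10) ≡ (suc i + r) * 10
          arith = ℕ-solve
          index : suc i * 2 + (8 * i + 7) + r * 10 ≡ m
          index = suc-injective (trans (arith i r) (trans (cong (_* 10) lenr) len))

      direction′ : ∀ M m → M ≡ 11 * N → suc m ≡ M * 10 → ∃ λ z → z ∈ B 10 × (∀ i → i < N → + suc i · z ∉ B (8 * i + 7))
      direction′ M m M≡ m≡ = onGeodesic (ball-gap m (M * 10) m≡ (subst (λ k → k * 10 ≤ J₀) (sym M≡) N≤J₀))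
        where
        open ℕₚ.≤-Reasoning
        N≡ : suc (N ∸ 1) ≡ N
        N≡ = m+[n∸m]≡n 0<N
        onGeodesic : (∃ λ y → y ∈ B (M * 10) × y ∉ B m) → ∃ λ z → z ∈ B 10 × (∀ i → i < N → + suc i · z ∉ B (8 * i + 7))
        onGeodesic (y , yB , y∉) = onList (decompose M yB)
          where
          onList : (∃ λ zs → length zs ≡ M × All (_∈ B 10) zs × y ≈ sumℤ zs) → ∃ λ z → z ∈ B 10 × (∀ i → i < N → + suc i · z ∉ B (8 * i + 7))
          onList (zs , len , zB , y≈) = onReps (representatives zs zB)
            where
            onReps : (∃ λ ws → All (_∈ B 10) ws × AllPairs Far ws × All (λ z → Any (Near z) ws) zs) → ∃ λ z → z ∈ B 10 × (∀ i → i < N → + suc i · z ∉ B (8 * i + 7))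
            -- At most 11 representatives share 11N steps, so one of them is near at least N steps.
            onReps (ws , wB , far , cover) = onPopular (lookup∈ wB (popular ws zs (N ∸ 1) (begin-strict
                length ws * (N ∸ 1)   ≤⟨ *-monoˡ-≤ (N ∸ 1) (few-representatives ws wB far) ⟩
                11 * (N ∸ 1)          <⟨ *-monoʳ-< 11 (≤-reflexive N≡) ⟩
                11 * N                ≡⟨ sym M≡ ⟩
                M                     ≡⟨ sym len ⟩
                length zs             ≤⟨ cover-count ws zs cover ⟩
                counts ws zs          ∎)))
              where
              onPopular : (∃ λ w → w ∈ B 10 × N ∸ 1 < count w zs) → ∃ λ z → z ∈ B 10 × (∀ i → i < N → + suc i · z ∉ B (8 * i + 7))
              onPopular (w , wB10 , lt) = w , wB10 , λ i i<N → no-shortcut m (M * 10) y zs w i m≡ (cong (_* 10) len) y∉ y≈ zB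
                (≤-trans i<N (≤-trans (≤-reflexive (sym N≡)) lt))

    -- Many steps of a geodesic are close to a common w, so the multiples of w stay far from 0.
    direction : ∃ λ z → z ∈ B 10 × (∀ i → i < N → + suc i · z ∉ B (8 * i + 7))
    direction = direction′ (11 * N) (11 * N * 10 ∸ 1) refl (m+[n∸m]≡n 0<110N)
      where
      0<110N : 1 ≤ 11 * N * 10
      0<110N = ≤-trans 0<N (≤-trans (m≤n*m N 11) (m≤m*n (11 * N) 10))

-- Coordinates along the direction z

module Lattice (p : ℕ) .{{nz : NonZero p}} (pr : Prime p)
  (D : Residues.ZSet p) (0∈D : Residues.Mem D (+ 0)) (neg∈D : ∀ d → Residues.Mem D d → Residues.Mem D (⊖ d))
  (u J₀ N : ℕ) (0<u : 0 < u) (84≤N : 84 ≤ N) (40≤J₀ : 40 ≤ J₀) where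

  open Balls p pr D 0∈D neg∈D public

  module Basis
    (lower : ∀ j → j ≤ J₀ → 2 * j * u + 1 ≤ card (B j))
    (upper : ∀ j → j ≤ J₀ → card (B j) ≤ (2 * j + 1) * u + 1)
    (z : ℤ) (zB : z ∈ B 10) (far : ∀ i → i < N → + suc i · z ∉ B (8 * i + 7)) where

    farℤ : ∀ q i → abs q ≡ suc i → i < N → q · z ∉ B (8 * i + 7)
    farℤ (+ _)    i refl i<N m = far i i<N m
    farℤ -[1+ i ] i refl i<N m = far i i<N (resp (B (8 * i + 7)) (≡⇒≈ (aux (+ suc i) z)) (B-neg (8 * i + 7) m))
      where
      aux : ∀ q z → ⊖ (⊖ q · z) ≡ q · z
      aux = ℤ-solve

    near-0 : ∀ q → abs q ≤ N → q · z ∈ B 7 → abs q ≡ 0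
    near-0 q le m = go (abs q) refl le
      where
      go : ∀ a → abs q ≡ a → a ≤ N → a ≡ 0
      go zero    _ _ = refl
      go (suc i) e i<N = ⊥-elim (farℤ q i e i<N (B-mono (m≤n+m 7 (8 * i)) m))

    near-1 : ∀ q → abs q ≤ N → q · z ∈ B 12 → abs q ≤ 1
    near-1 q le m = go (abs q) refl le
      where
      go : ∀ a → abs q ≡ a → a ≤ N → a ≤ 1
      go zero          _ _   = z≤n
      go (suc zero)    _ _   = s≤s z≤n
      go (suc (suc i)) e i<N = ⊥-elim (farℤ q (suc i) e i<N (B-mono (subst (12 ≤_) (arith i) (m≤m+n 12 (8 * i + 3))) m))
        where
        arith : ∀ i → 12 + (8 * i + 3) ≡ 8 * suc i + 7
        arith = ℕ-solve

    -- Otherwise 14 translates of B 3 would be disjoint in B 40, which is too small.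
    B7-covered : ∀ w → w ∈ B 7 → ∃ λ k → k < 13 × w ⊝ (+ k ⊝ + 6) · z ∈ B 6
    B7-covered w wB = decide (anyUpTo? (λ k → dec (B 6) (w ⊝ (+ k ⊝ + 6) · z)) 13)
      where
      Goal : Set
      Goal = ∃ λ k → k < 13 × w ⊝ (+ k ⊝ + 6) · z ∈ B 6
      c : ℕ → ℤ
      c k = (+ k ⊝ + 3) · z
      f g : ℤ → ℕ
      f x = ∑ 7 (λ k → χ (B 3) (x ⊝ c k))
      g x = ∑ 7 (λ k → χ (B 3) (x ⊝ (w ⊹ c k)))
      total : ∀ (v : ℕ → ℤ) → S (λ x → ∑ 7 (λ k → χ (B 3) (x ⊝ v k))) ≡ 7 * card (B 3)
      total v = trans (∑-swap p 7 (λ i k → χ (B 3) (+ i ⊝ v k))) (trans (∑-cong 7 λ k _ → S-shift (χ-per (B 3)) (⊖ v k)) (∑-const 7 (card (B 3))))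
      cB : ∀ k → k < 7 → c k ∈ B 30
      cB k (s≤s k≤6) = B-mono (*-monoˡ-≤ 10 (abs-difference k 3 3 k≤6 (m≤n+m 3 k))) (B-multipleℤ 10 zB (+ k ⊝ + 3))
      aux₁ : ∀ x y → x ⊝ y ⊹ y ≡ x
      aux₁ = ℤ-solve
      aux₂ : ∀ x a b z → x ⊝ (b ⊝ + 3) · z ⊝ (x ⊝ (a ⊝ + 3) · z) ≡ (a ⊝ b) · z
      aux₂ = ℤ-solve
      aux₃ : ∀ x w a b z → x ⊝ (w ⊹ (b ⊝ + 3) · z) ⊝ (x ⊝ (w ⊹ (a ⊝ + 3) · z)) ≡ (a ⊝ b) · z
      aux₃ = ℤ-solve
      aux₄ : ∀ x w a b z → x ⊝ (a ⊝ + 3) · z ⊝ (x ⊝ (w ⊹ (b ⊝ + 3) · z)) ≡ w ⊝ (a ⊝ b) · z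
      aux₄ = ℤ-solve
      same : ∀ a b → a < 7 → b < 7 → (+ a ⊝ + b) · z ∈ B 6 → a ≡ b
      same a b (s≤s a≤6) (s≤s b≤6) m = ℤₚ.+-injective (from (ℤₚ.∣i∣≡0⇒i≡0
        (near-0 (+ a ⊝ + b) (≤-trans (abs-difference a b 6 (≤-trans a≤6 (m≤n+m 6 b)) (≤-trans b≤6 (m≤n+m 6 a)))
          (≤-trans (m≤m+n 6 78) 84≤N)) (B-mono (n≤1+n 6) m))))
        where
        from : + a ⊝ + b ≡ + 0 → + a ≡ + b
        from e = trans (sym (aux₁ (+ a) (+ b))) (trans (cong (_⊹ + b) e) (ℤₚ.+-identityˡ (+ b)))
      f≤ : ∀ x → f x ≤ χ (B 40) x
      f≤ x = ∑-atMostOne 7 _ _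
        (λ k k<7 → 𝟙-mono (dec (B 3) (x ⊝ c k)) (dec (B 40) x) λ m →
          B-mono (m≤m+n 33 7) (resp (B 33) (≡⇒≈ (aux₁ x (c k))) (B-+ 3 30 m (cB k k<7))))
        λ a b a<7 b<7 p₁ p₂ → same a b a<7 b<7 (resp (B 6) (≡⇒≈ (aux₂ x (+ a) (+ b) z))
          (B-− 3 3 (𝟙-pos (dec (B 3) (x ⊝ c b)) p₂) (𝟙-pos (dec (B 3) (x ⊝ c a)) p₁)))
      g≤ : ∀ x → g x ≤ χ (B 40) x
      g≤ x = ∑-atMostOne 7 _ _
        (λ k k<7 → 𝟙-mono (dec (B 3) (x ⊝ (w ⊹ c k))) (dec (B 40) x) λ m →
          resp (B 40) (≡⇒≈ (aux₁ x (w ⊹ c k))) (B-+ 3 37 m (B-+ 7 30 wB (cB k k<7))))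
        λ a b a<7 b<7 p₁ p₂ → same a b a<7 b<7 (resp (B 6) (≡⇒≈ (aux₃ x w (+ a) (+ b) z))
          (B-− 3 3 (𝟙-pos (dec (B 3) (x ⊝ (w ⊹ c b))) p₂) (𝟙-pos (dec (B 3) (x ⊝ (w ⊹ c a))) p₁)))
      disjoint : ¬ Goal → ∀ x → 0 < f x → 0 < g x → ⊥
      disjoint none x p₁ p₂ = clash (∑-positive 7 _ p₁) (∑-positive 7 _ p₂)
        where
        clash : (∃ λ a → a < 7 × 0 < χ (B 3) (x ⊝ c a)) → (∃ λ b → b < 7 × 0 < χ (B 3) (x ⊝ (w ⊹ c b))) → ⊥
        -- A common point puts w - (a - b)z into `B 6`; the coefficient a - b ∈ [-6, 6] is stored as
        -- k - 6 with k = a + (6 - b).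
        clash (a , a<7 , pa) (b , s≤s b≤6 , pb) = none (a + (6 ∸ b) , s≤s (+-mono-≤ (ℕ.s≤s⁻¹ a<7) (m∸n≤m 6 b)) ,
          resp (B 6) (≡⇒≈ (trans (aux₄ x w (+ a) (+ b) z) (cong (λ q → w ⊝ q · z) shift)))
            (B-− 3 3 (𝟙-pos (dec (B 3) (x ⊝ c a)) pa) (𝟙-pos (dec (B 3) (x ⊝ (w ⊹ c b))) pb)))
          where
          aux : ∀ a s b → a ⊝ b ≡ a ⊹ s ⊝ (s ⊹ b)
          aux = ℤ-solve
          shift : + a ⊝ + b ≡ + (a + (6 ∸ b)) ⊝ + 6
          shift = trans (aux (+ a) (+ (6 ∸ b)) (+ b)) (cong₂ _⊝_ (sym (ℤₚ.pos-+ a (6 ∸ b)))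
            (trans (sym (ℤₚ.pos-+ (6 ∸ b) b)) (cong +_ (m∸n+n≡m b≤6))))
      packed : ¬ Goal → ∀ x → f x + g x ≤ χ (B 40) x
      packed none x = go (f x) (g x) refl refl (f≤ x) (g≤ x)
        where
        go : ∀ a b → f x ≡ a → g x ≡ b → a ≤ χ (B 40) x → b ≤ χ (B 40) x → a + b ≤ χ (B 40) x
        go zero    b       _  _  _  hb = hb
        go (suc a) zero    _  _  ha _  = subst (_≤ χ (B 40) x) (sym (+-identityʳ (suc a))) ha
        go (suc a) (suc b) ea eb _  _  = ⊥-elim (disjoint none x (subst (0 <_) (sym ea) (s≤s z≤n)) (subst (0 <_) (sym eb) (s≤s z≤n)))
      decide : Dec Goal → Goal
      decide (yes w) = w
      decide (no ¬w) = ⊥-elim (<-irrefl refl (begin-strict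
          81 * u + 1                   <⟨ ≤-cancel {a = 0} (3 * u + 12) z≤n (arith u) ⟩
          14 * (6 * u + 1)             ≤⟨ *-monoʳ-≤ 14 (lower 3 (≤-trans (m≤m+n 3 37) 40≤J₀)) ⟩
          14 * card (B 3)              ≡⟨ arith′ (card (B 3)) ⟩
          7 * card (B 3) + 7 * card (B 3) ≡⟨ sym (cong₂ _+_ (total c) (total (λ k → w ⊹ c k))) ⟩
          S f + S g                    ≡⟨ sym (∑-+ p _ _) ⟩
          S (λ x → f x + g x)          ≤⟨ S-mono (packed ¬w) ⟩
          card (B 40)                  ≤⟨ upper 40 40≤J₀ ⟩
          81 * u + 1                   ∎))
        where
        open ℕₚ.≤-Reasoning
        arith : ∀ u → suc (81 * u + 1) + 0 + (3 * u + 12) ≡ 14 * (6 * u + 1) + 0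
        arith = ℕ-solve
        arith′ : ∀ c → 14 * c ≡ 7 * c + 7 * c
        arith′ = ℕ-solve

    -- The lowest points of the z-progressions in `B 6`. As 2z ∉ `B 12`, at most two neighbours of a
    -- progression lie in `B 6`, and R is a transversal modulo bounded multiples of z.
    R : ZSet
    R = zset (λ x → x ∈ B 6 × x ⊝ z ∉ B 6) (λ x → dec (B 6) x ×-dec ¬? (dec (B 6) (x ⊝ z)))
      λ { e (a , b) → resp (B 6) e a , λ m → b (resp (B 6) (≈-−ʳ z (≈-sym e)) m) }

    ℓ : ℕ
    ℓ = card R

    R-reduce : ∀ x → x ∈ B 6 → ∃ λ k → k ≤ 1 × x ⊝ + k · z ∈ R
    R-reduce x m = decide (dec (B 6) (x ⊝ z))
      where
      aux₀ : ∀ x z → x ≡ x ⊝ + 0 · z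
      aux₀ = ℤ-solve
      aux₁ : ∀ x z → x ⊝ z ≡ x ⊝ + 1 · z
      aux₁ = ℤ-solve
      aux₂ : ∀ x z → x ⊝ (x ⊝ z ⊝ z) ≡ + 2 · z
      aux₂ = ℤ-solve
      decide : Dec (x ⊝ z ∈ B 6) → ∃ λ k → k ≤ 1 × x ⊝ + k · z ∈ R
      decide (no ¬m) = 0 , z≤n , resp R (≡⇒≈ (aux₀ x z)) (m , ¬m)
      decide (yes m′) = 1 , ≤-refl , resp R (≡⇒≈ (aux₁ x z)) (m′ , λ m″ →
        <⇒≱ (n<1+n 1) (near-1 (+ 2) (≤-trans (m≤m+n 2 82) 84≤N) (resp (B 12) (≡⇒≈ (aux₂ x z)) (B-− 6 6 m m″))))

    -- By `near-1` two points of R on one progression are at most one step apart; if they were one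
    -- step apart, the upper one would have its predecessor in `B 6`.
    R-unique : ∀ r r′ → r ∈ R → r′ ∈ R → ∀ q → abs q ≤ N → r ⊝ r′ ≈ q · z → r ≈ r′
    R-unique r r′ (a , b) (a′ , b′) q q≤N e = go q (near-1 q q≤N (resp (B 12) e (B-− 6 6 a a′))) e
      where
      aux₀ : ∀ r r′ → r ≡ r ⊝ r′ ⊹ r′
      aux₀ = ℤ-solve
      aux₁ : ∀ r′ z → + 0 · z ⊹ r′ ≡ r′
      aux₁ = ℤ-solve
      aux₂ : ∀ r r′ z → r ⊝ z ≡ r ⊝ r′ ⊹ (r′ ⊝ z)
      aux₂ = ℤ-solve
      aux₃ : ∀ r′ z → + 1 · z ⊹ (r′ ⊝ z) ≡ r′
      aux₃ = ℤ-solve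
      aux₄ : ∀ r r′ z → r′ ⊝ z ≡ r ⊝ (r ⊝ r′) ⊝ z
      aux₄ = ℤ-solve
      aux₅ : ∀ r z → r ⊝ -[1+ 0 ] · z ⊝ z ≡ r
      aux₅ = ℤ-solve
      go : ∀ q → abs q ≤ 1 → r ⊝ r′ ≈ q · z → r ≈ r′
      go (+ zero)        _ e = ≈-trans (≡⇒≈ (aux₀ r r′)) (≈-trans (≈-+ʳ r′ e) (≡⇒≈ (aux₁ r′ z)))
      go (+ suc zero)    _ e = ⊥-elim (b (resp (B 6) (≈-sym (≈-trans (≡⇒≈ (aux₂ r r′ z)) (≈-trans (≈-+ʳ (r′ ⊝ z) e) (≡⇒≈ (aux₃ r′ z))))) a′))
      go (+ suc (suc _)) (s≤s ()) e
      go -[1+ zero ]     _ e = ⊥-elim (b′ (resp (B 6) (≈-sym (≈-trans (≡⇒≈ (aux₄ r r′ z)) (≈-trans (≈-−ʳ z (≈-−ˡ r e)) (≡⇒≈ (aux₅ r z))))) a))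
      go -[1+ suc _ ]    (s≤s ()) e

    -- `B7-covered` brings r + d back to `B 6` and `R-reduce` brings it to R. The offset 7z turns
    -- the multiplier k - 6 + ε into a natural number at most 14, with 7 at the centre of the range.
    R-step : ∀ d → d ∈ D → ∀ r → r ∈ R → ∃ λ k → k ≤ 14 × r ⊹ d ⊹ + 7 · z ⊝ + k · z ∈ R
    R-step d dD r (rB , _) = combine (B7-covered (r ⊹ d) (B-+ 6 1 rB (B-one dD)))
      where
      combine : (∃ λ k → k < 13 × r ⊹ d ⊝ (+ k ⊝ + 6) · z ∈ B 6) → ∃ λ k → k ≤ 14 × r ⊹ d ⊹ + 7 · z ⊝ + k · z ∈ R
      combine (k , s≤s k≤12 , m) = finish (R-reduce _ m)
        where
        aux : ∀ x k ε z → x ⊝ (k ⊝ + 6) · z ⊝ ε · z ≡ x ⊹ + 7 · z ⊝ (k ⊹ (+ 1 ⊹ ε)) · z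
        aux = ℤ-solve
        finish : (∃ λ ε → ε ≤ 1 × r ⊹ d ⊝ (+ k ⊝ + 6) · z ⊝ + ε · z ∈ R) → _
        finish (ε , ε≤1 , m′) = k + (1 + ε) , +-mono-≤ k≤12 (s≤s ε≤1) ,
          resp R (≡⇒≈ (trans (aux (r ⊹ d) (+ k) (+ ε) z) (cong (λ q → r ⊹ d ⊹ + 7 · z ⊝ q · z) (sym (ℤₚ.pos-+ k (1 + ε)))))) m′

    -- Translation by d permutes the residues of R up to multiples of z; summing over R gives ℓ d = I z.
    module Carry (d : ℤ) (dD : d ∈ D) where

      carry′ : ∀ i → Dec (+ i ∈ R) → ℕ
      carry′ i (yes m) = proj₁ (R-step d dD (+ i) m)
      carry′ i (no _)  = 0

      carry : ℕ → ℕ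
      carry i = carry′ i (dec R (+ i))

      next : ℕ → ℤ
      next i = + i ⊹ d ⊹ + 7 · z ⊝ + carry i · z

      carry≤14 : ∀ i → carry i ≤ 14
      carry≤14 i = go (dec R (+ i))
        where
        go : ∀ m? → carry′ i m? ≤ 14
        go (yes m) = proj₁ (proj₂ (R-step d dD (+ i) m))
        go (no _)  = z≤n

      next∈R : ∀ i → + i ∈ R → next i ∈ R
      next∈R i m = go (dec R (+ i))
        where
        go : ∀ m? → + i ⊹ d ⊹ + 7 · z ⊝ + carry′ i m? · z ∈ R
        go (yes m) = proj₂ (proj₂ (R-step d dD (+ i) m))
        go (no ¬m) = ⊥-elim (¬m m)

      -- Points with equal images differ by at most 14 multiples of z, so `R-unique` identifies
      -- them.
      next-injective : ∀ i j → i < p → j < p → + i ∈ R → + j ∈ R → next i ≈ next j → i ≡ j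
      next-injective i j i<p j<p mi mj e = ≈-unique i<p j<p (R-unique (+ i) (+ j) mi mj (+ carry i ⊝ + carry j)
        (≤-trans (abs-difference (carry i) (carry j) 14 (≤-trans (carry≤14 i) (m≤n+m 14 _)) (≤-trans (carry≤14 j) (m≤n+m 14 _)))
          (≤-trans (m≤m+n 14 70) 84≤N))
        (≈-trans (≡⇒≈ (aux (+ i) (+ j) (+ carry i · z) (+ carry j · z) d (+ 7 · z)))
          (≈-trans (≈-+ʳ (+ carry i · z ⊝ + carry j · z) (≈-− e (≈-refl {next j})))
            (≡⇒≈ (aux′ (next j) (+ carry i) (+ carry j) z)))))
        where
        aux : ∀ i j a b d s → i ⊝ j ≡ i ⊹ d ⊹ s ⊝ a ⊝ (j ⊹ d ⊹ s ⊝ b) ⊹ (a ⊝ b)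
        aux = ℤ-solve
        aux′ : ∀ x a b z → x ⊝ x ⊹ (a · z ⊝ b · z) ≡ (a ⊝ b) · z
        aux′ = ℤ-solve

      private
        hits : ℕ → ℕ
        hits j = ∑ p (λ i → χ R (+ i) * 𝟙 (next i ≈? + j))

        hit : ∀ i j → 0 < χ R (+ i) * 𝟙 (next i ≈? + j) → + i ∈ R × next i ≈ + j
        hit i j = 𝟙-pos-* (dec R (+ i)) (next i ≈? + j)

        hits≤ : ∀ j → j < p → hits j ≤ χ R (+ j)
        hits≤ j j<p = ∑-atMostOne p _ _ bound
          λ a b a<p b<p pa pb → next-injective a b a<p b<p (proj₁ (hit a j pa)) (proj₁ (hit b j pb))
            (≈-trans (proj₂ (hit a j pa)) (≈-sym (proj₂ (hit b j pb))))
          where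
          bound : ∀ i → i < p → χ R (+ i) * 𝟙 (next i ≈? + j) ≤ χ R (+ j)
          bound i _ = go (χ R (+ i) * 𝟙 (next i ≈? + j)) refl (*-mono-≤ (χ≤1 R (+ i)) (𝟙≤1 (next i ≈? + j)))
            where
            go : ∀ v → χ R (+ i) * 𝟙 (next i ≈? + j) ≡ v → v ≤ 1 → v ≤ χ R (+ j)
            go zero    _ _ = z≤n
            go (suc v) e v≤1 = ≤-trans v≤1 (≤-reflexive (sym (𝟙-true (dec R (+ j))
              (resp R (proj₂ (hit i j (subst (0 <_) (sym e) (s≤s z≤n)))) (next∈R i (proj₁ (hit i j (subst (0 <_) (sym e) (s≤s z≤n)))))))))

        hits-total : ∑ p hits ≡ ℓ
        hits-total = trans (∑-swap p p (λ j i → χ R (+ i) * 𝟙 (next i ≈? + j))) (∑-cong p λ i _ →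
          trans (∑-*ˡ p (χ R (+ i)) (λ j → 𝟙 (next i ≈? + j))) (trans (cong (_*_ (χ R (+ i))) (δ-total (next i))) (*-identityʳ _)))

        hits≡ : ∀ j → j < p → hits j ≡ χ R (+ j)
        hits≡ = ∑-≡-pointwise p hits (λ j → χ R (+ j)) hits≤ (≤-reflexive (sym hits-total))

        ρ-per : Per ρ
        ρ-per {x} {y} e = ≈-unique (ρ<p x) (ρ<p y) (≈-trans (≈-sym (≈ρ x)) (≈-trans e (≈ρ y)))

      -- By `hits≡` the injection `next` of R into itself is a bijection. The representatives ρ make
      -- the sum over R a natural number.
      permuted : ∑ p (λ i → χ R (+ i) * ρ (next i)) ≡ ∑ p (λ i → χ R (+ i) * ρ (+ i))
      permuted = begin
        ∑ p (λ i → χ R (+ i) * ρ (next i))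
          ≡⟨ ∑-cong p (λ i _ → cong (_*_ (χ R (+ i))) (sym (sift ρ-per (next i)))) ⟩
        ∑ p (λ i → χ R (+ i) * ∑ p (λ j → 𝟙 (next i ≈? + j) * ρ (+ j)))
          ≡⟨ ∑-cong p (λ i _ → sym (∑-*ˡ p (χ R (+ i)) (λ j → 𝟙 (next i ≈? + j) * ρ (+ j)))) ⟩
        ∑ p (λ i → ∑ p (λ j → χ R (+ i) * (𝟙 (next i ≈? + j) * ρ (+ j))))
          ≡⟨ ∑-swap p p (λ i j → χ R (+ i) * (𝟙 (next i ≈? + j) * ρ (+ j))) ⟩
        ∑ p (λ j → ∑ p (λ i → χ R (+ i) * (𝟙 (next i ≈? + j) * ρ (+ j))))
          ≡⟨ ∑-cong p (λ j j<p → trans (∑-cong p λ i _ → sym (*-assoc (χ R (+ i)) (𝟙 (next i ≈? + j)) (ρ (+ j))))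
               (trans (∑-*ʳ p (ρ (+ j)) (λ i → χ R (+ i) * 𝟙 (next i ≈? + j))) (cong (_* ρ (+ j)) (hits≡ j j<p)))) ⟩
        ∑ p (λ j → χ R (+ j) * ρ (+ j)) ∎
        where open ≡-Reasoning

      K : ℕ
      K = ∑ p (λ i → χ R (+ i) * carry i)

      K≤ : K ≤ ℓ * 14
      K≤ = ≤-trans (∑-mono p λ i _ → *-monoʳ-≤ (χ R (+ i)) (carry≤14 i)) (≤-reflexive (∑-*ʳ p 14 (λ i → χ R (+ i))))

      private
        e′ : ℤ
        e′ = d ⊹ + 7 · z

        term : ∀ i → + (χ R (+ i) * ρ (+ i)) ⊹ + χ R (+ i) · e′ ≈ + (χ R (+ i) * ρ (next i)) ⊹ + (χ R (+ i) * carry i) · z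
        term i = go (χ R (+ i)) (χ≤1 R (+ i))
          where
          aux₁ : ∀ i d s c → i ⊹ + 1 · (d ⊹ s) ≡ i ⊹ d ⊹ s ⊝ c ⊹ c
          aux₁ = ℤ-solve
          aux₀ : ∀ e z → + 0 ⊹ + 0 · e ≡ + 0 ⊹ + 0 · z
          aux₀ = ℤ-solve
          go : ∀ v → v ≤ 1 → + (v * ρ (+ i)) ⊹ + v · e′ ≈ + (v * ρ (next i)) ⊹ + (v * carry i) · z
          go zero       _ = ≡⇒≈ (aux₀ e′ z)
          go (suc zero) _ = ≈-trans (≈-+ʳ (+ 1 · e′) (≈-trans (≡⇒≈ (cong +_ (*-identityˡ (ρ (+ i))))) (≈-sym (≈ρ (+ i)))))
            (≈-trans (≡⇒≈ (aux₁ (+ i) d (+ 7 · z) (+ carry i · z)))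
              (≈-+ (≈-trans (≈ρ (next i)) (≡⇒≈ (cong +_ (sym (*-identityˡ (ρ (next i)))))))
                   (≡⇒≈ (cong (λ c → + c · z) (sym (*-identityˡ (carry i)))))))
          go (suc (suc _)) (s≤s ())

        partial : ∀ n → + ∑ n (λ i → χ R (+ i) * ρ (+ i)) ⊹ + ∑ n (λ i → χ R (+ i)) · e′
                      ≈ + ∑ n (λ i → χ R (+ i) * ρ (next i)) ⊹ + ∑ n (λ i → χ R (+ i) * carry i) · z
        partial zero    = ≡⇒≈ (aux e′ z)
          where
          aux : ∀ e z → + 0 ⊹ + 0 · e ≡ + 0 ⊹ + 0 · z
          aux = ℤ-solve
        partial (suc n) = ≈-trans (≡⇒≈ (expand (χ R (+ n) * ρ (+ n)) (∑ n (λ i → χ R (+ i) * ρ (+ i))) (χ R (+ n)) (∑ n (λ i → χ R (+ i))) e′))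
          (≈-trans (≈-+ (term n) (partial n)) (≡⇒≈ (sym (expand (χ R (+ n) * ρ (next n)) (∑ n (λ i → χ R (+ i) * ρ (next i)))
            (χ R (+ n) * carry n) (∑ n (λ i → χ R (+ i) * carry i)) z))))
          where
          poly : ∀ a b c d e → a ⊹ b ⊹ (c ⊹ d) · e ≡ a ⊹ c · e ⊹ (b ⊹ d · e)
          poly = ℤ-solve
          expand : ∀ a b c d e → + (a + b) ⊹ + (c + d) · e ≡ + a ⊹ + c · e ⊹ (+ b ⊹ + d · e)
          expand a b c d e = poly (+ a) (+ b) (+ c) (+ d) e

      ℓd≈ : + ℓ · d ≈ (+ K ⊝ + (7 * ℓ)) · z
      ℓd≈ = ≈-trans (≡⇒≈ (trans (aux (+ Θ) (+ ℓ) d z) (cong (λ t → + Θ ⊹ + ℓ · e′ ⊝ + Θ ⊝ t · z) (sym (ℤₚ.pos-* 7 ℓ)))))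
        (≈-trans (≈-−ʳ (+ (7 * ℓ) · z) (≈-−ʳ (+ Θ) (≈-trans (partial p) (≡⇒≈ (cong (λ t → + t ⊹ + K · z) permuted)))))
          (≡⇒≈ (aux′ (+ Θ) (+ K) (+ (7 * ℓ)) z)))
        where
        Θ : ℕ
        Θ = ∑ p (λ i → χ R (+ i) * ρ (+ i))
        aux : ∀ Θ ℓ d z → ℓ · d ≡ Θ ⊹ ℓ · (d ⊹ + 7 · z) ⊝ Θ ⊝ (+ 7 · ℓ) · z
        aux = ℤ-solve
        aux′ : ∀ Θ K t z → Θ ⊹ K · z ⊝ Θ ⊝ t · z ≡ (K ⊝ t) · z
        aux′ = ℤ-solve

    scaled : ∀ d → d ∈ D → ∃ λ I → abs I ≤ 7 * ℓ × + ℓ · d ≈ I · z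
    scaled d dD = + K ⊝ + (7 * ℓ) , abs-difference K (7 * ℓ) (7 * ℓ) (≤-trans K≤ (≤-reflexive (arith ℓ))) (m≤n+m (7 * ℓ) K) , ℓd≈
      where
      open Carry d dD
      arith : ∀ ℓ → ℓ * 14 ≡ 7 * ℓ + 7 * ℓ
      arith = ℕ-solve

    R-inhabited : ∃ λ r → r ∈ R
    R-inhabited = _ , proj₂ (proj₂ (R-reduce (+ 0) (B-mono {0} {6} z≤n (B-zero ≈-refl))))

    0<ℓ : 0 < ℓ
    0<ℓ = card-pos R (proj₁ R-inhabited) (proj₂ R-inhabited)

    ℓ≤ : ℓ ≤ 13 * u + 1
    ℓ≤ = ≤-trans (card-mono R (B 6) λ _ → proj₁) (upper 6 (≤-trans (m≤m+n 6 34) 40≤J₀))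

    ℓ<p : ℓ < p
    ℓ<p = begin-strict
      ℓ               ≤⟨ ℓ≤ ⟩
      13 * u + 1      <⟨ ≤-cancel {a = 1} {b = u} 0 0<u (arith u) ⟩
      14 * u + 1      ≤⟨ lower 7 (≤-trans (m≤m+n 7 33) 40≤J₀) ⟩
      card (B 7)      ≤⟨ card≤p (B 7) ⟩
      p               ∎
      where
      open ℕₚ.≤-Reasoning
      arith : ∀ u → suc (13 * u + 1) + u + 0 ≡ 14 * u + 1 + 1
      arith = ℕ-solve

    ℓ≉0 : ¬ + ℓ ≈ + 0
    ℓ≉0 e = <⇒≢ 0<ℓ (sym (≈-unique ℓ<p (<-trans 0<ℓ ℓ<p) e))

    abstract
      ℓ-inverse : ∃ λ ℓ′ → + ℓ · ℓ′ ≈ + 1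
      ℓ-inverse = inverse (+ ℓ) ℓ≉0

    -- The quotient z / ℓ, the unit in which all of D has small integer coordinates.
    h : ℤ
    h = proj₁ ℓ-inverse · z

    ℓh≈z : + ℓ · h ≈ z
    ℓh≈z = ≈-trans (≡⇒≈ (sym (ℤₚ.*-assoc (+ ℓ) (proj₁ ℓ-inverse) z)))
      (≈-trans (≈-* (proj₂ ℓ-inverse) (≈-refl {z})) (≡⇒≈ (ℤₚ.*-identityˡ z)))

    h≉0 : ¬ h ≈ + 0
    h≉0 e = far 0 (≤-trans (s≤s z≤n) 84≤N) (B-mono {0} {7} z≤n (B-zero (≈-trans (≡⇒≈ (ℤₚ.*-identityˡ z))
      (≈-trans (≈-sym ℓh≈z) (≈-trans (≈-* (≈-refl {+ ℓ}) e) (≡⇒≈ (ℤₚ.*-zeroʳ (+ ℓ))))))))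

    coordinate-D : ∀ d → d ∈ D → ∃ λ I → abs I ≤ 7 * ℓ × d ≈ I · h
    coordinate-D d dD = go (scaled d dD)
      where
      ℓ′ : ℤ
      ℓ′ = proj₁ ℓ-inverse
      aux₁ : ∀ l l′ d → l · l′ · d ≡ l′ · (l · d)
      aux₁ = ℤ-solve
      aux₂ : ∀ l′ I z → l′ · (I · z) ≡ I · (l′ · z)
      aux₂ = ℤ-solve
      go : (∃ λ I → abs I ≤ 7 * ℓ × + ℓ · d ≈ I · z) → ∃ λ I → abs I ≤ 7 * ℓ × d ≈ I · h
      go (I , le , e) = I , le , ≈-trans (≡⇒≈ (sym (ℤₚ.*-identityˡ d))) (≈-trans (≈-* (≈-sym (proj₂ ℓ-inverse)) (≈-refl {d}))
        (≈-trans (≡⇒≈ (aux₁ (+ ℓ) ℓ′ d)) (≈-trans (≈-* (≈-refl {ℓ′}) e) (≡⇒≈ (aux₂ ℓ′ I z)))))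

    coordinate : ∀ j x → x ∈ B j → ∃ λ I → abs I ≤ j * (7 * ℓ) × x ≈ I · h
    coordinate zero    x m = + 0 , z≤n , ≈-trans (zero-B m) (≡⇒≈ (sym (ℤₚ.*-zeroˡ h)))
    coordinate (suc j) x m = join (proj₁ split) (coordinate-D _ (one-B (proj₁ (proj₂ split)))) (coordinate j _ (proj₂ (proj₂ split)))
      where
      split : ∃ λ y → y ∈ B 1 × x ⊝ y ∈ B j
      split = B-split 1 j m
      aux : ∀ x y → x ≡ y ⊹ (x ⊝ y)
      aux = ℤ-solve
      join : ∀ y → (∃ λ I → abs I ≤ 7 * ℓ × y ≈ I · h) → (∃ λ I → abs I ≤ j * (7 * ℓ) × x ⊝ y ≈ I · h) → ∃ λ I → abs I ≤ suc j * (7 * ℓ) × x ≈ I · h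
      join y (I , le , e) (I′ , le′ , e′) = I ⊹ I′ , ≤-trans (ℤₚ.∣i+j∣≤∣i∣+∣j∣ I I′) (+-mono-≤ le le′) ,
        ≈-trans (≡⇒≈ (aux x y)) (≈-trans (≈-+ e e′) (≡⇒≈ (sym (ℤₚ.*-distribʳ-+ h I I′))))

    private
      instance
        ℓ≢0 : NonZero ℓ
        ℓ≢0 = ℕ.>-nonZero 0<ℓ

      module L = Residues ℓ

      coordinate′ : ∀ i → Dec (+ i ∈ R) → ℤ
      coordinate′ i (yes m) = proj₁ (coordinate 6 (+ i) (proj₁ m))
      coordinate′ i (no _)  = + 0

      coord : ℕ → ℤ
      coord i = coordinate′ i (dec R (+ i))

      coord-spec : ∀ i → + i ∈ R → abs (coord i) ≤ 42 * ℓ × + i ≈ coord i · h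
      coord-spec i m = go (dec R (+ i))
        where
        arith : ∀ ℓ → 6 * (7 * ℓ) ≡ 42 * ℓ
        arith = ℕ-solve
        go : ∀ m? → abs (coordinate′ i m?) ≤ 42 * ℓ × + i ≈ coordinate′ i m? · h
        go (yes m) = subst (abs (proj₁ (coordinate 6 (+ i) (proj₁ m))) ≤_) (arith ℓ) (proj₁ (proj₂ (coordinate 6 (+ i) (proj₁ m)))) ,
                     proj₂ (proj₂ (coordinate 6 (+ i) (proj₁ m)))
        go (no ¬m) = ⊥-elim (¬m m)

      quotient-small : ∀ k c → abs (k · + ℓ) ≤ c * ℓ → abs k ≤ c
      quotient-small k c le = *-cancelʳ-≤ (abs k) c ℓ (subst (_≤ c * ℓ) (ℤₚ.abs-* k (+ ℓ)) le)

      -- Coordinates congruent modulo ℓ differ by kℓ with |k| ≤ 42 + 42, so the points differ by kz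
      -- and `R-unique` applies. This is the reason for 84 ≤ N.
      coord-distinct : ∀ i j → i < p → j < p → + i ∈ R → + j ∈ R → coord i L.≈ coord j → i ≡ j
      coord-distinct i j i<p j<p mi mj (L.mod≈ k e) = ≈-unique i<p j<p (R-unique (+ i) (+ j) mi mj k
        (≤-trans (quotient-small k 84 (subst (λ t → abs t ≤ 84 * ℓ) diff≡ (≤-trans (ℤₚ.∣i-j∣≤∣i∣+∣j∣ (coord i) (coord j))
          (≤-trans (+-mono-≤ (proj₁ (coord-spec i mi)) (proj₁ (coord-spec j mj))) (≤-reflexive (arith ℓ)))))) 84≤N)
        (≈-trans (≈-− (proj₂ (coord-spec i mi)) (proj₂ (coord-spec j mj)))
          (≈-trans (≡⇒≈ (trans (aux₂ (coord i) (coord j) h) (trans (cong (_· h) diff≡) (ℤₚ.*-assoc k (+ ℓ) h)))) (≈-* (≈-refl {k}) ℓh≈z))))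
        where
        arith : ∀ ℓ → 42 * ℓ + 42 * ℓ ≡ 84 * ℓ
        arith = ℕ-solve
        aux₁ : ∀ c t → c ⊹ t ⊝ c ≡ t
        aux₁ = ℤ-solve
        aux₂ : ∀ a b h → a · h ⊝ b · h ≡ (a ⊝ b) · h
        aux₂ = ℤ-solve
        diff≡ : coord i ⊝ coord j ≡ k · + ℓ
        diff≡ = trans (cong (_⊝ coord j) e) (aux₁ (coord j) (k · + ℓ))

      hits : ℕ → ℕ
      hits c = ∑ p (λ i → χ R (+ i) * 𝟙 (coord i L.≈? + c))

      hit : ∀ i c → 0 < χ R (+ i) * 𝟙 (coord i L.≈? + c) → + i ∈ R × coord i L.≈ + c
      hit i c = 𝟙-pos-* (dec R (+ i)) (coord i L.≈? + c)

      hits≤1 : ∀ c → c < ℓ → hits c ≤ 1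
      hits≤1 c _ = ∑-atMostOne p _ 1 (λ i _ → *-mono-≤ (χ≤1 R (+ i)) (𝟙≤1 (coord i L.≈? + c)))
        λ a b a<p b<p pa pb → coord-distinct a b a<p b<p (proj₁ (hit a c pa)) (proj₁ (hit b c pb))
          (L.≈-trans (proj₂ (hit a c pa)) (L.≈-sym (proj₂ (hit b c pb))))

      hits-total : ∑ ℓ hits ≡ ℓ
      hits-total = trans (∑-swap ℓ p (λ c i → χ R (+ i) * 𝟙 (coord i L.≈? + c))) (∑-cong p λ i _ →
        trans (∑-*ˡ ℓ (χ R (+ i)) (λ c → 𝟙 (coord i L.≈? + c))) (trans (cong (_*_ (χ R (+ i))) (L.δ-total (coord i))) (*-identityʳ _)))

      -- The ℓ points of R have distinct coordinates modulo ℓ, so every class occurs.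
      every-residue : ∀ c → c < ℓ → ∃ λ i → + i ∈ R × coord i L.≈ + c
      every-residue c c<ℓ = go (∑-positive p _ (≤-reflexive (sym (∑-≡-pointwise ℓ hits (λ _ → 1) hits≤1
        (≤-reflexive (trans (trans (∑-const ℓ 1) (*-identityʳ ℓ)) (sym hits-total))) c c<ℓ))))
        where
        go : (∃ λ i → i < p × 0 < χ R (+ i) * 𝟙 (coord i L.≈? + c)) → ∃ λ i → + i ∈ R × coord i L.≈ + c
        go (i , _ , lt) = i , hit i c lt

    -- Some r ∈ R has coordinate x + kℓ with |k| ≤ 42 + 7, hence xh = r - kz, with r ∈ `B 6` and z ∈
    -- `B 10`.
    interval∈B : ∀ x → x ≤ 7 * ℓ → + x · h ∈ B 496
    interval∈B x x≤ = go (every-residue (L.ρ (+ x)) (L.ρ<p (+ x)))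
      where
      arith : ∀ ℓ → 42 * ℓ + 7 * ℓ ≡ 49 * ℓ
      arith = ℕ-solve
      aux₁ : ∀ c t → c ⊹ t ⊝ c ≡ t
      aux₁ = ℤ-solve
      aux₂ : ∀ x k l h → (x ⊹ k · l) · h ⊝ k · (l · h) ≡ x · h
      aux₂ = ℤ-solve
      go : (∃ λ i → + i ∈ R × coord i L.≈ + L.ρ (+ x)) → + x · h ∈ B 496
      go (i , m , e) = go′ i m (L.≈-trans e (L.≈-sym (L.≈ρ (+ x))))
        where
        go′ : ∀ i → + i ∈ R → coord i L.≈ + x → + x · h ∈ B 496
        go′ i m (L.mod≈ k eq) = B-mono (+-monoʳ-≤ 6 (*-monoˡ-≤ 10 k≤49)) (resp (B (6 + abs k * 10))
              (≈-trans (≈-− (≈-trans (proj₂ (coord-spec i m)) (≡⇒≈ (cong (_· h) eq))) (≈-* (≈-refl {k}) (≈-sym ℓh≈z))) (≡⇒≈ (aux₂ (+ x) k (+ ℓ) h)))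
              (B-− 6 (abs k * 10) (proj₁ m) (B-multipleℤ 10 zB k)))
          where
          k≤49 : abs k ≤ 49
          k≤49 = quotient-small k 49 (subst (λ t → abs t ≤ 49 * ℓ) (trans (cong (_⊝ + x) eq) (aux₁ (+ x) (k · + ℓ)))
            (≤-trans (ℤₚ.∣i-j∣≤∣i∣+∣j∣ (coord i) (+ x)) (≤-trans (+-mono-≤ (proj₁ (coord-spec i m)) x≤) (≤-reflexive (arith ℓ)))))

    private
      longest : ∃ λ m → m ≤ 7 * ℓ × + m · h ∈ D × (∀ k → k ≤ 7 * ℓ → + k · h ∈ D → k ≤ m)
      longest = largest (λ k → dec D (+ k · h)) (resp D (≡⇒≈ (sym (ℤₚ.*-zeroˡ h))) 0∈D) (7 * ℓ)

    -- Half-width of D in units of h; it becomes the l of the line argument.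
    ℓ₀ : ℕ
    ℓ₀ = proj₁ longest

    ℓ₀≤ : ℓ₀ ≤ 7 * ℓ
    ℓ₀≤ = proj₁ (proj₂ longest)

    ℓ₀h∈D : + ℓ₀ · h ∈ D
    ℓ₀h∈D = proj₁ (proj₂ (proj₂ longest))

    short-D : ∀ d → d ∈ D → ∃ λ I → abs I ≤ ℓ₀ × d ≈ I · h
    short-D d dD = go (coordinate-D d dD)
      where
      max : ∀ k → k ≤ 7 * ℓ → + k · h ∈ D → k ≤ ℓ₀
      max = proj₂ (proj₂ (proj₂ longest))
      aux : ∀ k h → ⊖ (⊖ k · h) ≡ k · h
      aux = ℤ-solve
      bound : ∀ I → abs I ≤ 7 * ℓ → d ≈ I · h → abs I ≤ ℓ₀
      bound (+ k)    le e = max k le (resp D e dD)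
      bound -[1+ k ] le e = max (suc k) le (resp D (≈-trans (≈-neg e) (≡⇒≈ (aux (+ suc k) h))) (neg∈D d dD))
      go : (∃ λ I → abs I ≤ 7 * ℓ × d ≈ I · h) → ∃ λ I → abs I ≤ ℓ₀ × d ≈ I · h
      go (I , le , e) = I , bound I le e , e

    -- Translates of the interval [0, ℓ₀) by multiples of ℓ₀ fill a ball, whose size is known.
    ℓ₀-bound : ∀ J → 496 + J ≤ J₀ → 2 * J * ℓ₀ ≤ p → 2 * J * ℓ₀ ≤ (2 * (496 + J) + 1) * u + 1
    ℓ₀-bound J J≤ small = go ℓ₀ refl
      where
      X : ZSet
      X = dilate (B (496 + J)) h
      go : ∀ l → l ≡ ℓ₀ → 2 * J * ℓ₀ ≤ (2 * (496 + J) + 1) * u + 1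
      go zero      e = subst (λ l → 2 * J * l ≤ _) e (subst (_≤ (2 * (496 + J) + 1) * u + 1) (sym (*-zeroʳ (2 * J))) z≤n)
      go l@(suc _) e = ≤-trans (≤-trans count (≤-reflexive (card-dilate (B (496 + J)) h h≉0))) (upper (496 + J) J≤)
        where
        l∈ : + l · h ∈ B 1
        l∈ = B-one (subst (λ t → + t · h ∈ D) (sym e) ℓ₀h∈D)
        -- Division k = r + il splits the point into rh, from the interval, and (i - J) times the
        -- element lh of D.
        inside : ∀ k → k < 2 * J * ℓ₀ → (⊖ + (J * l) ⊹ + k) · h ∈ B (496 + J)
        inside k k< = B-mono (+-monoʳ-≤ 496 (≤-trans (≤-reflexive (*-identityʳ _))
            (abs-difference i J J (<⇒≤ (<-≤-trans i<2J (≤-reflexive (2J J)))) (m≤n+m J i))))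
            (resp (B (496 + abs q * 1)) (≡⇒≈ eq) (B-+ 496 (abs q * 1) (interval∈B r r≤) (B-multipleℤ 1 l∈ q)))
          where
          r i : ℕ
          r = k ℕDM.% l
          i = k ℕDM./ l
          q : ℤ
          q = + i ⊝ + J
          2J : ∀ J → 2 * J ≡ J + J
          2J = ℕ-solve
          r≤ : r ≤ 7 * ℓ
          r≤ = ≤-trans (<⇒≤ (ℕDM.m%n<n k l)) (subst (_≤ 7 * ℓ) (sym e) ℓ₀≤)
          i<2J : i < 2 * J
          i<2J = ℕDM.m<n*o⇒m/o<n (subst (λ t → k < 2 * J * t) (sym e) k<)
          aux : ∀ r i J l h → r · h ⊹ (i ⊝ J) · (l · h) ≡ (⊖ (J · l) ⊹ (r ⊹ i · l)) · h
          aux = ℤ-solve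
          eq : + r · h ⊹ q · (+ l · h) ≡ (⊖ + (J * l) ⊹ + k) · h
          eq = trans (aux (+ r) (+ i) (+ J) (+ l) h) (cong₂ (λ a b → (⊖ a ⊹ b) · h) (sym (ℤₚ.pos-* J l))
            (trans (cong (_⊹_ (+ r)) (sym (ℤₚ.pos-* i l))) (trans (sym (ℤₚ.pos-+ r (i * l))) (cong +_ (sym (ℕDM.m≡m%n+[m/n]*n k l))))))
        count : 2 * J * ℓ₀ ≤ card X
        count = ≤-trans (subst (_≤ ∑ (2 * J * ℓ₀) (λ k → χ X (⊖ + (J * l) ⊹ + k))) (*-identityʳ (2 * J * ℓ₀))
          (∑-≥* (2 * J * ℓ₀) 1 _ λ k k< → ≤-reflexive (sym (𝟙-true (dec X (⊖ + (J * l) ⊹ + k)) (inside k k<)))))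
          (∑-window (χ-per X) (⊖ + (J * l)) (2 * J * ℓ₀) small)

-- Arcs and gaps

-- Truncation to the band [2l, 3l]. It can move only while the value is in the band, that is where
-- `mixed` is 1, so a discrete intermediate value argument becomes a telescoping sum.
clip : ℕ → ℕ → ℕ
clip l v = (v ℕ.⊔ 2 * l) ℕ.⊓ (3 * l)

mixed : ℕ → ℕ → ℕ
mixed l v = 𝟙 ((2 * l ℕₚ.≤? v) ×-dec (v ℕₚ.≤? 3 * l))

clip-step : ∀ l a b → a ≤ suc b → clip l a ≤ clip l b + mixed l a
clip-step l a b a≤1+b with 2 * l ℕₚ.≤? a | a ℕₚ.≤? 3 * l
... | no 2l≰a | _ = ≤-trans (⊓-monoˡ-≤ (3 * l) (≤-trans (≤-reflexive (m≤n⇒m⊔n≡n (≰⇒≥ 2l≰a))) (m≤n⊔m b (2 * l)))) (m≤m+n _ _)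
... | yes 2l≤a | yes a≤3l = ≤-trans (⊓-glb
        (≤-trans (m⊓n≤m (a ℕ.⊔ 2 * l) (3 * l)) (⊔-lub (≤-trans a≤1+b (s≤s (m≤m⊔n b (2 * l)))) (m≤n⇒m≤1+n (m≤n⊔m b (2 * l)))))
        (m≤n⇒m≤1+n (m⊓n≤n (a ℕ.⊔ 2 * l) (3 * l))))
      (≤-reflexive (trans (sym (+-distribˡ-⊓ 1 (b ℕ.⊔ 2 * l) (3 * l))) (+-comm 1 _)))
... | yes 2l≤a | no a≰3l = ≤-trans (⊓-glb
        (≤-trans (m⊓n≤n (a ℕ.⊔ 2 * l) (3 * l)) (≤-trans (ℕ.s≤s⁻¹ (≤-trans (≰⇒> a≰3l) a≤1+b)) (m≤m⊔n b (2 * l))))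
        (m⊓n≤n (a ℕ.⊔ 2 * l) (3 * l)))
      (m≤m+n _ _)

module Crossing (l : ℕ) (v : ℕ → ℕ) (down : ∀ i → v i ≤ suc (v (suc i))) (up : ∀ i → v (suc i) ≤ suc (v i)) where

  private
    falls : ∀ i k → clip l (v i) ≤ clip l (v (k + i)) + ∑ k (λ t → mixed l (v (t + i)))
    falls i zero    = m≤m+n _ 0
    falls i (suc k) = ≤-cancel 0 (+-mono-≤ (falls i k) (clip-step l (v (k + i)) (v (suc k + i)) (down (k + i))))
      (arith (clip l (v i)) (clip l (v (k + i))) _ (clip l (v (suc k + i))) _)
      where
      arith : ∀ a b s c m → a + (b + s + (c + m)) + 0 ≡ c + (m + s) + (a + b)
      arith = ℕ-solve

    rises : ∀ i k → clip l (v (k + i)) ≤ clip l (v i) + ∑ k (λ t → mixed l (v (suc t + i)))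
    rises i zero    = m≤m+n _ 0
    rises i (suc k) = ≤-cancel 0 (+-mono-≤ (rises i k) (clip-step l (v (suc k + i)) (v (k + i)) (up (k + i))))
      (arith (clip l (v i)) (clip l (v (k + i))) _ (clip l (v (suc k + i))) _)
      where
      arith : ∀ a b s c m → c + (a + s + (b + m)) + 0 ≡ a + (m + s) + (b + c)
      arith = ℕ-solve

    inside : ∀ i k n → k + i ≤ n → ∑ k (λ t → mixed l (v (t + i))) ≤ ∑ n (λ t → mixed l (v t))
    inside i k n le = ≤-trans (≤-trans (≤-reflexive (∑-cong k λ t _ → cong (λ s → mixed l (v s)) (+-comm t i)))
      (≤-trans (m≤n+m _ (∑ i (λ t → mixed l (v t)))) (≤-reflexive (sym (∑-split i k _)))))
      (∑-extend _ (subst (_≤ n) (+-comm k i) le))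

    clip-high : ∀ a → 3 * l ≤ a → clip l a ≡ 3 * l
    clip-high a le = m≥n⇒m⊓n≡n (≤-trans le (m≤m⊔n a (2 * l)))

    clip-low : ∀ a → a ≤ 2 * l → clip l a ≡ 2 * l
    clip-low a le = trans (cong (ℕ._⊓ (3 * l)) (m≤n⇒m⊔n≡n le)) (m≤n⇒m⊓n≡m (*-monoˡ-≤ l (n≤1+n 2)))

    gain : ∀ a b s → 3 * l ≤ a → b ≤ 2 * l → clip l a ≤ clip l b + s → l ≤ s
    gain a b s ha hb le = ≤-cancel 0 (subst (λ t → t ≤ 2 * l + s) (clip-high a ha) (subst (λ t → clip l a ≤ t + s) (clip-low b hb) le)) (arith l s)
      where
      arith : ∀ l s → l + (2 * l + s) + 0 ≡ s + 3 * l
      arith = ℕ-solve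

  -- The truncation travels between 3l and 2l in steps of at most 1, each paid by an index in the
  -- band: by `falls` if the high value comes first, by `rises` otherwise.
  crossing : ∀ n i j → i < n → j < n → 3 * l ≤ v i → v j ≤ 2 * l → l ≤ ∑ n (λ t → mixed l (v t))
  crossing n i j i<n j<n hi hj with ≤-total i j
  ... | inj₁ i≤j = ≤-trans (gain (v i) (v j) _ hi hj (subst (λ t → clip l (v i) ≤ clip l (v t) + ∑ (j ∸ i) (λ s → mixed l (v (s + i)))) (m∸n+n≡m i≤j) (falls i (j ∸ i))))
                     (inside i (j ∸ i) n (subst (_≤ n) (sym (m∸n+n≡m i≤j)) (<⇒≤ j<n)))
  ... | inj₂ j≤i = ≤-trans (gain (v i) (v j) _ hi hj (subst (λ t → clip l (v t) ≤ clip l (v j) + ∑ (i ∸ j) (λ s → mixed l (v (suc s + j)))) (m∸n+n≡m j≤i) (rises j (i ∸ j))))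
                     (≤-trans (≤-reflexive (∑-cong (i ∸ j) λ t _ → cong (λ s → mixed l (v s)) (sym (+-suc t j))))
                       (inside (suc j) (i ∸ j) n (subst (_≤ n) (sym (trans (+-suc (i ∸ j) j) (cong suc (m∸n+n≡m j≤i)))) i<n)))

mixed-weight : ∀ l v w → v + w ≡ 4 * l → 2 * l * l * mixed l v ≤ v * w
mixed-weight l v w e with 2 * l ℕₚ.≤? v | v ℕₚ.≤? 3 * l
... | no _     | _        = ≤-trans (≤-reflexive (*-zeroʳ (2 * l * l))) z≤n
... | yes _    | no _     = ≤-trans (≤-reflexive (*-zeroʳ (2 * l * l))) z≤n
... | yes 2l≤v | yes v≤3l = ≤-trans (≤-reflexive (*-identityʳ (2 * l * l))) (*-mono-≤ 2l≤v l≤w)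
  where
  arith : ∀ v w l → l + 3 * l + 0 ≡ 4 * l
  arith = ℕ-solve
  l≤w : l ≤ w
  l≤w = ≤-cancel 0 v≤3l (trans (arith v w l) (trans (sym e) (+-comm v w)))

module Arcs (p : ℕ) .{{nz : NonZero p}} (pr : Prime p) where

  open PrimeResidues p pr public

  χ̄ : ZSet → ℤ → ℕ
  χ̄ X x = 1 ∸ χ X x

  χ+χ̄ : ∀ X x → χ X x + χ̄ X x ≡ 1
  χ+χ̄ X x = m+[n∸m]≡n (χ≤1 X x)

  χ̄-per : ∀ X → Per (χ̄ X)
  χ̄-per X e = cong (1 ∸_) (χ-per X e)

  -- Telescoping along steps of length d from an arc inside X to a gap of X.
  lam-telescope : ∀ X c n d → n ≤ p → (∀ j → j < d → c ⊹ + j ∈ X) → (∀ j → j < d → c ⊹ + (n + j) ∉ X) → d ≤ lam X (+ d)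
  lam-telescope X c n d n≤p inX notX = begin
    d                                               ≡⟨ sym (*-identityʳ d) ⟩
    d * 1                                           ≤⟨ ∑-≥* d 1 _ (λ j j<d → ≤-reflexive (sym (𝟙-true (dec X (c ⊹ + j)) (inX j j<d)))) ⟩
    ∑ d F                                           ≤⟨ ≤-cancel 0 step (arith (∑ d F) (∑ n F) (∑ n (λ j → F (d + j))) (∑ n Λ) balance) ⟩
    ∑ n Λ                                           ≤⟨ ∑-window (χ-per (leaving X (+ d))) c n n≤p ⟩
    lam X (+ d)                                     ∎
    where
    open ℕₚ.≤-Reasoning
    F Λ : ℕ → ℕ
    F j = χ X (c ⊹ + j)
    Λ j = χ (leaving X (+ d)) (c ⊹ + j)
    point : ∀ x → χ X x ≤ χ (leaving X (+ d)) x + χ X (x ⊹ + d)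
    point x with dec X x | dec X (x ⊹ + d)
    ... | yes _ | yes _ = s≤s z≤n
    ... | yes _ | no _  = s≤s z≤n
    ... | no _  | _     = z≤n
    poly : ∀ c j d → c ⊹ j ⊹ d ≡ c ⊹ (d ⊹ j)
    poly = ℤ-solve
    step : ∑ n F ≤ ∑ n Λ + ∑ n (λ j → F (d + j))
    step = ≤-trans (∑-mono n λ j _ → ≤-trans (point (c ⊹ + j)) (≤-reflexive (cong (λ t → Λ j + χ X t) (poly c (+ j) (+ d)))))
      (≤-reflexive (∑-+ n _ _))
    balance : ∑ d F + ∑ n (λ j → F (d + j)) ≡ ∑ n F
    balance = trans (sym (∑-split d n F)) (trans (cong (λ t → ∑ t F) (+-comm d n)) (trans (∑-split n d F)
      (trans (cong (_+_ (∑ n F)) (∑-vanish d _ λ j j<d → 𝟙-false (dec X (c ⊹ + (n + j))) (notX j j<d))) (+-identityʳ _))))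
    arith : ∀ a b s t → a + s ≡ b → a + (t + s) + 0 ≡ t + b
    arith a b s t refl = poly′ a s t
      where
      poly′ : ∀ a s t → a + (t + s) + 0 ≡ t + (a + s)
      poly′ = ℕ-solve

  -- Union bound: if y is outside X but y - j is in X, then y is one of the λ(j) points of X + j
  -- outside X. The points y to be avoided are fewer than p.
  gap : ∀ X l → ∑ l (λ x → lam X (+ suc x)) + card X < p → ∃ λ y → ∀ j → j ≤ l → y ⊝ + j ∉ X
  gap X l small = locate (∑-<-witness p cover (λ _ → 1) (subst (_< ∑ p (λ _ → 1)) (sym total) (subst (∑ l (λ x → lam X (+ suc x)) + card X <_) (sym (trans (∑-const p 1) (*-identityʳ p))) small)))
    where
    cover : ℕ → ℕ
    cover i = ∑ l (λ x → χ (leaving X (+ suc x)) (+ i ⊝ + suc x)) + χ X (+ i)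
    total : ∑ p cover ≡ ∑ l (λ x → lam X (+ suc x)) + card X
    total = trans (∑-+ p _ _) (cong (_+ card X) (trans (∑-swap p l (λ i x → χ (leaving X (+ suc x)) (+ i ⊝ + suc x)))
      (∑-cong l λ x _ → S-shift (χ-per (leaving X (+ suc x))) (⊖ + suc x))))
    aux : ∀ y j → y ⊝ j ⊹ j ≡ y
    aux = ℤ-solve
    locate : (∃ λ i → i < p × cover i < 1) → ∃ λ y → ∀ j → j ≤ l → y ⊝ + j ∉ X
    locate (i , _ , s≤s none) = + i , out
      where
      cover≡0 : cover i ≡ 0
      cover≡0 = n≤0⇒n≡0 none
      here∉ : + i ∉ X
      here∉ m = 1+n≢0 (trans (sym (𝟙-true (dec X (+ i)) m)) (m+n≡0⇒n≡0 (∑ l _) cover≡0))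
      out : ∀ j → j ≤ l → + i ⊝ + j ∉ X
      out zero    _   m = here∉ (resp X (≡⇒≈ (ℤₚ.+-identityʳ (+ i))) m)
      out (suc j) j<l m = <⇒≱ (≤-trans (≤-reflexive (sym (𝟙-true (dec (leaving X (+ suc j)) (+ i ⊝ + suc j))
          (m , λ m′ → here∉ (resp X (≡⇒≈ (aux (+ i) (+ suc j))) m′)))))
        (∑-term l (λ x → χ (leaving X (+ suc x)) (+ i ⊝ + suc x)) j j<l)) (≤-reflexive (m+n≡0⇒m≡0 _ cover≡0))

  -- Each of the d progressions of difference d that start in the arc has to leave X before it
  -- reaches the gap, and each contributes to λ(d).
  lam≥distance : ∀ X c l → (∀ i → i < l → c ⊹ + i ∈ X) → ∑ l (λ x → lam X (+ suc x)) + card X < p →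
    ∀ d → d ≤ l → d ≤ lam X (+ d)
  lam≥distance X c l arc small d d≤l = go (gap X l small)
    where
    go : (∃ λ y → ∀ j → j ≤ l → y ⊝ + j ∉ X) → d ≤ lam X (+ d)
    go (y , out) = lam-telescope X c n d (<⇒≤ (ρ<p (y ⊝ + l ⊝ c))) (λ j j<d → arc j (<-≤-trans j<d d≤l)) notX
      where
      n : ℕ
      n = ρ (y ⊝ + l ⊝ c)
      aux : ∀ c y l j → c ⊹ (y ⊝ l ⊝ c ⊹ j) ≡ y ⊝ (l ⊝ j)
      aux = ℤ-solve
      aux′ : ∀ a j → a ⊹ j ⊝ j ≡ a
      aux′ = ℤ-solve
      notX : ∀ j → j < d → c ⊹ + (n + j) ∉ X
      notX j j<d m = out (l ∸ j) (m∸n≤m l j) (resp X (≈-trans (≈-+ˡ c (≈-trans (≡⇒≈ (ℤₚ.pos-+ n j)) (≈-+ʳ (+ j) (≈-sym (≈ρ (y ⊝ + l ⊝ c))))))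
        (≡⇒≈ (trans (aux c y (+ l) (+ j)) (cong (_⊝_ y) (trans (cong (_⊝ + j) (trans (cong +_ (sym (m∸n+n≡m j≤l))) (ℤₚ.pos-+ (l ∸ j) j))) (aux′ (+ (l ∸ j)) (+ j))))))) m)
        where
        j≤l : j ≤ l
        j≤l = <⇒≤ (<-≤-trans j<d d≤l)

  infixl 5 _∪_

  _∪_ : ZSet → ZSet → ZSet
  X ∪ Y = zset (λ x → x ∈ X ⊎ x ∈ Y) (λ x → dec X x ⊎-dec dec Y x)
    λ { e (inj₁ m) → inj₁ (resp X e m) ; e (inj₂ m) → inj₂ (resp Y e m) }

  card-∪ : ∀ X Y → card (X ∪ Y) ≤ card X + card Y
  card-∪ X Y = ≤-trans (S-mono point) (≤-reflexive (∑-+ p _ _))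
    where
    point : ∀ x → χ (X ∪ Y) x ≤ χ X x + χ Y x
    point x with dec X x | dec Y x
    ... | yes _ | _     = s≤s z≤n
    ... | no _  | yes _ = s≤s z≤n
    ... | no _  | no _  = z≤n

  -- A point leaving or entering H by a step d comes from A or from H′ ∖ H, so filling H removes lam H d
  -- of the steps that leave A, up to 2 |H′ ∖ H|.
  lam-fill : ∀ A H H′ d → (∀ x → x ∈ H → x ∉ A) → (∀ x → x ∈ H → x ∈ H′) →
    (∀ x → x ∈ H → x ⊹ d ∈ A ⊎ x ⊹ d ∈ H′) → (∀ x → x ⊹ d ∈ H → x ∈ A ⊎ x ∈ H′) →
    lam (A ∪ H) d + lam H d + 2 * card H ≤ lam A d + 2 * card H′
  lam-fill A H H′ d disjoint sub fwd bwd = ≤-cancel 0 (begin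
      lam (A ∪ H) d + lam H d + card H + card H + card H
        ≡⟨ sym (trans (∑₅ (χ (leaving (A ∪ H) d)) (χ (leaving H d)) (λ x → χ H (x ⊹ d)) (λ x → χ H (x ⊹ d)) (χ H)) (cong₂ (λ s t → lam (A ∪ H) d + lam H d + s + t + card H) shiftH shiftH)) ⟩
      S (λ x → χ (leaving (A ∪ H) d) x + χ (leaving H d) x + χ H (x ⊹ d) + χ H (x ⊹ d) + χ H x)
        ≤⟨ S-mono point ⟩
      S (λ x → χ (leaving A d) x + χ H′ (x ⊹ d) + χ H′ x + χ H x)
        ≡⟨ trans (trans (∑-+ p _ _) (cong (_+ card H) (trans (∑-+ p _ _) (cong (_+ card H′) (∑-+ p _ _)))))
             (cong (λ s → lam A d + s + card H′ + card H) (S-shift (χ-per H′) d)) ⟩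
      lam A d + card H′ + card H′ + card H ∎)
    (arith (lam (A ∪ H) d) (lam H d) (card H) (lam A d) (card H′))
    where
    open ℕₚ.≤-Reasoning
    shiftH : S (λ x → χ H (x ⊹ d)) ≡ card H
    shiftH = S-shift (χ-per H) d
    arith : ∀ a b h c h′ → a + b + 2 * h + (c + h′ + h′ + h) + 0 ≡ c + 2 * h′ + (a + b + h + h + h)
    arith = ℕ-solve
    ∑₅ : ∀ (f g h k l : ℤ → ℕ) → S (λ x → f x + g x + h x + k x + l x) ≡ S f + S g + S h + S k + S l
    ∑₅ f g h k l = trans (∑-+ p _ _) (cong (_+ S l) (trans (∑-+ p _ _) (cong (_+ S k) (trans (∑-+ p _ _) (cong (_+ S h) (∑-+ p _ _))))))
    point : ∀ x → χ (leaving (A ∪ H) d) x + χ (leaving H d) x + χ H (x ⊹ d) + χ H (x ⊹ d) + χ H x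
                ≤ χ (leaving A d) x + χ H′ (x ⊹ d) + χ H′ x + χ H x
    point x = cases (dec A x) (dec H x) (dec A (x ⊹ d)) (dec H (x ⊹ d)) (dec H′ x) (dec H′ (x ⊹ d))
      where
      cases : (a : Dec (x ∈ A)) (h : Dec (x ∈ H)) (a′ : Dec (x ⊹ d ∈ A)) (h′ : Dec (x ⊹ d ∈ H)) (k : Dec (x ∈ H′)) (k′ : Dec (x ⊹ d ∈ H′)) →
        𝟙 ((a ⊎-dec h) ×-dec ¬? (a′ ⊎-dec h′)) + 𝟙 (h ×-dec ¬? h′) + 𝟙 h′ + 𝟙 h′ + 𝟙 h ≤ 𝟙 (a ×-dec ¬? a′) + 𝟙 k′ + 𝟙 k + 𝟙 h
      cases (yes a) (yes h) _        _        _       _        = ⊥-elim (disjoint x h a)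
      cases _       _       (yes a′) (yes h′) _       _        = ⊥-elim (disjoint (x ⊹ d) h′ a′)
      cases _       (yes h) _        _        (no ¬k) _        = ⊥-elim (¬k (sub x h))
      cases _       _       _        (yes h′) _       (no ¬k′) = ⊥-elim (¬k′ (sub (x ⊹ d) h′))
      cases (no ¬a) (no ¬h) _        (yes h′) (no ¬k) _        = ⊥-elim (both (bwd x h′))
        where
        both : x ∈ A ⊎ x ∈ H′ → ⊥
        both (inj₁ a) = ¬a a
        both (inj₂ k) = ¬k k
      cases _       (yes h) (no ¬a′) (no ¬h′) _       (no ¬k′) = ⊥-elim (both (fwd x h))
        where
        both : x ⊹ d ∈ A ⊎ x ⊹ d ∈ H′ → ⊥
        both (inj₁ a) = ¬a′ a
        both (inj₂ k) = ¬k′ k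
      cases (no _)  (yes _) (yes _)  (no _)   (yes _) (yes _)  = m≤m+n 2 1
      cases (no _)  (yes _) (yes _)  (no _)   (yes _) (no _)   = ≤-refl
      cases (no _)  (yes _) (no _)   (no _)   (yes _) (yes _)  = ≤-refl
      cases (no _)  (yes _) (no _)   (yes _)  (yes _) (yes _)  = ≤-refl
      cases (no _)  (no _)  (no _)   (yes _)  (yes _) (yes _)  = ≤-refl
      cases (yes _) (no _)  (no _)   (yes _)  (yes _) (yes _)  = m≤m+n 2 1
      cases (yes _) (no _)  (no _)   (yes _)  (no _)  (yes _)  = ≤-refl
      cases (no _)  (no _)  (yes _)  (no _)   _       _        = z≤n
      cases (no _)  (no _)  (no _)   (no _)   _       _        = z≤n
      cases (yes _) (no _)  (yes _)  (no _)   _       _        = z≤n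
      cases (yes _) (no _)  (no _)   (no _)   _       _        = s≤s z≤n

-- Dense windows

private
  window-contradiction : ∀ l K t n → 0 < l → 0 < K →
    l * l * (K * l * (4 * l * n)) ≤ 3 * (K * l) * (K * l * (4 * l * (4 * l * (4 * t)))) → n ≤ 48 * K * t
  window-contradiction l K t n 0<l 0<K h = *-cancelˡ-≤ (4 * (l * l * l * l * K)) {{ℕ.>-nonZero pos}}
    (subst₂ _≤_ (lhs l K n) (rhs l K t) h)
    where
    pos : 0 < 4 * (l * l * l * l * K)
    pos = *-mono-≤ {1} {4} (s≤s z≤n) (*-mono-≤ (*-mono-≤ (*-mono-≤ (*-mono-≤ 0<l 0<l) 0<l) 0<l) 0<K)
    lhs : ∀ l K n → l * l * (K * l * (4 * l * n)) ≡ 4 * (l * l * l * l * K) * n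
    lhs = ℕ-solve
    rhs : ∀ l K t → 3 * (K * l) * (K * l * (4 * l * (4 * l * (4 * t)))) ≡ 4 * (l * l * l * l * K) * (48 * K * t)
    rhs = ℕ-solve

module DenseWindow (p : ℕ) .{{nz : NonZero p}} (pr : Prime p) (A : Residues.ZSet p) (l t K : ℕ)
  (0<l : 0 < l) (0<K : 0 < K) where

  open Arcs p pr public

  module Dense (lam≤t : ∀ x → x ≤ l → lam A (+ x) ≤ t) (large : 48 * K * t < card A) (Kl≤p : K * l ≤ p) where

    lam-far : ∀ k x → x ≤ k * l → lam A (+ x) ≤ k * t
    lam-far zero    zero z≤n = ≤-reflexive (lam-zero A ≈-refl)
    lam-far (suc k) x le with ≤-total x l
    ... | inj₁ x≤l = ≤-trans (lam≤t x x≤l) (m≤m+n t (k * t))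
    ... | inj₂ l≤x = subst (λ s → lam A (+ s) ≤ t + k * t) (m+[n∸m]≡n l≤x)
            (≤-trans (lam-subadd A (+ l) (+ (x ∸ l))) (+-mono-≤ (lam≤t l ≤-refl) (lam-far k (x ∸ l) (m≤n+o⇒m∸n≤o x l le))))

    lam-farℤ : ∀ q → abs q ≤ 4 * l → lam A q ≤ 4 * t
    lam-farℤ (+ x)    le = lam-far 4 x le
    lam-farℤ -[1+ x ] le = subst (_≤ 4 * t) (sym (lam-neg A (+ suc x))) (lam-far 4 (suc x) le)

    w L : ℕ
    w = 4 * l
    L = K * l

    ω ω̄ : ℤ → ℕ
    ω y = ∑ w (λ i → χ A (y ⊹ + i))
    ω̄ y = ∑ w (λ i → χ̄ A (y ⊹ + i))

    ω+ω̄ : ∀ y → ω y + ω̄ y ≡ w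
    ω+ω̄ y = trans (sym (∑-+ w _ _)) (trans (∑-cong w λ i _ → χ+χ̄ A (y ⊹ + i)) (trans (∑-const w 1) (*-identityʳ w)))

    ω-per : Per ω
    ω-per e = ∑-cong w λ i _ → χ-per A (≈-+ʳ (+ i) e)

    ω̄-per : Per ω̄
    ω̄-per e = ∑-cong w λ i _ → χ̄-per A (≈-+ʳ (+ i) e)

    ωω̄-per : Per (λ y → ω y * ω̄ y)
    ωω̄-per e = cong₂ _*_ (ω-per e) (ω̄-per e)

    private
      product : ∀ x d → χ A x * χ̄ A (x ⊹ d) ≡ χ (leaving A d) x
      product x d with dec A x | dec A (x ⊹ d)
      ... | yes _ | yes _ = refl
      ... | yes _ | no _  = refl
      ... | no _  | _     = refl

      cross : ∀ i j → S (λ y → χ A (y ⊹ + i) * χ̄ A (y ⊹ + j)) ≡ lam A (+ j ⊝ + i)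
      cross i j = trans (S-cong λ y → trans (cong (λ s → χ A (y ⊹ + i) * χ̄ A s) (aux y (+ i) (+ j))) (product (y ⊹ + i) (+ j ⊝ + i)))
        (S-shift (χ-per (leaving A (+ j ⊝ + i))) (+ i))
        where
        aux : ∀ y i j → y ⊹ j ≡ y ⊹ i ⊹ (j ⊝ i)
        aux = ℤ-solve

      short : ∀ i j → i < w → j < w → abs (+ j ⊝ + i) ≤ w
      short i j i<w j<w = abs-difference j i w (≤-trans (<⇒≤ j<w) (m≤n+m w i)) (≤-trans (<⇒≤ i<w) (m≤n+m w j))

    -- Counts pairs of a point of A and a point outside A in a common window; for fixed positions i
    -- and j the count over all windows is λ(j - i).
    ∑ωω̄ : S (λ y → ω y * ω̄ y) ≤ w * (w * (4 * t))
    ∑ωω̄ = begin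
      S (λ y → ω y * ω̄ y)
        ≡⟨ S-cong (λ y → trans (sym (∑-*ʳ w (ω̄ y) (λ i → χ A (y ⊹ + i)))) (∑-cong w λ i _ → sym (∑-*ˡ w (χ A (y ⊹ + i)) (λ j → χ̄ A (y ⊹ + j))))) ⟩
      S (λ y → ∑ w (λ i → ∑ w (λ j → χ A (y ⊹ + i) * χ̄ A (y ⊹ + j))))
        ≡⟨ trans (∑-swap p w _) (∑-cong w λ i _ → trans (∑-swap p w _) (∑-cong w λ j _ → cross i j)) ⟩
      ∑ w (λ i → ∑ w (λ j → lam A (+ j ⊝ + i)))
        ≤⟨ ∑-≤* w _ _ (λ i i<w → ∑-≤* w _ _ λ j j<w → lam-farℤ (+ j ⊝ + i) (short i j i<w j<w)) ⟩
      w * (w * (4 * t)) ∎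
      where open ℕₚ.≤-Reasoning

    ∑ω : S ω ≡ w * card A
    ∑ω = trans (∑-swap p w (λ y i → χ A (+ y ⊹ + i))) (trans (∑-cong w λ i _ → S-shift (χ-per A) (+ i)) (∑-const w (card A)))

    Good : ℤ → Set
    Good y = ∀ {i} → i < L → 2 * l ≤ ω (y ⊹ + i)

    private
      slide : ∀ y → ω (y ⊹ + 1) + χ A y ≡ ω y + χ A (y ⊹ + w)
      slide y = trans (cong₂ _+_ (∑-cong w λ i _ → cong (χ A) (aux y (+ i))) (cong (χ A) (sym (ℤₚ.+-identityʳ y))))
        (trans (+-comm _ (F 0)) (trans (sym (trans (∑-split 1 w F) (cong (_+ ∑ w (λ i → F (1 + i))) (+-identityʳ (F 0))))) (+-comm (F w) (∑ w F))))
        where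
        F : ℕ → ℕ
        F i = χ A (y ⊹ + i)
        aux : ∀ y i → y ⊹ + 1 ⊹ i ≡ y ⊹ (+ 1 ⊹ i)
        aux = ℤ-solve

      next : ∀ y i → y ⊹ + suc i ≡ y ⊹ + i ⊹ + 1
      next y i = aux y (+ i)
        where
        aux : ∀ y i → y ⊹ (+ 1 ⊹ i) ≡ y ⊹ i ⊹ + 1
        aux = ℤ-solve

      module Window (y : ℤ) where

        v v̄ : ℕ → ℕ
        v i = ω (y ⊹ + i)
        v̄ i = ω̄ (y ⊹ + i)

        v-down : ∀ i → v i ≤ suc (v (suc i))
        v-down i = subst (λ s → v i ≤ suc (ω s)) (sym (next y i)) (≤-cancel (χ A (y ⊹ + i ⊹ + w)) (χ≤1 A (y ⊹ + i))
          (trans (arith (v i) (χ A (y ⊹ + i ⊹ + w))) (trans (cong suc (sym (slide (y ⊹ + i)))) refl)))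
          where
          arith : ∀ a c → a + 1 + c ≡ suc (a + c)
          arith = ℕ-solve

        v-up : ∀ i → v (suc i) ≤ suc (v i)
        v-up i = subst (λ s → ω s ≤ suc (v i)) (sym (next y i)) (≤-cancel (χ A (y ⊹ + i)) (χ≤1 A (y ⊹ + i ⊹ + w))
          (trans (arith (ω (y ⊹ + i ⊹ + 1)) (χ A (y ⊹ + i))) (cong suc (slide (y ⊹ + i)))))
          where
          arith : ∀ a c → a + 1 + c ≡ suc (a + c)
          arith = ℕ-solve

        v+v̄ : ∀ i → v i + v̄ i ≡ w
        v+v̄ i = ω+ω̄ (y ⊹ + i)

        e c : ℕ
        e = ∑ L v
        c = ∑ L (λ i → v i * v̄ i)

        sparse : (∀ i → i < L → v i ≤ 3 * l) → l * e ≤ c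
        sparse h = subst (_≤ c) (∑-*ˡ L l v) (∑-mono L λ i i<L → ≤-trans (≤-reflexive (*-comm l (v i)))
          (*-monoʳ-≤ (v i) (≤-cancel 0 (h i i<L) (trans (arith l) (trans (sym (v+v̄ i)) (+-comm (v i) (v̄ i)))))))
          where
          arith : ∀ l → l + 3 * l + 0 ≡ 4 * l
          arith = ℕ-solve

        crossed : ∀ i j → i < L → j < L → 3 * l ≤ v i → v j ≤ 2 * l → 2 * l * l * l ≤ c
        crossed i j i<L j<L hi hj = ≤-trans (*-monoʳ-≤ (2 * l * l) (Crossing.crossing l v v-down v-up L i j i<L j<L hi hj))
          (≤-trans (≤-reflexive (sym (∑-*ˡ L (2 * l * l) (λ i → mixed l (v i))))) (∑-mono L λ i _ → mixed-weight l (v i) (v̄ i) (v+v̄ i)))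

        e≤ : e ≤ L * w
        e≤ = ∑-≤* L w v λ i _ → ≤-trans (m≤m+n (v i) (v̄ i)) (≤-reflexive (v+v̄ i))

        -- Either no window reaches three quarters of its length, and then every window has at least
        -- l points outside A; or the filling crosses the band [2l, 3l], and each of at least l
        -- windows there contributes at least 2l · l mixed pairs.
        notGood : ¬ Good y → l * l * e ≤ 3 * L * c
        notGood ¬g = decide (anyUpTo? (λ i → v i ℕₚ.<? 2 * l) L) (anyUpTo? (λ i → 3 * l ℕₚ.≤? v i) L)
          where
          open ℕₚ.≤-Reasoning
          arith₁ : ∀ l e → l * l * e ≡ l * (l * e)
          arith₁ = ℕ-solve
          arith₂ : ∀ l L → l * l * (L * (4 * l)) ≡ 2 * L * (2 * l * l * l)
          arith₂ = ℕ-solve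
          decide : Dec (∃ λ i → i < L × v i < 2 * l) → Dec (∃ λ i → i < L × 3 * l ≤ v i) → l * l * e ≤ 3 * L * c
          decide (no none) _ = ⊥-elim (¬g λ {i} i<L → ≮⇒≥ λ lt → none (i , i<L , lt))
          decide (yes _) (no none) = begin
            l * l * e      ≡⟨ arith₁ l e ⟩
            l * (l * e)    ≤⟨ *-mono-≤ (≤-trans (m≤n*m l K {{ℕ.>-nonZero 0<K}}) (m≤n*m L 3))
                                (sparse λ i i<L → <⇒≤ (≰⇒> λ le → none (i , i<L , le))) ⟩
            3 * L * c      ∎
          decide (yes (j , j<L , hj)) (yes (i , i<L , hi)) = begin
            l * l * e                    ≤⟨ *-monoʳ-≤ (l * l) e≤ ⟩
            l * l * (L * (4 * l))        ≡⟨ arith₂ l L ⟩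
            2 * L * (2 * l * l * l)      ≤⟨ *-mono-≤ (*-monoˡ-≤ L (n≤1+n 2)) (crossed i j i<L j<L hi (<⇒≤ hj)) ⟩
            3 * L * c                    ∎

    good? : ∀ y → Dec (Good y)
    good? y = allUpTo? (λ i → 2 * l ℕₚ.≤? ω (y ⊹ + i)) L

    -- If all arcs were bad, summing `notGood` over them would give l² · L w n ≤ 3L · L w² · 4t,
    -- that is n ≤ 48Kt.
    good-window : ∃ λ y → Good y
    good-window = decide (anyUpTo? (λ i → good? (+ i)) p)
      where
      decide : Dec (∃ λ i → i < p × Good (+ i)) → ∃ λ y → Good y
      decide (yes (i , _ , g)) = + i , g
      decide (no none) = ⊥-elim (<⇒≱ large (window-contradiction l K t (card A) 0<l 0<K (begin
          l * l * (L * (w * card A))               ≡⟨ cong (λ s → l * l * s) (sym total-e) ⟩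
          l * l * S (λ y → Window.e y)             ≡⟨ sym (∑-*ˡ p (l * l) (λ i → Window.e (+ i))) ⟩
          S (λ y → l * l * Window.e y)             ≤⟨ ∑-mono p (λ i i<p → Window.notGood (+ i) λ g → none (i , i<p , g)) ⟩
          S (λ y → 3 * L * Window.c y)             ≡⟨ ∑-*ˡ p (3 * L) (λ i → Window.c (+ i)) ⟩
          3 * L * S (λ y → Window.c y)             ≡⟨ cong (λ s → 3 * L * s) total-c ⟩
          3 * L * (L * S (λ y → ω y * ω̄ y))        ≤⟨ *-monoʳ-≤ (3 * L) (*-monoʳ-≤ L ∑ωω̄) ⟩
          3 * L * (L * (w * (w * (4 * t))))        ∎)))
        where
        open ℕₚ.≤-Reasoning
        total-e : S (λ y → Window.e y) ≡ L * (w * card A)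
        total-e = trans (∑-swap p L (λ y i → ω (+ y ⊹ + i))) (trans (∑-cong L λ i _ → trans (S-shift ω-per (+ i)) ∑ω) (∑-const L (w * card A)))
        total-c : S (λ y → Window.c y) ≡ L * S (λ y → ω y * ω̄ y)
        total-c = trans (∑-swap p L (λ y i → ω (+ y ⊹ + i) * ω̄ (+ y ⊹ + i))) (trans (∑-cong L λ i _ → S-shift ωω̄-per (+ i)) (∑-const L _))

    -- Each hole x sees at least 2l points of A in [x, x + 4l), and the pairs are counted by λ at
    -- differences below 4l: 2l times the number of holes is at most 4l · 4t.
    few-holes : ∀ y → Good y → ∑ L (λ i → χ̄ A (y ⊹ + i)) ≤ 8 * t
    few-holes y good = *-cancelˡ-≤ (2 * l) {{ℕ.>-nonZero (≤-trans 0<l (m≤n*m l 2))}} (begin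
        2 * l * ∑ L (λ i → χ̄ A (y ⊹ + i))                     ≡⟨ sym (∑-*ˡ L (2 * l) _) ⟩
        ∑ L (λ i → 2 * l * χ̄ A (y ⊹ + i))                     ≤⟨ ∑-mono L (λ i i<L → *-monoˡ-≤ (χ̄ A (y ⊹ + i)) (good i<L)) ⟩
        ∑ L (λ i → ω (y ⊹ + i) * χ̄ A (y ⊹ + i))               ≤⟨ ∑-window {λ x → ω x * χ̄ A x} (λ e → cong₂ _*_ (ω-per e) (χ̄-per A e)) y L Kl≤p ⟩
        S (λ x → ω x * χ̄ A x)                                 ≡⟨ S-cong (λ x → sym (∑-*ʳ w (χ̄ A x) (λ i → χ A (x ⊹ + i)))) ⟩
        S (λ x → ∑ w (λ i → χ A (x ⊹ + i) * χ̄ A x))           ≡⟨ ∑-swap p w _ ⟩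
        ∑ w (λ i → S (λ x → χ A (x ⊹ + i) * χ̄ A x))           ≤⟨ ∑-≤* w (4 * t) _ (λ i i<w → ≤-trans (≤-reflexive (column i)) (lam-farℤ (+ 0 ⊝ + i) (short i 0 i<w (≤-trans 0<l (m≤n*m l 4))))) ⟩
        w * (4 * t)                                           ≡⟨ arith l t ⟩
        2 * l * (8 * t)                                       ∎)
      where
      open ℕₚ.≤-Reasoning
      arith : ∀ l t → 4 * l * (4 * t) ≡ 2 * l * (8 * t)
      arith = ℕ-solve
      column : ∀ i → S (λ x → χ A (x ⊹ + i) * χ̄ A x) ≡ lam A (+ 0 ⊝ + i)
      column i = trans (S-cong λ x → cong (λ s → χ A (x ⊹ + i) * χ̄ A s) (sym (ℤₚ.+-identityʳ x))) (cross i 0)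

-- Popular differences

∑-initial : ∀ n m → ∑ n (λ i → 𝟙 (i ℕₚ.<? m)) ≤ m
∑-initial zero    m = z≤n
∑-initial (suc n) m with n ℕₚ.<? m
... | yes n<m = ≤-trans (s≤s (≤-trans (∑-≤* n 1 _ λ i _ → 𝟙≤1 (i ℕₚ.<? m)) (≤-reflexive (*-identityʳ n)))) n<m
... | no _    = ∑-initial n m

-- The elements of T are popular differences of H that lie close together, so the sumsets iT, I < i ≤ 2I,
-- are disjoint and provide too many popular differences.
module PopularSums (p : ℕ) .{{nz : NonZero p}} (pr : Prime p) (H T : Residues.ZSet p) (u l s I : ℕ)
  (0<u : 0 < u) (0<s : 0 < s) (0<I : 0 < I) (narrow : 8 * I * l ≤ (8 * I + 1) * u) (8Is≤u : 8 * I * s ≤ u) (4Iu≤p : 4 * I * u < p) where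

  open Arcs p pr public

  module Contradiction (many : s + 1 ≤ card T)
    (location : ∀ x → x ∈ T → ∃ λ v → x ≈ + v × u ≤ v + s × v ≤ l)
    (popular : ∀ x → x ∈ T → lam H x ≤ 2 * s) (8Is≤h : 8 * I * s ≤ card H) (small : 2 * card H < I * I * s) where

    private
      h : ℕ
      h = card H

      0<h : 0 < h
      0<h = ≤-trans (*-mono-≤ (*-mono-≤ {1} {8} (s≤s z≤n) 0<I) 0<s) 8Is≤h

      l≤2u : l ≤ 2 * u
      l≤2u = *-cancelˡ-≤ (8 * I) {{ℕ.>-nonZero (*-mono-≤ {1} {8} (s≤s z≤n) 0<I)}} (≤-trans narrow (≤-trans
        (*-monoˡ-≤ u (+-monoʳ-≤ (8 * I) (*-mono-≤ {1} {8} (s≤s z≤n) 0<I))) (≤-reflexive (arith I u))))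
        where
        arith : ∀ I u → (8 * I + 8 * I) * u ≡ 8 * I * (2 * u)
        arith = ℕ-solve

      positions : ∀ i x → x ∈ pow T i → ∃ λ v → x ≈ + v × i * u ≤ v + i * s × v ≤ i * l
      positions zero    x m = 0 , m , z≤n , z≤n
      positions (suc i) x (y , yT , m) = join (location y yT) (positions i (x ⊝ y) m)
        where
        aux : ∀ x y → x ≡ y ⊹ (x ⊝ y)
        aux = ℤ-solve
        arith : ∀ a b c d → a + b + (c + d) ≡ a + c + (b + d)
        arith = ℕ-solve
        join : (∃ λ v → y ≈ + v × u ≤ v + s × v ≤ l) → (∃ λ v → x ⊝ y ≈ + v × i * u ≤ v + i * s × v ≤ i * l) →
               ∃ λ v → x ≈ + v × suc i * u ≤ v + suc i * s × v ≤ suc i * l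
        join (v , e , a , b) (v′ , e′ , a′ , b′) = v + v′ , ≈-trans (≡⇒≈ (aux x y)) (≈-+ e e′) ,
          ≤-trans (+-mono-≤ a a′) (≤-reflexive (arith v s v′ (i * s))) , +-mono-≤ b b′

      v<p : ∀ i v → i ≤ 2 * I → v ≤ i * l → v < p
      v<p i v i≤ v≤ = ≤-<-trans (≤-trans v≤ (≤-trans (*-mono-≤ i≤ l≤2u) (≤-reflexive (arith I u)))) 4Iu≤p
        where
        arith : ∀ I u → 2 * I * (2 * u) ≡ 4 * I * u
        arith = ℕ-solve

      -- iT lies in [i(u - s), il], and both l - u and s are at most u / 8I. An overlap with jT
      -- would need u ≤ (i + j) u / 8I, but i + j < 4I.
      apart : ∀ i j v → i < j → j ≤ 2 * I → v ≤ i * l → j * u ≤ v + j * s → ⊥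
      apart i j v i<j j≤2I v≤il ju≤ = <-irrefl refl (begin-strict
        8 * I * (j * u)                                   ≤⟨ *-monoʳ-≤ (8 * I) (≤-trans ju≤ (+-monoˡ-≤ (j * s) v≤il)) ⟩
        8 * I * (i * l + j * s)                           ≡⟨ arith₁ I i l j s ⟩
        i * (8 * I * l) + j * (8 * I * s)                 ≤⟨ +-mono-≤ (*-monoʳ-≤ i narrow) (*-monoʳ-≤ j 8Is≤u) ⟩
        i * ((8 * I + 1) * u) + j * u                     ≡⟨ arith₂ I i j u ⟩
        (8 * I * i + (i + j)) * u                         <⟨ *-monoˡ-< u {{ℕ.>-nonZero 0<u}} (begin-strict
            8 * I * i + (i + j)                           <⟨ +-monoʳ-< (8 * I * i) (≤-trans (+-mono-≤ (≤-trans i<j j≤2I) j≤2I) (≤-reflexive (arith₃ I))) ⟩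
            8 * I * i + 4 * I                             ≤⟨ +-monoʳ-≤ (8 * I * i) (*-monoˡ-≤ I (m≤m+n 4 4)) ⟩
            8 * I * i + 8 * I                             ≡⟨ arith₄ I i ⟩
            8 * I * suc i                                 ≤⟨ *-monoʳ-≤ (8 * I) i<j ⟩
            8 * I * j                                     ∎) ⟩
        8 * I * j * u                                     ≡⟨ *-assoc (8 * I) j u ⟩
        8 * I * (j * u)                                   ∎)
        where
        open ℕₚ.≤-Reasoning
        arith₁ : ∀ I i l j s → 8 * I * (i * l + j * s) ≡ i * (8 * I * l) + j * (8 * I * s)
        arith₁ = ℕ-solve
        arith₂ : ∀ I i j u → i * ((8 * I + 1) * u) + j * u ≡ (8 * I * i + (i + j)) * u
        arith₂ = ℕ-solve
        arith₃ : ∀ I → 2 * I + 2 * I ≡ 4 * I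
        arith₃ = ℕ-solve
        arith₄ : ∀ I i → 8 * I * i + 8 * I ≡ 8 * I * suc i
        arith₄ = ℕ-solve

      -- Only the upper half I < i ≤ 2I is used, so that each iT has at least Is elements.
      level : ℕ → ℕ
      level t = I + suc t

      level≤ : ∀ t → t < I → level t ≤ 2 * I
      level≤ t t<I = ≤-trans (+-monoʳ-≤ I t<I) (≤-reflexive (arith I))
        where
        arith : ∀ I → I + I ≡ 2 * I
        arith = ℕ-solve

      disjoint : ∀ x a b → a < I → b < I → x ∈ pow T (level a) → x ∈ pow T (level b) → a ≡ b
      disjoint x a b a<I b<I ma mb = go (positions (level a) x ma) (positions (level b) x mb) (<-cmp a b)
        where
        go : (∃ λ v → x ≈ + v × level a * u ≤ v + level a * s × v ≤ level a * l) →
             (∃ λ v → x ≈ + v × level b * u ≤ v + level b * s × v ≤ level b * l) → Tri (a < b) (a ≡ b) (b < a) → a ≡ b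
        go (v , e , lo , hi) (v′ , e′ , lo′ , hi′) = order (≈-unique (v<p _ v (level≤ a a<I) hi) (v<p _ v′ (level≤ b b<I) hi′) (≈-trans (≈-sym e) e′))
          where
          order : v ≡ v′ → Tri (a < b) (a ≡ b) (b < a) → a ≡ b
          order refl (tri< a<b _ _) = ⊥-elim (apart (level a) (level b) v (+-monoʳ-< I (s≤s a<b)) (level≤ b b<I) hi lo′)
          order refl (tri≈ _ a≡b _) = a≡b
          order refl (tri> _ _ b<a) = ⊥-elim (apart (level b) (level a) v (+-monoʳ-< I (s≤s b<a)) (level≤ a a<I) hi′ lo)

      -- λ of H is at most 2I · 2s ≤ h / 2 on these sumsets, so half of H survives as
      -- representations.
      rep-large : ∀ t → t < I → ∀ x → x ∈ pow T (level t) → h ≤ 2 * rep H x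
      rep-large t t<I x m = ≤-cancel 0 twice (trans (cong₂ (λ a b → a + b + 0) (sym (lam+rep H x)) (sym (lam+rep H x))) (arith (lam H x) (rep H x)))
        where
        open ℕₚ.≤-Reasoning
        arith : ∀ a b → a + b + (a + b) + 0 ≡ 2 * b + (a + a)
        arith = ℕ-solve
        twice : lam H x + lam H x ≤ h
        twice = begin
          lam H x + lam H x                         ≤⟨ +-mono-≤ bound bound ⟩
          2 * I * (2 * s) + 2 * I * (2 * s)         ≡⟨ arith′ I s ⟩
          8 * I * s                                 ≤⟨ 8Is≤h ⟩
          h                                         ∎
          where
          bound : lam H x ≤ 2 * I * (2 * s)
          bound = ≤-trans (lam-pow H T (2 * s) popular (level t) x m) (*-monoˡ-≤ (2 * s) (level≤ t t<I))
          arith′ : ∀ I s → 2 * I * (2 * s) + 2 * I * (2 * s) ≡ 8 * I * s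
          arith′ = ℕ-solve

      many-each : ∀ t → t < I → I * s ≤ card (pow T (level t))
      many-each t t<I = ≤-trans (≤-trans (*-monoˡ-≤ s (m≤m+n I (suc t))) (m≤m+n (level t * s) 1))
        (subst (λ j → level t * s + 1 ≤ card (pow T j)) (*-identityʳ (level t))
          (pow-growth T 1 s (≤-trans many (card-mono T (pow T 1) λ x m → x , m , ≡⇒≈ (ℤₚ.+-inverseʳ x))) (level t) (begin
            level t * s + 1         ≤⟨ +-monoˡ-≤ 1 (*-monoˡ-≤ s (level≤ t t<I)) ⟩
            2 * I * s + 1           ≤⟨ +-monoˡ-≤ 1 (≤-trans (*-monoˡ-≤ s (*-monoˡ-≤ I (m≤m+n 2 6))) 8Is≤u) ⟩
            u + 1                   ≡⟨ +-comm u 1 ⟩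
            suc u                   ≤⟨ s≤s (m≤n*m u (4 * I) {{ℕ.>-nonZero (*-mono-≤ {1} {4} (s≤s z≤n) 0<I)}}) ⟩
            suc (4 * I * u)         ≤⟨ 4Iu≤p ⟩
            p                       ∎)))
        where open ℕₚ.≤-Reasoning

      total : ℤ → ℕ
      total x = ∑ I (λ t → χ (pow T (level t)) x)

      total≤1 : ∀ x → total x ≤ 1
      total≤1 x = ∑-atMostOne I _ 1 (λ t _ → χ≤1 (pow T (level t)) x)
        λ a b a<I b<I pa pb → disjoint x a b a<I b<I (𝟙-pos (dec (pow T (level a)) x) pa) (𝟙-pos (dec (pow T (level b)) x) pb)

    contradiction′ : ⊥
    -- I disjoint sumsets of at least Is points, each point with at least h / 2 representations,
    -- against h² representations in total.
    contradiction′ = <⇒≱ small (*-cancelˡ-≤ h {{ℕ.>-nonZero 0<h}} (begin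
      h * (I * I * s)                         ≡⟨ cong (h *_) (*-assoc I I s) ⟩
      h * (I * (I * s))                       ≤⟨ *-monoʳ-≤ h (∑-≥* I (I * s) _ many-each) ⟩
      h * ∑ I (λ t → card (pow T (level t)))  ≡⟨ cong (h *_) (∑-swap I p (λ t i → χ (pow T (level t)) (+ i))) ⟩
      h * S total                             ≡⟨ sym (∑-*ˡ p h _) ⟩
      S (λ x → h * total x)                   ≤⟨ S-mono point ⟩
      S (λ x → 2 * rep H x)                   ≡⟨ trans (∑-*ˡ p 2 _) (cong (2 *_) (∑-rep H)) ⟩
      2 * (h * h)                             ≡⟨ arith h ⟩
      h * (2 * h)                             ∎))
      where
      open ℕₚ.≤-Reasoning
      arith : ∀ h → 2 * (h * h) ≡ h * (2 * h)
      arith = ℕ-solve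
      point : ∀ x → h * total x ≤ 2 * rep H x
      point x = go (total x) refl (total≤1 x)
        where
        go : ∀ v → total x ≡ v → v ≤ 1 → h * v ≤ 2 * rep H x
        go zero    _ _ = ≤-trans (≤-reflexive (*-zeroʳ h)) z≤n
        go (suc v) e v≤ = ≤-trans (≤-trans (*-monoʳ-≤ h v≤) (≤-reflexive (*-identityʳ h)))
          (witness (∑-positive I _ (subst (0 <_) (sym e) (s≤s z≤n))))
          where
          witness : (∃ λ t → t < I × 0 < χ (pow T (level t)) x) → h ≤ 2 * rep H x
          witness (t , t<I , lt) = rep-large t t<I x (𝟙-pos (dec (pow T (level t)) x) lt)

-- Filling the holes of an arc

slow-growth : ∀ E k (h : ℕ → ℕ) → 0 < h 0 → h k * E ^ k < (E + 1) ^ k →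
  ∃ λ j → j < k × E * h (suc j) ≤ (E + 1) * h j
slow-growth E k h 0<h₀ bound = decide (anyUpTo? (λ j → E * h (suc j) ℕₚ.≤? (E + 1) * h j) k)
  where
  decide : Dec (∃ λ j → j < k × E * h (suc j) ≤ (E + 1) * h j) → ∃ λ j → j < k × E * h (suc j) ≤ (E + 1) * h j
  decide (yes w) = w
  -- Otherwise each of the k steps multiplies h by more than 1 + 1 / E, and h(k) is at least (1 + 1
  -- / E)^k.
  decide (no none) = ⊥-elim (<⇒≱ bound (fast k ≤-refl))
    where
    open ℕₚ.≤-Reasoning
    arith₁ : ∀ E x y → E * x * y ≡ x * (E * y)
    arith₁ = ℕ-solve
    arith₂ : ∀ E x y → (E + 1) * (x * y) ≡ (E + 1) * x * y
    arith₂ = ℕ-solve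
    fast : ∀ j → j ≤ k → (E + 1) ^ j ≤ h j * E ^ j
    fast zero    _   = ≤-trans 0<h₀ (≤-reflexive (sym (*-identityʳ (h 0))))
    fast (suc j) j<k = begin
      (E + 1) * (E + 1) ^ j           ≤⟨ *-monoʳ-≤ (E + 1) (fast j (<⇒≤ j<k)) ⟩
      (E + 1) * (h j * E ^ j)         ≡⟨ arith₂ E (h j) (E ^ j) ⟩
      (E + 1) * h j * E ^ j           ≤⟨ *-monoˡ-≤ (E ^ j) (≰⇒≥ λ le → none (j , j<k , le)) ⟩
      E * h (suc j) * E ^ j           ≡⟨ arith₁ E (h (suc j)) (E ^ j) ⟩
      h (suc j) * (E * E ^ j)         ∎

module Holes (p : ℕ) .{{nz : NonZero p}} (pr : Prime p) (A : Residues.ZSet p) where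

  open Arcs p pr public

  arc : ℤ → ℕ → ZSet
  arc a len = zset (λ x → ∃ λ i → i < len × x ≈ a ⊹ + i) (λ x → anyUpTo? (λ i → x ≈? a ⊹ + i) len)
    λ { e (i , lt , e′) → i , lt , ≈-trans (≈-sym e) e′ }

  holes : ℤ → ℕ → ZSet
  holes a len = zset (λ x → x ∈ arc a len × x ∉ A) (λ x → dec (arc a len) x ×-dec ¬? (dec A x))
    λ { e (m , x∉) → resp (arc a len) e m , λ m′ → x∉ (resp A (≈-sym e) m′) }

  card-holes : ∀ a len → card (holes a len) ≤ ∑ len (λ i → χ̄ A (a ⊹ + i))
  card-holes a len = begin
    card (holes a len)                                                    ≤⟨ S-mono point ⟩
    S (λ x → ∑ len (λ i → 𝟙 (a ⊹ + i ≈? x) * χ̄ A (a ⊹ + i)))              ≡⟨ ∑-swap p len (λ x i → 𝟙 (a ⊹ + i ≈? + x) * χ̄ A (a ⊹ + i)) ⟩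
    ∑ len (λ i → S (λ x → 𝟙 (a ⊹ + i ≈? x) * χ̄ A (a ⊹ + i)))              ≡⟨ ∑-cong len (λ i _ → trans (∑-*ʳ p (χ̄ A (a ⊹ + i)) (λ x → 𝟙 (a ⊹ + i ≈? + x)))
                                                                               (trans (cong (_* χ̄ A (a ⊹ + i)) (δ-total (a ⊹ + i))) (*-identityˡ _))) ⟩
    ∑ len (λ i → χ̄ A (a ⊹ + i))                                           ∎
    where
    open ℕₚ.≤-Reasoning
    point : ∀ x → χ (holes a len) x ≤ ∑ len (λ i → 𝟙 (a ⊹ + i ≈? x) * χ̄ A (a ⊹ + i))
    point x = go (dec (holes a len) x)
      where
      go : (d : Dec (x ∈ holes a len)) → 𝟙 d ≤ ∑ len (λ i → 𝟙 (a ⊹ + i ≈? x) * χ̄ A (a ⊹ + i))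
      go (no _) = z≤n
      go (yes ((i , i<len , e) , x∉)) = ≤-trans (≤-reflexive (sym (cong₂ _*_ (𝟙-true (a ⊹ + i ≈? x) (≈-sym e))
          (cong (1 ∸_) (𝟙-false (dec A (a ⊹ + i)) λ m → x∉ (resp A (≈-sym e) m))))))
        (∑-term len (λ i → 𝟙 (a ⊹ + i ≈? x) * χ̄ A (a ⊹ + i)) i i<len)

  arc-shift : ∀ a len b off len′ → a ≡ b ⊹ + off → off + len ≤ len′ → ∀ x → x ∈ arc a len → x ∈ arc b len′
  arc-shift a len b off len′ refl le x (i , i<len , e) = off + i , <-≤-trans (+-monoʳ-< off i<len) le ,
    ≈-trans e (≡⇒≈ (aux b (+ off) (+ i)))
    where
    aux : ∀ b o i → b ⊹ o ⊹ i ≡ b ⊹ (o ⊹ i)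
    aux = ℤ-solve

  fill-or-hole : ∀ a len x → x ∈ arc a len → x ∈ A ⊎ x ∈ holes a len
  fill-or-hole a len x m = go (dec A x)
    where
    go : Dec (x ∈ A) → x ∈ A ⊎ x ∈ holes a len
    go (yes m′) = inj₁ m′
    go (no ¬m)  = inj₂ (m , ¬m)

  module Enlarge (a b : ℤ) (l len : ℕ) (a≡ : a ≡ b ⊹ + l) where

    private
      H H′ : ZSet
      H  = holes a len
      H′ = holes b (l + len + l)

      sub : ∀ x → x ∈ H → x ∈ H′
      sub x (m , x∉) = arc-shift a len b l (l + len + l) a≡ (m≤m+n (l + len) l) x m , x∉

      fwd : ∀ d → d ≤ l → ∀ x → x ∈ H → x ⊹ + d ∈ A ⊎ x ⊹ + d ∈ H′
      fwd d d≤l x ((i , i<len , e) , _) = fill-or-hole b (l + len + l) (x ⊹ + d)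
        (l + i + d , +-mono-<-≤ (+-monoʳ-< l i<len) d≤l , ≈-trans (≈-+ʳ (+ d) e) (≡⇒≈ (trans (cong (λ t → t ⊹ + i ⊹ + d) a≡) (aux b (+ l) (+ i) (+ d)))))
        where
        aux : ∀ b l i d → b ⊹ l ⊹ i ⊹ d ≡ b ⊹ (l ⊹ i ⊹ d)
        aux = ℤ-solve

      bwd : ∀ d → d ≤ l → ∀ x → x ⊹ + d ∈ H → x ∈ A ⊎ x ∈ H′
      bwd d d≤l x ((i , i<len , e) , _) = fill-or-hole b (l + len + l) x
        (l ∸ d + i , <-≤-trans (+-mono-≤-< (m∸n≤m l d) i<len) (m≤m+n (l + len) l) ,
          ≈-trans (≡⇒≈ (aux₁ x (+ d))) (≈-trans (≈-−ʳ (+ d) e) (≡⇒≈ (trans (cong (λ t → t ⊹ + i ⊝ + d) a≡)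
            (trans (cong (λ t → b ⊹ t ⊹ + i ⊝ + d) (trans (cong +_ (sym (m∸n+n≡m d≤l))) (ℤₚ.pos-+ (l ∸ d) d))) (aux₂ b (+ (l ∸ d)) (+ d) (+ i)))))))
        where
        aux₁ : ∀ x d → x ≡ x ⊹ d ⊝ d
        aux₁ = ℤ-solve
        aux₂ : ∀ b m d i → b ⊹ (m ⊹ d) ⊹ i ⊝ d ≡ b ⊹ (m ⊹ i)
        aux₂ = ℤ-solve

    -- A step d ≤ l out of H or into H stays in the arc enlarged by l at both ends, so its other end
    -- lies in A or in H′, as `lam-fill` requires.
    enlarge-lam : ∀ d → d ≤ l → lam (A ∪ holes a len) (+ d) + lam (holes a len) (+ d) + 2 * card (holes a len)
                    ≤ lam A (+ d) + 2 * card (holes b (l + len + l))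
    enlarge-lam d d≤l = lam-fill A H H′ (+ d) (λ _ → proj₂) sub (fwd d d≤l) (bwd d d≤l)

module LineArgument (p : ℕ) .{{nz : NonZero p}} (pr : Prime p) (A D : Residues.ZSet p) (u l r I E k : ℕ)
  (0<u : 0 < u) (0<r : 0 < r) (r≤I : r ≤ I) (E≡ : E ≡ 128 * r * I) (2E≤I² : 2 * E ≤ I * I)
  (narrow : 8 * I * l ≤ (8 * I + 1) * u) (growth : 8 * (r * u) * E ^ k < (E + 1) ^ k) (8u²<p : 8 * (u * u) < p) where

  open Holes p pr A public

  private
    n : ℕ
    n = card A

    0<I : 0 < I
    0<I = ≤-trans 0<r r≤I

    instance
      I≢0 : NonZero I
      I≢0 = ℕ.>-nonZero 0<I
      r≢0 : NonZero r
      r≢0 = ℕ.>-nonZero 0<r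
      E≢0 : NonZero E
      E≢0 = subst NonZero (sym E≡) (m*n≢0 (128 * r) I {{m*n≢0 128 r}})

    8l≤9u : 8 * l ≤ 9 * u
    8l≤9u = *-cancelˡ-≤ I (≤-trans (≤-reflexive (arith₁ I l)) (≤-trans narrow
      (≤-trans (*-monoˡ-≤ u (+-monoʳ-≤ (8 * I) 0<I)) (≤-reflexive (arith₂ I u)))))
      where
      arith₁ : ∀ I l → I * (8 * l) ≡ 8 * I * l
      arith₁ = ℕ-solve
      arith₂ : ∀ I u → (8 * I + I) * u ≡ I * (9 * u)
      arith₂ = ℕ-solve

    l≤2u : l ≤ 2 * u
    l≤2u = *-cancelˡ-≤ 8 (≤-trans 8l≤9u (≤-trans (*-monoˡ-≤ u (m≤m+n 9 7)) (≤-reflexive (arith u))))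
      where
      arith : ∀ u → 16 * u ≡ 8 * (2 * u)
      arith = ℕ-solve

  module Refute (l∈D : + l ∈ D) (many : u ≤ ∑ l (λ i → χ D (+ suc i))) (lamD : ∀ d → d ∈ D → lam A d < u)
    (lamI : ∀ x → x ≤ l → lam A (+ x) ≤ r * u) (large : 48 * (2 * k + 1) * (r * u) < card A)
    (4Iu≤n : 4 * I * u ≤ card A) (2n<p : 2 * card A < p) where

    private
      u≤l : u ≤ l
      u≤l = ≤-trans many (≤-trans (∑-≤* l 1 _ λ i _ → χ≤1 D (+ suc i)) (≤-reflexive (*-identityʳ l)))

      0<l : 0 < l
      0<l = ≤-trans 0<u u≤l

      n<p : n < p
      n<p = ≤-<-trans (m≤n*m n 2) 2n<p

      0<K : 0 < 2 * k + 1
      0<K = m≤n+m 1 (2 * k)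

      48ru<n : 48 * (r * u) < n
      48ru<n = ≤-<-trans (≤-trans (m≤n*m (48 * (r * u)) (2 * k + 1) {{ℕ.>-nonZero 0<K}}) (≤-reflexive (arith k (r * u)))) large
        where
        arith : ∀ k t → (2 * k + 1) * (48 * t) ≡ 48 * (2 * k + 1) * t
        arith = ℕ-solve

      Kl≤p : (2 * k + 1) * l ≤ p
      Kl≤p = <⇒≤ (≤-<-trans (begin
        (2 * k + 1) * l                     ≤⟨ *-monoʳ-≤ (2 * k + 1) (≤-trans l≤2u (*-mono-≤ (m≤m+n 2 46) (m≤n*m u r))) ⟩
        (2 * k + 1) * (48 * (r * u))        ≡⟨ arith k (r * u) ⟩
        48 * (2 * k + 1) * (r * u)          ≤⟨ <⇒≤ large ⟩
        n                                   ∎) n<p)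
        where
        open ℕₚ.≤-Reasoning
        arith : ∀ k t → (2 * k + 1) * (48 * t) ≡ 48 * (2 * k + 1) * t
        arith = ℕ-solve

      open DenseWindow.Dense p pr A l (r * u) (2 * k + 1) 0<l 0<K lamI large Kl≤p using (good-window; few-holes)

      y : ℤ
      y = proj₁ good-window

      full-holes : card (holes y ((2 * k + 1) * l)) ≤ 8 * (r * u)
      full-holes = ≤-trans (card-holes y ((2 * k + 1) * l)) (few-holes y (proj₂ good-window))

      -- The arcs of length (2j + 1)l are concentric and reach the whole dense window at j = k.
      start : ℕ → ℤ
      start j = y ⊹ + ((k ∸ j) * l)

      H : ℕ → ZSet
      H j = holes (start j) ((2 * j + 1) * l)

      h : ℕ → ℕ
      h j = card (H j)

      h≤ : ∀ j → j ≤ k → h j ≤ 8 * (r * u)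
      h≤ j j≤k = ≤-trans (card-mono (H j) (holes y ((2 * k + 1) * l)) λ { x (m , x∉) →
          arc-shift (start j) ((2 * j + 1) * l) y ((k ∸ j) * l) ((2 * k + 1) * l) refl fits x m , x∉ }) full-holes
        where
        arith : ∀ a j l → a * l + (2 * j + 1) * l ≡ (a + j + j + 1) * l
        arith = ℕ-solve
        arith′ : ∀ k → k + k + 1 ≡ 2 * k + 1
        arith′ = ℕ-solve
        fits : (k ∸ j) * l + (2 * j + 1) * l ≤ (2 * k + 1) * l
        fits = ≤-trans (≤-reflexive (arith (k ∸ j) j l)) (*-monoˡ-≤ l (≤-trans
          (+-monoˡ-≤ 1 (+-mono-≤ (≤-reflexive (m∸n+n≡m j≤k)) j≤k)) (≤-reflexive (arith′ k))))

      σ : ℕ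
      σ = ∑ l (λ x → lam A (+ suc x))

      -- All but u / 8I of the x ≤ l lie in D, where λ < u; they contribute at most lu ≤ 9u² / 8. On
      -- the others λ ≤ ru with r ≤ I, which adds at most u² / 8.
      8σ≤ : 8 * σ ≤ 10 * (u * u)
      8σ≤ = begin
        8 * σ                                    ≤⟨ *-monoʳ-≤ 8 (∑-mono l point) ⟩
        8 * ∑ l (λ x → χ D (+ suc x) * u + χ̄ D (+ suc x) * (r * u)) ≡⟨ cong (8 *_) (trans (∑-+ l _ _) (cong₂ _+_ (∑-*ʳ l u _) (∑-*ʳ l (r * u) _))) ⟩
        8 * (C * u + C̄ * (r * u))                ≡⟨ arith₁ C u C̄ r ⟩
        8 * C * u + 8 * (r * C̄) * u              ≤⟨ +-mono-≤ (*-monoˡ-≤ u (≤-trans (*-monoʳ-≤ 8 C≤l) 8l≤9u)) (*-monoˡ-≤ u 8rC̄≤u) ⟩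
        9 * u * u + u * u                        ≡⟨ arith₂ u ⟩
        10 * (u * u)                             ∎
        where
        open ℕₚ.≤-Reasoning
        C C̄ : ℕ
        C = ∑ l (λ x → χ D (+ suc x))
        C̄ = ∑ l (λ x → χ̄ D (+ suc x))
        arith₁ : ∀ C u C̄ r → 8 * (C * u + C̄ * (r * u)) ≡ 8 * C * u + 8 * (r * C̄) * u
        arith₁ = ℕ-solve
        arith₂ : ∀ u → 9 * u * u + u * u ≡ 10 * (u * u)
        arith₂ = ℕ-solve
        C+C̄ : C + C̄ ≡ l
        C+C̄ = trans (sym (∑-+ l _ _)) (trans (∑-cong l λ x _ → χ+χ̄ D (+ suc x)) (trans (∑-const l 1) (*-identityʳ l)))
        C≤l : C ≤ l
        C≤l = ≤-trans (m≤m+n C C̄) (≤-reflexive C+C̄)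
        8IC̄≤u : 8 * I * C̄ ≤ u
        8IC̄≤u = ≤-cancel 0 (+-mono-≤ narrow (*-monoʳ-≤ (8 * I) many)) (trans (arith₃ I C̄ C u) (cong (λ t → u + (8 * I * t + 8 * I * u)) C+C̄))
          where
          arith₃ : ∀ I C̄ C u → 8 * I * C̄ + ((8 * I + 1) * u + 8 * I * C) + 0 ≡ u + (8 * I * (C + C̄) + 8 * I * u)
          arith₃ = ℕ-solve
        8rC̄≤u : 8 * (r * C̄) ≤ u
        8rC̄≤u = ≤-trans (*-monoʳ-≤ 8 (*-monoˡ-≤ C̄ r≤I)) (≤-trans (≤-reflexive (sym (*-assoc 8 I C̄))) 8IC̄≤u)
        point : ∀ x → x < l → lam A (+ suc x) ≤ χ D (+ suc x) * u + χ̄ D (+ suc x) * (r * u)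
        point x x<l = go (dec D (+ suc x))
          where
          go : (d : Dec (+ suc x ∈ D)) → lam A (+ suc x) ≤ 𝟙 d * u + (1 ∸ 𝟙 d) * (r * u)
          go (yes m) = ≤-trans (<⇒≤ (lamD _ m)) (≤-trans (≤-reflexive (sym (*-identityˡ u))) (m≤m+n (1 * u) _))
          go (no _)  = ≤-trans (lamI (suc x) x<l) (≤-reflexive (sym (*-identityˡ (r * u))))

      -- Provides the hypothesis of `lam≥distance`, for A and for the filled set: 16(s + c) ≤ 24u² +
      -- 16n + 128ru, where 128ru ≤ 6n, and by 8u² < p and 2n < p this is below 3p + 11p.
      below-p : ∀ s c h′ → 8 * s ≤ 12 * (u * u) → c ≤ n + h′ → h′ ≤ 8 * (r * u) → s + c < p
      below-p s c h′ hs hc hh = *-cancelˡ-< 16 (s + c) p (begin-strict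
        16 * (s + c)                                       ≡⟨ arith₁ s c ⟩
        2 * (8 * s) + 16 * c                               ≤⟨ +-mono-≤ (*-monoʳ-≤ 2 hs) (*-monoʳ-≤ 16 (≤-trans hc (+-monoʳ-≤ n hh))) ⟩
        2 * (12 * (u * u)) + 16 * (n + 8 * (r * u))        ≡⟨ arith₂ (u * u) n (r * u) ⟩
        3 * (8 * (u * u)) + (16 * n + 128 * (r * u))       ≤⟨ +-monoʳ-≤ (3 * (8 * (u * u))) (+-monoʳ-≤ (16 * n) (≤-trans (*-monoˡ-≤ (r * u) (m≤m+n 128 160)) (≤-trans (≤-reflexive (arith₃ (r * u))) (*-monoʳ-≤ 6 (<⇒≤ 48ru<n))))) ⟩
        3 * (8 * (u * u)) + (16 * n + 6 * n)               ≡⟨ arith₄ (8 * (u * u)) n ⟩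
        3 * (8 * (u * u)) + 11 * (2 * n)                   <⟨ +-mono-<-≤ (*-monoʳ-< 3 8u²<p) (*-monoʳ-≤ 11 (<⇒≤ 2n<p)) ⟩
        3 * p + 11 * p                                     ≤⟨ ≤-cancel {a = 0} (2 * p) z≤n (arith₅ p) ⟩
        16 * p                                             ∎)
        where
        open ℕₚ.≤-Reasoning
        arith₁ : ∀ s c → 16 * (s + c) ≡ 2 * (8 * s) + 16 * c
        arith₁ = ℕ-solve
        arith₂ : ∀ q n t → 2 * (12 * q) + 16 * (n + 8 * t) ≡ 3 * (8 * q) + (16 * n + 128 * t)
        arith₂ = ℕ-solve
        arith₃ : ∀ t → 288 * t ≡ 6 * (48 * t)
        arith₃ = ℕ-solve
        arith₄ : ∀ q n → 3 * q + (16 * n + 6 * n) ≡ 3 * q + 11 * (2 * n)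
        arith₄ = ℕ-solve
        arith₅ : ∀ p → 3 * p + 11 * p + 0 + 2 * p ≡ 16 * p + 0
        arith₅ = ℕ-solve

      -- Without holes in the central arc, A contains an arc of length l, so lam A l ≥ l ≥ u.
      hole-exists : 0 < h 0
      hole-exists = ≰⇒> λ h₀≤0 → <⇒≱ (lamD (+ l) l∈D) (≤-trans u≤l
        (lam≥distance A (start 0) l (λ i i<l → inside h₀≤0 i i<l) (below-p σ n 0 (≤-trans 8σ≤ (*-monoˡ-≤ (u * u) (m≤m+n 10 2)))
          (m≤m+n n 0) z≤n) l ≤-refl))
        where
        inside : h 0 ≤ 0 → ∀ i → i < l → start 0 ⊹ + i ∈ A
        inside h₀≤0 i i<l = go (fill-or-hole (start 0) ((2 * 0 + 1) * l) (start 0 ⊹ + i)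
            (i , <-≤-trans i<l (≤-reflexive (sym (*-identityˡ l))) , ≈-refl))
          where
          go : start 0 ⊹ + i ∈ A ⊎ start 0 ⊹ + i ∈ H 0 → start 0 ⊹ + i ∈ A
          go (inj₁ m) = m
          go (inj₂ m) = ⊥-elim (<⇒≱ (card-pos (H 0) (start 0 ⊹ + i) m) h₀≤0)

    contradiction : ⊥
    -- h goes from at least 1 to at most 8ru in k steps, so one step multiplies it by at most 1 + 1
    -- / E.
    contradiction = onLevel (slow-growth E k h hole-exists (≤-<-trans (*-monoˡ-≤ (E ^ k) (h≤ k ≤-refl)) growth))
      where
      onLevel : (∃ λ j → j < k × E * h (suc j) ≤ (E + 1) * h j) → ⊥
      onLevel (j , j<k , slow) = Level.refute
        where
        module Level where
          h₀ h₁ q s g : ℕ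
          h₀ = h j
          h₁ = h (suc j)
          -- q will bound the number g of new holes. Then s = 2q is the depth below u to which
          -- elements of D are taken into T, and 2s bounds λ of H on T.
          q  = h₀ ℕDM./ E
          s  = 2 * q
          g  = h₁ ∸ h₀

          h₀≤ : h₀ ≤ 8 * (r * u)
          h₀≤ = h≤ j (<⇒≤ j<k)

          len≡ : l + (2 * j + 1) * l + l ≡ (2 * suc j + 1) * l
          len≡ = arith l j
            where
            arith : ∀ l j → l + (2 * j + 1) * l + l ≡ (2 * suc j + 1) * l
            arith = ℕ-solve

          start≡ : start j ≡ start (suc j) ⊹ + l
          start≡ = trans (cong (λ t → y ⊹ + (t * l)) (sym (suc-pred (k ∸ j) {{ℕ.>-nonZero (m<n⇒0<n∸m j<k)}}))) (trans
            (cong (λ t → y ⊹ + (suc t * l)) (pred[m∸n]≡m∸[1+n] k j)) (trans (cong (_⊹_ y) (ℤₚ.pos-+ l ((k ∸ suc j) * l))) (aux y (+ l) (+ ((k ∸ suc j) * l)))))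
            where
            aux : ∀ y l t → y ⊹ (l ⊹ t) ≡ y ⊹ t ⊹ l
            aux = ℤ-solve

          filled : ∀ d → d ≤ l → lam (A ∪ H j) (+ d) + lam (H j) (+ d) ≤ lam A (+ d) + 2 * g
          filled d d≤l = ≤-cancel 0 (+-mono-≤ (subst (λ t → lam (A ∪ H j) (+ d) + lam (H j) (+ d) + 2 * h₀ ≤ lam A (+ d) + 2 * card (holes (start (suc j)) t)) len≡
              (Enlarge.enlarge-lam (start j) (start (suc j)) l ((2 * j + 1) * l) start≡ d d≤l)) (*-monoʳ-≤ 2 (m≤n+m∸n h₁ h₀)))
            (arith (lam (A ∪ H j) (+ d)) (lam (H j) (+ d)) h₀ (lam A (+ d)) h₁ g)
            where
            arith : ∀ a b h c h₁ g → a + b + (c + 2 * h₁ + 2 * (h + g)) + 0 ≡ c + 2 * g + (a + b + 2 * h + 2 * h₁)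
            arith = ℕ-solve

          Eg≤h : E * g ≤ h₀
          Eg≤h = ≤-trans (≤-reflexive (*-distribˡ-∸ E h₁ h₀)) (m≤n+o⇒m∸n≤o (E * h₁) (E * h₀) (≤-trans slow (≤-reflexive (arith E h₀))))
            where
            arith : ∀ E h → (E + 1) * h ≡ E * h + h
            arith = ℕ-solve

          g≤q : g ≤ q
          g≤q = ≤-trans (≤-reflexive (sym (ℕDM.m*n/n≡m g E))) (ℕDM./-monoˡ-≤ E (≤-trans (≤-reflexive (*-comm g E)) Eg≤h))

          Eq≤h : E * q ≤ h₀
          Eq≤h = ≤-trans (≤-reflexive (*-comm E q)) (ℕDM.m/n*n≤m h₀ E)

          -- E q ≤ h ≤ 8 r u with E = 128 r I
          16Iq≤u : 16 * I * q ≤ u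
          16Iq≤u = *-cancelˡ-≤ (8 * r) {{m*n≢0 8 r}} (≤-trans (≤-reflexive (trans (arith r I q) (cong (_* q) (sym E≡))))
            (≤-trans Eq≤h (≤-trans h₀≤ (≤-reflexive (sym (*-assoc 8 r u))))))
            where
            arith : ∀ r I q → 8 * r * (16 * I * q) ≡ 128 * r * I * q
            arith = ℕ-solve

          16g≤u : 16 * g ≤ u
          16g≤u = ≤-trans (*-monoʳ-≤ 16 g≤q) (≤-trans (*-monoˡ-≤ q (m≤m*n 16 I)) 16Iq≤u)

          small-Â : ∑ l (λ x → lam (A ∪ H j) (+ suc x)) + card (A ∪ H j) < p
          small-Â = below-p _ (card (A ∪ H j)) h₀ (begin
              8 * ∑ l (λ x → lam (A ∪ H j) (+ suc x))       ≤⟨ *-monoʳ-≤ 8 (∑-mono l λ x x<l → ≤-trans (m≤m+n _ _) (filled (suc x) x<l)) ⟩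
              8 * ∑ l (λ x → lam A (+ suc x) + 2 * g)       ≡⟨ cong (8 *_) (trans (∑-+ l _ _) (cong (_+_ σ) (∑-const l (2 * g)))) ⟩
              8 * (σ + l * (2 * g))                         ≡⟨ arith₁ σ l g ⟩
              8 * σ + l * (16 * g)                          ≤⟨ +-mono-≤ 8σ≤ (*-mono-≤ l≤2u 16g≤u) ⟩
              10 * (u * u) + 2 * u * u                      ≡⟨ arith₂ u ⟩
              12 * (u * u)                                  ∎)
            (card-∪ A (H j)) h₀≤
            where
            open ℕₚ.≤-Reasoning
            arith₁ : ∀ σ l g → 8 * (σ + l * (2 * g)) ≡ 8 * σ + l * (16 * g)
            arith₁ = ℕ-solve
            arith₂ : ∀ u → 10 * (u * u) + 2 * u * u ≡ 12 * (u * u)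
            arith₂ = ℕ-solve

          arc⊆Â : ∀ i → i < l → start j ⊹ + i ∈ A ∪ H j
          arc⊆Â i i<l = fill-or-hole (start j) ((2 * j + 1) * l) (start j ⊹ + i)
            (i , <-≤-trans i<l (m≤n*m l (2 * j + 1) {{ℕ.>-nonZero (m≤n+m 1 (2 * j))}}) , ≈-refl)

          -- The filled set contains an arc of length l, so its λ takes at least d out of λ(d) < u
          -- for A; by `filled`, only the rest and 2g remain for H.
          lam-H : ∀ d → d ≤ l → + d ∈ D → d + lam (H j) (+ d) < u + 2 * g
          lam-H d d≤l dD = ≤-<-trans (+-monoˡ-≤ (lam (H j) (+ d)) (lam≥distance (A ∪ H j) (start j) l arc⊆Â small-Â d d≤l))
            (≤-<-trans (filled d d≤l) (+-monoˡ-< (2 * g) (lamD (+ d) dD)))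

          -- If q = 0, no holes are added, and d = l ≥ u contradicts `lam-H`.
          0<q : 0 < q
          0<q = ≰⇒> λ q≤0 → <⇒≱ (lam-H l ≤-refl l∈D) (≤-trans
            (≤-reflexive (trans (cong (λ t → u + 2 * t) (n≤0⇒n≡0 (≤-trans g≤q q≤0))) (+-identityʳ u)))
            (≤-trans u≤l (m≤m+n l _)))

          T : ZSet
          T = zset (λ x → ∃ λ i → i < l × (u ≤ suc i + s × + suc i ∈ D × x ≈ + suc i))
            (λ x → anyUpTo? (λ i → (u ℕₚ.≤? suc i + s) ×-dec (dec D (+ suc i) ×-dec (x ≈? + suc i))) l)
            λ { e (i , a , b , c , d) → i , a , b , c , ≈-trans (≈-sym e) d }

          -- At most u - s - 1 of the u elements of D in [1, l] lie below u - s.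
          card-T : s + 1 ≤ card T
          card-T = ≤-cancel 0 (≤-trans many (≤-trans (∑-mono l point) (≤-trans (≤-reflexive (∑-+ l _ _)) (+-mono-≤ window (∑-initial l (u ∸ suc s))))))
            (trans (arith s (card T) (u ∸ suc s)) (cong (_+_ (card T)) (m+[n∸m]≡n s<u)))
            where
            arith : ∀ s c m → s + 1 + (c + m) + 0 ≡ c + (suc s + m)
            arith = ℕ-solve
            s<u : suc s ≤ u
            s<u = ≤-trans (+-monoˡ-≤ s 0<s) (≤-trans (≤-reflexive (arith′ q)) (≤-trans (*-monoˡ-≤ q (≤-trans (m≤m+n 4 12) (m≤m*n 16 I))) 16Iq≤u))
              where
              0<s : 0 < s
              0<s = ≤-trans 0<q (m≤n*m q 2)
              arith′ : ∀ q → 2 * q + 2 * q ≡ 4 * q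
              arith′ = ℕ-solve
            window : ∑ l (λ i → χ T (+ suc i)) ≤ card T
            window = ∑-window (χ-per T) (+ 1) l (≤-trans (m≤n*m l (2 * k + 1) {{ℕ.>-nonZero 0<K}}) Kl≤p)
            point : ∀ i → i < l → χ D (+ suc i) ≤ χ T (+ suc i) + 𝟙 (i ℕₚ.<? u ∸ suc s)
            point i i<l = go (u ℕₚ.≤? suc i + s)
              where
              go : Dec (u ≤ suc i + s) → χ D (+ suc i) ≤ χ T (+ suc i) + 𝟙 (i ℕₚ.<? u ∸ suc s)
              go (yes le) = ≤-trans (𝟙-mono (dec D (+ suc i)) (dec T (+ suc i)) λ m → i , i<l , le , m , ≈-refl) (m≤m+n _ _)
              go (no ¬le) = ≤-trans (χ≤1 D (+ suc i)) (≤-trans (≤-reflexive (sym (𝟙-true (i ℕₚ.<? u ∸ suc s)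
                (m+n≤o⇒m≤o∸n (suc i) (≤-trans (≤-reflexive (arith″ i s)) (≰⇒> ¬le)))))) (m≤n+m _ (χ T (+ suc i))))
                where
                arith″ : ∀ i s → suc i + suc s ≡ suc (suc i + s)
                arith″ = ℕ-solve

          location : ∀ x → x ∈ T → ∃ λ v → x ≈ + v × u ≤ v + s × v ≤ l
          location x (i , i<l , le , _ , e) = suc i , e , le , i<l

          -- `lam-H` with d ≥ u - s bounds λ of H by s + 2g ≤ s + 2q = 2s.
          popular : ∀ x → x ∈ T → lam (H j) x ≤ 2 * s
          popular x (i , i<l , le , m , e) = ≤-trans (≤-reflexive (lam-resp (H j) e))
            (≤-cancel 1 (+-mono-≤ (+-mono-≤ (lam-H (suc i) i<l m) le) (*-monoʳ-≤ 2 g≤q)) (arith (lam (H j) (+ suc i)) (suc i) u g q))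
            where
            arith : ∀ a i u g q → a + (u + 2 * g + (i + 2 * q) + 2 * q) + 1 ≡ 2 * (2 * q) + (suc (i + a) + u + 2 * g)
            arith = ℕ-solve

          refute : ⊥
          refute = PopularSums.Contradiction.contradiction′ p pr (H j) T u l s I 0<u 0<s 0<I narrow 8Is≤u
            (≤-<-trans 4Iu≤n n<p) card-T location popular 8Is≤h small
            where
            open ℕₚ.≤-Reasoning
            0<s : 0 < s
            0<s = ≤-trans 0<q (m≤n*m q 2)
            arith₁ : ∀ I q → 8 * I * (2 * q) ≡ 16 * I * q
            arith₁ = ℕ-solve
            8Is≤u : 8 * I * s ≤ u
            8Is≤u = ≤-trans (≤-reflexive (arith₁ I q)) 16Iq≤u
            8Is≤h : 8 * I * s ≤ h₀
            8Is≤h = ≤-trans (≤-reflexive (arith₁ I q)) (≤-trans (*-monoˡ-≤ q (≤-trans (*-monoˡ-≤ I (≤-trans (m≤m+n 16 112) (m≤m*n 128 r))) (≤-reflexive (sym E≡)))) Eq≤h)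
            h₀< : h₀ < E * q + E
            h₀< = begin-strict
              h₀                           ≡⟨ ℕDM.m≡m%n+[m/n]*n h₀ E ⟩
              h₀ ℕDM.% E + q * E           <⟨ +-monoˡ-< (q * E) (ℕDM.m%n<n h₀ E) ⟩
              E + q * E                    ≡⟨ trans (+-comm E (q * E)) (cong (_+ E) (*-comm q E)) ⟩
              E * q + E                    ∎
            arith₂ : ∀ E q → 2 * (E * q + E * q) ≡ 2 * E * (2 * q)
            arith₂ = ℕ-solve
            small : 2 * h₀ < I * I * s
            -- As q > 0, h₀ < E(q + 1) ≤ 2Eq = Es.
            small = begin-strict
              2 * h₀                       <⟨ *-monoʳ-< 2 h₀< ⟩
              2 * (E * q + E)              ≤⟨ *-monoʳ-≤ 2 (+-monoʳ-≤ (E * q) (m≤m*n E q {{ℕ.>-nonZero 0<q}})) ⟩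
              2 * (E * q + E * q)          ≡⟨ arith₂ E q ⟩
              2 * E * (2 * q)              ≤⟨ *-monoˡ-≤ s 2E≤I² ⟩
              I * I * s                    ∎

-- Rectification joined to the line argument

module PopularDifferences (p : ℕ) .{{nz : NonZero p}} (pr : Prime p)
  (D : Residues.ZSet p) (0∈D : Residues.Mem D (+ 0)) (neg∈D : ∀ d → Residues.Mem D d → Residues.Mem D (⊖ d))
  (A : Residues.ZSet p) (u I E J k : ℕ) (0<u : 0 < u)
  (496≤I : 496 ≤ I) (E≡ : E ≡ 128 * 496 * I) (2E≤I² : 2 * E ≤ I * I) (J≡ : J ≡ 3976 * I) (9240≤J : 9240 ≤ J)
  (growth : 8 * (496 * u) * E ^ k < (E + 1) ^ k) (8u²<p : 8 * (u * u) < p) where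

  open Balls p pr D 0∈D neg∈D

  module Refute (card-D : 2 * u + 1 ≤ card D) (lamD : ∀ d → d ∈ D → lam A d < u) (2n<p : 2 * card A < p)
    (big : (2 * (496 + J) + 1) * (3 * (496 + J) + 1) * u < card A) (wide : 98 * J * u ≤ card A)
    (large : 48 * (2 * k + 1) * (496 * u) < card A) (4Iu≤n : 4 * I * u ≤ card A) where

    private
      J₀ : ℕ
      J₀ = 496 + J

      n : ℕ
      n = card A

      upper : ∀ j → j ≤ J₀ → card (B j) ≤ (2 * j + 1) * u + 1
      upper j j≤ = Upper.upper A u 0<u (λ d m → <⇒≤ (lamD d m)) 2n<p j (≤-<-trans (*-monoˡ-≤ u (*-mono-≤
        (+-monoˡ-≤ 1 (*-monoʳ-≤ 2 j≤)) (+-monoˡ-≤ 1 (*-monoʳ-≤ 3 j≤)))) big)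

      ball-fits : ∀ j → j ≤ J₀ → j * (2 * u) + 1 ≤ p
      ball-fits j j≤ = ≤-trans (≤-reflexive (+-comm _ 1)) (≤-<-trans (begin
          j * (2 * u)                          ≤⟨ *-monoˡ-≤ (2 * u) j≤ ⟩
          J₀ * (2 * u)                         ≡⟨ arith J₀ u ⟩
          2 * (J₀ * u)                         ≤⟨ *-monoʳ-≤ 2 (≤-trans (*-monoˡ-≤ u J₀≤) (<⇒≤ big)) ⟩
          2 * n                                ∎) 2n<p)
        where
        open ℕₚ.≤-Reasoning
        arith : ∀ J u → J * (2 * u) ≡ 2 * (J * u)
        arith = ℕ-solve
        J₀≤ : J₀ ≤ (2 * J₀ + 1) * (3 * J₀ + 1)
        J₀≤ = ≤-trans (≤-trans (m≤n*m J₀ 2) (m≤m+n (2 * J₀) 1)) (m≤m*n (2 * J₀ + 1) (3 * J₀ + 1) {{ℕ.>-nonZero (m≤n+m 1 (3 * J₀))}})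

      lower : ∀ j → j ≤ J₀ → 2 * j * u + 1 ≤ card (B j)
      lower j j≤ = subst₂ _≤_ (cong (_+ 1) (arith j u)) (trans (cong (λ t → card (pow D t)) (*-identityʳ j)) (sym (card-B j)))
        (pow-growth D 1 (2 * u) (≤-trans card-D (card-mono D (pow D 1) λ x m → B⇒pow 1 (B-one m))) j (ball-fits j j≤))
        where
        arith : ∀ j u → j * (2 * u) ≡ 2 * j * u
        arith = ℕ-solve

      40≤J₀ : 40 ≤ J₀
      40≤J₀ = ≤-trans (m≤m+n 40 456) (m≤m+n 496 J)

      direction : ∃ λ z → z ∈ B 10 × (∀ i → i < 84 → + suc i · z ∉ B (8 * i + 7))
      -- 84 multiples of z are what `coord-distinct` needs; the geodesic then has length 11 · 84 ·
      -- 10 = 9240.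
      direction = Geodesic.Direction.direction p pr D 0∈D neg∈D u J₀ 84 0<u (s≤s z≤n) (≤-trans 9240≤J (m≤n+m J 496)) lower upper

      open Lattice.Basis p pr D 0∈D neg∈D u J₀ 84 0<u ≤-refl 40≤J₀ lower upper
        (proj₁ direction) (proj₁ (proj₂ direction)) (proj₂ (proj₂ direction))

      l : ℕ
      l = ℓ₀

      A′ D′ : ZSet
      A′ = dilate A h
      D′ = dilate D h

      card-A′ : card A′ ≡ n
      card-A′ = card-dilate A h h≉0

      cancel-h : ∀ x y → x · h ≈ y · h → x ≈ y
      cancel-h x y e = ≈-trans (undo x) (≈-trans (≈-* e (≈-refl {h′})) (≈-sym (undo y)))
        where
        h′ : ℤ
        h′ = proj₁ (inverse h h≉0)
        undo : ∀ x → x ≈ x · h · h′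
        undo x = ≈-sym (≈-trans (≡⇒≈ (ℤₚ.*-assoc x h h′)) (≈-trans (≈-* (≈-refl {x}) (proj₂ (inverse h h≉0))) (≡⇒≈ (ℤₚ.*-identityʳ x))))

      -- The radius 496 costs 994 = 2 · 496 + 2 in `ℓ₀-bound`, and 994 is the fraction 1 / 8I of 2J.
      narrow : 8 * I * l ≤ (8 * I + 1) * u
      narrow = *-cancelˡ-≤ 994 (begin
        994 * (8 * I * l)                     ≡⟨ arith₁ I l ⟩
        2 * (3976 * I) * l                    ≡⟨ cong (λ t → 2 * t * l) (sym J≡) ⟩
        2 * J * l                             ≤⟨ ℓ₀-bound J ≤-refl fits ⟩
        (2 * (496 + J) + 1) * u + 1           ≤⟨ +-monoʳ-≤ ((2 * (496 + J) + 1) * u) 0<u ⟩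
        (2 * (496 + J) + 1) * u + u           ≡⟨ cong (λ t → (2 * (496 + t) + 1) * u + u) J≡ ⟩
        (2 * (496 + 3976 * I) + 1) * u + u    ≡⟨ arith₂ I u ⟩
        994 * ((8 * I + 1) * u)               ∎)
        where
        open ℕₚ.≤-Reasoning
        arith₁ : ∀ I l → 994 * (8 * I * l) ≡ 2 * (3976 * I) * l
        arith₁ = ℕ-solve
        arith₂ : ∀ I u → (2 * (496 + 3976 * I) + 1) * u + u ≡ 994 * ((8 * I + 1) * u)
        arith₂ = ℕ-solve
        -- l ≤ 7ℓ ≤ 7 · 14u is the origin of 98 in `wide`.
        fits : 2 * J * l ≤ p
        fits = <⇒≤ (≤-<-trans (begin
          2 * J * l                        ≤⟨ *-monoʳ-≤ (2 * J) (≤-trans ℓ₀≤ (*-monoʳ-≤ 7 (≤-trans ℓ≤ (+-monoʳ-≤ (13 * u) 0<u)))) ⟩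
          2 * J * (7 * (13 * u + u))       ≡⟨ arith J u ⟩
          2 * (98 * J * u)                 ≤⟨ *-monoʳ-≤ 2 wide ⟩
          2 * n                            ∎) 2n<p)
          where
          arith : ∀ J u → 2 * J * (7 * (13 * u + u)) ≡ 2 * (98 * J * u)
          arith = ℕ-solve

      -- The at least 2u + 1 elements of D′ are 0 and pairs of opposite elements ±i with 1 ≤ i ≤ l.
      many : u ≤ ∑ l (λ i → χ D′ (+ suc i))
      many = *-cancelˡ-≤ 2 (+-cancelʳ-≤ 1 (2 * u) (2 * M) (begin
        2 * u + 1                ≤⟨ card-D ⟩
        card D                   ≡⟨ sym (card-dilate D h h≉0) ⟩
        card D′                  ≤⟨ S-mono point ⟩
        S (λ x → 𝟙 (+ 0 ≈? x) + ∑ l (λ i → 𝟙 (+ suc i ≈? x) * m i) + ∑ l (λ i → 𝟙 (-[1+ i ] ≈? x) * m i))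
                                 ≡⟨ trans (∑-+ p _ _) (cong₂ _+_ (trans (∑-+ p _ _) (cong₂ _+_ (δ-total (+ 0)) (side (λ i → + suc i)))) (side -[1+_])) ⟩
        1 + M + M                ≡⟨ arith M ⟩
        2 * M + 1                ∎))
        where
        open ℕₚ.≤-Reasoning
        m : ℕ → ℕ
        m i = χ D′ (+ suc i)
        M : ℕ
        M = ∑ l m
        arith : ∀ M → 1 + M + M ≡ 2 * M + 1
        arith = ℕ-solve
        side : ∀ (c : ℕ → ℤ) → S (λ x → ∑ l (λ i → 𝟙 (c i ≈? x) * m i)) ≡ M
        side c = trans (∑-swap p l (λ x i → 𝟙 (c i ≈? + x) * m i)) (∑-cong l λ i _ →
          trans (∑-*ʳ p (m i) (λ x → 𝟙 (c i ≈? + x))) (trans (cong (_* m i) (δ-total (c i))) (*-identityˡ (m i))))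
        point : ∀ x → χ D′ x ≤ 𝟙 (+ 0 ≈? x) + ∑ l (λ i → 𝟙 (+ suc i ≈? x) * m i) + ∑ l (λ i → 𝟙 (-[1+ i ] ≈? x) * m i)
        point x = go (dec D′ x)
          where
          P₀ P₁ P₂ : ℕ
          P₀ = 𝟙 (+ 0 ≈? x)
          P₁ = ∑ l (λ i → 𝟙 (+ suc i ≈? x) * m i)
          P₂ = ∑ l (λ i → 𝟙 (-[1+ i ] ≈? x) * m i)
          hit : ∀ (c : ℕ → ℤ) i → i < l → c i ≈ x → + suc i ∈ D′ → 1 ≤ ∑ l (λ i → 𝟙 (c i ≈? x) * m i)
          hit c i i<l e m∈ = ≤-trans (≤-reflexive (sym (cong₂ _*_ (𝟙-true (c i ≈? x) e) (𝟙-true (dec D′ (+ suc i)) m∈))))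
            (∑-term l (λ i → 𝟙 (c i ≈? x) * m i) i i<l)
          aux : ∀ i h → ⊖ (⊖ i · h) ≡ i · h
          aux = ℤ-solve
          cases : ∀ q → abs q ≤ l → x ≈ q → x ∈ D′ → 1 ≤ P₀ + P₁ + P₂
          cases (+ zero)    _   e _  = ≤-trans (≤-reflexive (sym (𝟙-true (+ 0 ≈? x) (≈-sym e)))) (≤-trans (m≤m+n P₀ P₁) (m≤m+n (P₀ + P₁) P₂))
          cases (+ (suc i)) i<l e m∈ = ≤-trans (hit (λ i → + suc i) i i<l (≈-sym e) (resp D′ e m∈)) (≤-trans (m≤n+m P₁ P₀) (m≤m+n (P₀ + P₁) P₂))
          cases -[1+ i ]    i<l e m∈ = ≤-trans (hit -[1+_] i i<l (≈-sym e)
            (resp D (≈-trans (≈-neg (≈-* e (≈-refl {h}))) (≡⇒≈ (aux (+ suc i) h))) (neg∈D (x · h) m∈))) (m≤n+m P₂ (P₀ + P₁))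
          located : x ∈ D′ → 1 ≤ P₀ + P₁ + P₂
          located m∈ = finish (short-D (x · h) m∈)
            where
            finish : (∃ λ q → abs q ≤ ℓ₀ × x · h ≈ q · h) → 1 ≤ P₀ + P₁ + P₂
            finish (q , le , e) = cases q le (cancel-h x q e) m∈
          go : (d : Dec (x ∈ D′)) → 𝟙 d ≤ P₀ + P₁ + P₂
          go (no _)  = z≤n
          go (yes m) = located m

      lamI : ∀ x → x ≤ l → lam A′ (+ x) ≤ 496 * u
      lamI x x≤l = ≤-trans (≤-reflexive (lam-dilate A h h≉0 (+ x)))
        (lam-pow A D u (λ d m → <⇒≤ (lamD d m)) 496 (+ x · h) (B⇒pow 496 (interval∈B x (≤-trans x≤l ℓ₀≤))))

    contradiction : ⊥
    contradiction = LineArgument.Refute.contradiction p pr A′ D′ u l 496 I E k 0<u (s≤s z≤n) 496≤I E≡ 2E≤I² narrow growth 8u²<p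
      ℓ₀h∈D many (λ d m → subst (_< u) (sym (lam-dilate A h h≉0 d)) (lamD (d · h) m)) lamI
      (subst (48 * (2 * k + 1) * (496 * u) <_) (sym card-A′) large)
      (subst (4 * I * u ≤_) (sym card-A′) 4Iu≤n) (subst (λ t → 2 * t < p) (sym card-A′) 2n<p)

-- The exponential series

factorial-pos : ∀ k → 0 < factorial k
factorial-pos zero    = s≤s z≤n
factorial-pos (suc k) = *-mono-≤ {1} {suc k} (s≤s z≤n) (factorial-pos k)

-- The binomial coefficient of a + b over a is at most 2^(a + b); the induction is Pascal's rule
-- with denominators cleared.
factorial-+ : ∀ a b → factorial (a + b) ≤ 2 ^ (a + b) * (factorial a * factorial b)
factorial-+ zero    b       = subst (_≤ 2 ^ b * (1 * factorial b)) (*-identityˡ (factorial b))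
  (*-mono-≤ (m^n>0 2 b) (≤-reflexive (sym (*-identityˡ (factorial b)))))
factorial-+ (suc a) zero    = subst (_≤ 2 ^ (suc a + 0) * (factorial (suc a) * 1)) (trans (*-identityˡ _) (cong factorial (sym (+-identityʳ (suc a)))))
  (*-mono-≤ (m^n>0 2 (suc a + 0)) (≤-reflexive (sym (*-identityʳ (factorial (suc a))))))
factorial-+ (suc a) (suc b) = begin
  suc (a + suc b) * factorial (a + suc b)                            ≡⟨ split a (suc b) (factorial (a + suc b)) ⟩
  suc a * factorial (a + suc b) + suc b * factorial (a + suc b)      ≡⟨ cong (λ t → suc a * factorial (a + suc b) + suc b * factorial t) (+-suc a b) ⟩
  suc a * factorial (a + suc b) + suc b * factorial (suc a + b)      ≤⟨ +-mono-≤ (*-monoʳ-≤ (suc a) (factorial-+ a (suc b))) (*-monoʳ-≤ (suc b) (factorial-+ (suc a) b)) ⟩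
  suc a * (2 ^ (a + suc b) * (factorial a * factorial (suc b))) + suc b * (2 ^ (suc a + b) * (factorial (suc a) * factorial b))
    ≡⟨ cong (λ t → suc a * (2 ^ (a + suc b) * (factorial a * factorial (suc b))) + suc b * (2 ^ t * (factorial (suc a) * factorial b))) (sym (+-suc a b)) ⟩
  suc a * (2 ^ (a + suc b) * (factorial a * factorial (suc b))) + suc b * (2 ^ (a + suc b) * (factorial (suc a) * factorial b))
    ≡⟨ merge a b (2 ^ (a + suc b)) (factorial a) (factorial b) ⟩
  2 * 2 ^ (a + suc b) * (factorial (suc a) * factorial (suc b))      ∎
  where
  open ℕₚ.≤-Reasoning
  split : ∀ a b f → suc (a + b) * f ≡ suc a * f + b * f
  split = ℕ-solve
  merge : ∀ a b w f g → suc a * (w * (f * (suc b * g))) + suc b * (w * (suc a * f * g)) ≡ 2 * w * (suc a * f * (suc b * g))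
  merge = ℕ-solve

power-factorial : ∀ n j → n ^ j * factorial n ≤ factorial (n + j)
power-factorial n zero    = ≤-reflexive (trans (*-identityˡ _) (cong factorial (sym (+-identityʳ n))))
power-factorial n (suc j) = subst (λ t → n ^ suc j * factorial n ≤ factorial t) (sym (+-suc n j)) (begin
  n * n ^ j * factorial n           ≡⟨ *-assoc n (n ^ j) (factorial n) ⟩
  n * (n ^ j * factorial n)         ≤⟨ *-mono-≤ (m≤n⇒m≤1+n (m≤m+n n j)) (power-factorial n j) ⟩
  suc (n + j) * factorial (n + j)   ∎)
  where open ℕₚ.≤-Reasoning

power≤ : ∀ n j → n ^ j ≤ 2 ^ (n + j) * factorial j
power≤ n j = *-cancelʳ-≤ (n ^ j) _ (factorial n) {{ℕ.>-nonZero (factorial-pos n)}} (≤-trans (power-factorial n j)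
  (≤-trans (factorial-+ n j) (≤-reflexive (arith (2 ^ (n + j)) (factorial n) (factorial j)))))
  where
  arith : ∀ w f g → w * (f * g) ≡ w * g * f
  arith = ℕ-solve

-- Up to k = 2n every term n^j / j! is at most 8^n; beyond that the terms at least halve.
module ExpBound (n : ℕ) (0<n : 0 < n) where

  private
    term≤ : ∀ j → j ≤ 2 * n → n ^ j ≤ 2 ^ (3 * n) * factorial j
    term≤ j j≤ = ≤-trans (power≤ n j) (*-monoˡ-≤ (factorial j) (^-monoʳ-≤ 2 (≤-trans (+-monoʳ-≤ n j≤) (≤-reflexive (arith n)))))
      where
      arith : ∀ n → n + 2 * n ≡ 3 * n
      arith = ℕ-solve

    early : ∀ k → k ≤ 2 * n → expNum n k ≤ (k + 1) * 2 ^ (3 * n) * factorial k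
    early zero    _  = subst (1 ≤_) (sym (trans (*-identityʳ _) (*-identityˡ _))) (m^n>0 2 (3 * n))
    early (suc k) le = begin
      suc k * expNum n k + n ^ suc k                                             ≤⟨ +-mono-≤ (*-monoʳ-≤ (suc k) (early k (≤-trans (n≤1+n k) le))) (term≤ (suc k) le) ⟩
      suc k * ((k + 1) * 2 ^ (3 * n) * factorial k) + 2 ^ (3 * n) * (suc k * factorial k) ≡⟨ arith k (2 ^ (3 * n)) (factorial k) ⟩
      (suc k + 1) * 2 ^ (3 * n) * (suc k * factorial k)                          ∎
      where
      open ℕₚ.≤-Reasoning
      arith : ∀ k w f → suc k * ((k + 1) * w * f) + w * (suc k * f) ≡ (suc k + 1) * w * (suc k * f)
      arith = ℕ-solve

    linear≤ : ∀ n → 0 < n → 2 * n + 2 ≤ 2 ^ (2 * n)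
    linear≤ (suc zero)    _ = ≤-refl
    linear≤ (suc (suc n)) _ = begin
      2 * suc (suc n) + 2            ≡⟨ arith₁ n ⟩
      2 * suc n + 2 + 2              ≤⟨ +-mono-≤ (linear≤ (suc n) (s≤s z≤n)) (≤-trans (m≤n+m 2 (2 * suc n)) (linear≤ (suc n) (s≤s z≤n))) ⟩
      2 ^ (2 * suc n) + 2 ^ (2 * suc n) ≤⟨ ≤-cancel {a = 0} (2 * 2 ^ (2 * suc n)) z≤n (arith₂ (2 ^ (2 * suc n))) ⟩
      2 * (2 * 2 ^ (2 * suc n))      ≡⟨ cong (2 ^_) (arith₃ n) ⟩
      2 ^ (2 * suc (suc n))          ∎
      where
      open ℕₚ.≤-Reasoning
      arith₁ : ∀ n → 2 * suc (suc n) + 2 ≡ 2 * suc n + 2 + 2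
      arith₁ = ℕ-solve
      arith₂ : ∀ w → w + w + 0 + 2 * w ≡ 2 * (2 * w) + 0
      arith₂ = ℕ-solve
      arith₃ : ∀ n → suc (suc (2 * suc n)) ≡ 2 * suc (suc n)
      arith₃ = ℕ-solve

    potential-early : ∀ k → k ≤ 2 * n → expNum n k + n ^ k ≤ 2 ^ (5 * n) * factorial k
    potential-early k le = begin
      expNum n k + n ^ k                                                        ≤⟨ +-mono-≤ (early k le) (term≤ k le) ⟩
      (k + 1) * 2 ^ (3 * n) * factorial k + 2 ^ (3 * n) * factorial k           ≡⟨ arith₁ k (2 ^ (3 * n)) (factorial k) ⟩
      (k + 2) * 2 ^ (3 * n) * factorial k                                       ≤⟨ *-monoˡ-≤ (factorial k) (*-monoˡ-≤ (2 ^ (3 * n)) (≤-trans (+-monoˡ-≤ 2 le) (linear≤ n 0<n))) ⟩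
      2 ^ (2 * n) * 2 ^ (3 * n) * factorial k                                   ≡⟨ cong (_* factorial k) (trans (sym (^-distribˡ-+-* 2 (2 * n) (3 * n))) (cong (2 ^_) (arith₂ n))) ⟩
      2 ^ (5 * n) * factorial k                                                 ∎
      where
      open ℕₚ.≤-Reasoning
      arith₁ : ∀ k w f → (k + 1) * w * f + w * f ≡ (k + 2) * w * f
      arith₁ = ℕ-solve
      arith₂ : ∀ n → 2 * n + 3 * n ≡ 5 * n
      arith₂ = ℕ-solve

    -- The added n^k makes the bound inductive: beyond 2n a term is at least twice the next one, so
    -- counting the last term twice pays for the next term counted twice.
    potential : ∀ k → expNum n k + n ^ k ≤ 2 ^ (5 * n) * factorial k
    potential zero    = potential-early 0 z≤n
    potential (suc k) = decide (suc k ℕₚ.≤? 2 * n)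
      where
      open ℕₚ.≤-Reasoning
      arith₁ : ∀ k e n w → suc k * e + n * w + n * w ≡ suc k * e + 2 * n * w
      arith₁ = ℕ-solve
      arith₂ : ∀ k w f → suc k * (w * f) ≡ w * (suc k * f)
      arith₂ = ℕ-solve
      decide : Dec (suc k ≤ 2 * n) → expNum n (suc k) + n ^ suc k ≤ 2 ^ (5 * n) * factorial (suc k)
      decide (yes le) = potential-early (suc k) le
      decide (no ¬le) = begin
        suc k * expNum n k + n * n ^ k + n * n ^ k      ≡⟨ arith₁ k (expNum n k) n (n ^ k) ⟩
        suc k * expNum n k + 2 * n * n ^ k              ≤⟨ +-monoʳ-≤ (suc k * expNum n k) (*-monoˡ-≤ (n ^ k) (<⇒≤ (≰⇒> ¬le))) ⟩
        suc k * expNum n k + suc k * n ^ k              ≡⟨ sym (*-distribˡ-+ (suc k) (expNum n k) (n ^ k)) ⟩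
        suc k * (expNum n k + n ^ k)                    ≤⟨ *-monoʳ-≤ (suc k) (potential k) ⟩
        suc k * (2 ^ (5 * n) * factorial k)             ≡⟨ arith₂ k (2 ^ (5 * n)) (factorial k) ⟩
        2 ^ (5 * n) * (suc k * factorial k)             ∎

  <exp⇒<2^5n : ∀ N → N <exp n → N < 2 ^ (5 * n)
  <exp⇒<2^5n N (k , lt) = *-cancelʳ-< (factorial k) N _ (<-≤-trans lt (≤-trans (m≤m+n (expNum n k) (n ^ k)) (potential k)))

-- Logarithms and geometric growth over ℕ

n<2^n : ∀ n → n < 2 ^ n
n<2^n zero    = s≤s z≤n
n<2^n (suc n) = ≤-trans (+-mono-≤ (m^n>0 2 n) (n<2^n n)) (≤-reflexive (cong (_+_ (2 ^ n)) (sym (+-identityʳ (2 ^ n)))))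

-- a is the floor of log₂ n; as a > 0, a + 1 ≤ 2a, and both bounds use multiples of a.
log₂-bounds : ∀ n → 1 < n → ∃ λ a → 0 < a × 2 ^ a ≤ n × n < 2 ^ (2 * a)
log₂-bounds n 1<n = go (largest (λ a → 2 ^ a ℕₚ.≤? n) (<⇒≤ 1<n) n)
  where
  go : (∃ λ a → a ≤ n × 2 ^ a ≤ n × (∀ k → k ≤ n → 2 ^ k ≤ n → k ≤ a)) → ∃ λ a → 0 < a × 2 ^ a ≤ n × n < 2 ^ (2 * a)
  go (a , a≤n , 2^a≤n , max) = a , 0<a , 2^a≤n , <-≤-trans
      (≰⇒> λ le → <⇒≱ (n<1+n a) (max (suc a) (≤-trans (<⇒≤ (n<2^n (suc a))) le) le))
      (^-monoʳ-≤ 2 (≤-trans (+-monoˡ-≤ a 0<a) (≤-reflexive (cong (_+_ a) (sym (+-identityʳ a))))))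
    where
    0<a : 0 < a
    0<a = max 1 (<⇒≤ 1<n) 1<n

-- 2^a ≤ n and n^(5Cm) < 2^(5n) give 5Cam < 5n. From here on a replaces ln n.
log-bound : ∀ C n m → 1 < n → (n ^ (5 * C * m)) <exp n → ∃ λ a → 0 < a × n < 2 ^ (2 * a) × C * a * m < n
log-bound C n m 1<n h = go (log₂-bounds n 1<n)
  where
  go : (∃ λ a → 0 < a × 2 ^ a ≤ n × n < 2 ^ (2 * a)) → ∃ λ a → 0 < a × n < 2 ^ (2 * a) × C * a * m < n
  go (a , 0<a , 2^a≤n , n<) = a , 0<a , n< , *-cancelˡ-< 5 (C * a * m) n (≰⇒> λ 5n≤ → <⇒≱ (ExpBound.<exp⇒<2^5n n (<⇒≤ 1<n) _ h) (begin
      2 ^ (5 * n)                  ≤⟨ ^-monoʳ-≤ 2 5n≤ ⟩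
      2 ^ (5 * (C * a * m))        ≡⟨ cong (2 ^_) (arith C a m) ⟩
      2 ^ (a * (5 * C * m))        ≡⟨ sym (^-*-assoc 2 a (5 * C * m)) ⟩
      (2 ^ a) ^ (5 * C * m)        ≤⟨ ^-monoˡ-≤ (5 * C * m) 2^a≤n ⟩
      n ^ (5 * C * m)              ∎))
    where
    open ℕₚ.≤-Reasoning
    arith : ∀ C a m → 5 * (C * a * m) ≡ a * (5 * C * m)
    arith = ℕ-solve

-- Bernoulli's inequality (1 + 1 / E)^j ≥ 1 + j / E with denominators cleared.
bernoulli : ∀ E j → E ^ j * (E + j) ≤ (E + 1) ^ j * E
bernoulli E zero    = ≤-reflexive (cong (1 *_) (+-identityʳ E))
bernoulli E (suc j) = begin
  E * E ^ j * (E + suc j)             ≤⟨ ≤-cancel {a = 0} (E ^ j * j) z≤n (arith₁ E j (E ^ j)) ⟩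
  (E + 1) * (E ^ j * (E + j))         ≤⟨ *-monoʳ-≤ (E + 1) (bernoulli E j) ⟩
  (E + 1) * ((E + 1) ^ j * E)         ≡⟨ sym (*-assoc (E + 1) ((E + 1) ^ j) E) ⟩
  (E + 1) * (E + 1) ^ j * E           ∎
  where
  open ℕₚ.≤-Reasoning
  arith₁ : ∀ E j w → E * w * (E + suc j) + 0 + w * j ≡ (E + 1) * (w * (E + j)) + 0
  arith₁ = ℕ-solve

^-distribʳ-* : ∀ x a b → (a * b) ^ x ≡ a ^ x * b ^ x
^-distribʳ-* zero    a b = refl
^-distribʳ-* (suc x) a b = trans (cong (a * b *_) (^-distribʳ-* x a b)) (arith a b (a ^ x) (b ^ x))
  where
  arith : ∀ a b c d → a * b * (c * d) ≡ a * c * (b * d)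
  arith = ℕ-solve

-- Bernoulli at j = E gives (1 + 1 / E)^E ≥ 2, which is raised to the power x.
doubling : ∀ E → 0 < E → ∀ x → 2 ^ x * E ^ (E * x) ≤ (E + 1) ^ (E * x)
doubling E 0<E x = begin
  2 ^ x * E ^ (E * x)            ≡⟨ cong (_*_ (2 ^ x)) (sym (^-*-assoc E E x)) ⟩
  2 ^ x * (E ^ E) ^ x            ≡⟨ sym (^-distribʳ-* x 2 (E ^ E)) ⟩
  (2 * E ^ E) ^ x                ≤⟨ ^-monoˡ-≤ x once ⟩
  ((E + 1) ^ E) ^ x              ≡⟨ ^-*-assoc (E + 1) E x ⟩
  (E + 1) ^ (E * x)              ∎
  where
  open ℕₚ.≤-Reasoning
  arith : ∀ w E → 2 * w * E ≡ w * (E + E)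
  arith = ℕ-solve
  once : 2 * E ^ E ≤ (E + 1) ^ E
  once = *-cancelʳ-≤ _ _ E {{ℕ.>-nonZero 0<E}} (≤-trans (≤-reflexive (arith (E ^ E) E)) (bernoulli E E))

-- Restricted sumsets

∑-∣∣ : ∀ {n} (X : Subset n) (f : ℕ → ℕ) → (∀ i → f (toℕ i) ≡ 𝟙 (i ∈ˢ? X)) → ∑ n f ≡ ∣ X ∣
∑-∣∣ []      f h = refl
∑-∣∣ {suc n} (b ∷ X) f h = trans (∑-split 1 n f) (trans (cong (_+ ∑ n (λ i → f (suc i))) (trans (+-identityʳ (f 0)) (h fzero)))
  (trans (cong (_+_ (𝟙 (fzero ∈ˢ? (b ∷ X)))) (∑-∣∣ X (λ i → f (suc i)) λ i → trans (h (fsuc i)) (𝟙-cong (fsuc i ∈ˢ? (b ∷ X)) (i ∈ˢ? X) drop-there there))) (head b)))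
  where
  head : ∀ b → 𝟙 (fzero ∈ˢ? (b ∷ X)) + ∣ X ∣ ≡ ∣ b ∷ X ∣
  head true  = refl
  head false = refl

module Reduction (p : ℕ) .{{nz : NonZero p}} (pr : Prime p) (A B : Subset p) (τ : Fin p → Fin p) where

  open PrimeResidues p pr

  private
    residue : ℤ → Fin p
    residue x = fromℕ< (ρ<p x)

    residue-resp : ∀ {x y} → x ≈ y → residue x ≡ residue y
    residue-resp {x} {y} e = Finₚ.fromℕ<-cong (ρ x) (ρ y)
      (≈-unique (ρ<p x) (ρ<p y) (≈-trans (≈-sym (≈ρ x)) (≈-trans e (≈ρ y)))) (ρ<p x) (ρ<p y)

    residue≈ : ∀ x → x ≈ + toℕ (residue x)
    residue≈ x = ≈-trans (≈ρ x) (≡⇒≈ (cong +_ (sym (Finₚ.toℕ-fromℕ< (ρ<p x)))))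

    residue-toℕ : ∀ i → residue (+ toℕ i) ≡ i
    residue-toℕ i = Finₚ.toℕ-injective (≈-unique (Finₚ.toℕ<n _) (Finₚ.toℕ<n i) (≈-sym (residue≈ (+ toℕ i))))

    lift : Subset p → ZSet
    lift X = zset (λ x → residue x ∈ˢ X) (λ x → residue x ∈ˢ? X) (λ e → subst (_∈ˢ X) (residue-resp e))

    card-lift : ∀ X → card (lift X) ≡ ∣ X ∣
    card-lift X = ∑-∣∣ X (λ i → χ (lift X) (+ i)) λ i → 𝟙-cong (residue (+ toℕ i) ∈ˢ? X) (i ∈ˢ? X)
      (subst (_∈ˢ X) (residue-toℕ i)) (subst (_∈ˢ X) (sym (residue-toℕ i)))

    A′ B′ Z : ZSet
    A′ = lift A
    B′ = lift B
    Z  = lift (restrictedSumset A B τ)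

    sum∈ : ∀ a b → a ∈ˢ A → b ∈ˢ B → a ≢ τ b → (a ⊕ b) ∈ˢ restrictedSumset A B τ
    sum∈ a b aA bB a≢ = Vecₚ.lookup⇒[]= (a ⊕ b) (restrictedSumset A B τ)
      (trans (Vecₚ.lookup∘tabulate _ (a ⊕ b)) (dec-true (Finₚ.any? _) (a , b , aA , bB , a≢ , refl)))

    residue-⊕ : ∀ x v → residue (x ⊝ v) ⊕ residue v ≡ residue x
    residue-⊕ x v = Finₚ.toℕ-injective (≈-unique (Finₚ.toℕ<n (residue (x ⊝ v) ⊕ residue v)) (Finₚ.toℕ<n (residue x)) (≈-trans (≡⇒≈ (cong +_ (Finₚ.toℕ-fromℕ< (ℕDM.m%n<n m p))))
        (≈-trans (≈-sym (mod≈ (+ (m ℕDM./ p)) (trans (cong +_ (ℕDM.m≡m%n+[m/n]*n m p)) (trans (ℤₚ.pos-+ (m ℕDM.% p) _) (cong (_⊹_ (+ (m ℕDM.% p))) (ℤₚ.pos-* (m ℕDM./ p) p))))))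
          (≈-trans (≡⇒≈ (ℤₚ.pos-+ (toℕ (residue (x ⊝ v))) (toℕ (residue v)))) (≈-trans (≈-+ (≈-sym (residue≈ (x ⊝ v))) (≈-sym (residue≈ v))) (≈-trans (≡⇒≈ (aux x v)) (residue≈ x)))))))
      where
      m : ℕ
      m = toℕ (residue (x ⊝ v)) + toℕ (residue v)
      aux : ∀ x v → x ⊝ v ⊹ v ≡ x
      aux = ℤ-solve

    -- The only sum that τ can remove from the translate A + v.
    exception : ℤ → ℤ
    exception v = + toℕ (τ (residue v)) ⊹ v

    translate⊆ : ∀ v → v ∈ B′ → ∀ x → x ⊝ v ∈ A′ → x ∈ Z ⊎ exception v ≈ x
    translate⊆ v vB x m = go (residue (x ⊝ v) Finₚ.≟ τ (residue v))
      where
      aux : ∀ x v → x ⊝ v ⊹ v ≡ x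
      aux = ℤ-solve
      go : Dec (residue (x ⊝ v) ≡ τ (residue v)) → x ∈ Z ⊎ exception v ≈ x
      go (no a≢) = inj₁ (subst (_∈ˢ restrictedSumset A B τ) (residue-⊕ x v) (sum∈ _ _ m vB a≢))
      go (yes e) = inj₂ (≈-trans (≈-+ʳ v (≈-trans (≡⇒≈ (cong (λ t → + toℕ t) (sym e))) (≈-sym (residue≈ (x ⊝ v))))) (≡⇒≈ (aux x v)))

    counted : ∀ x v → x ∈ Z ⊎ exception v ≈ x → 1 ≤ χ Z x + 𝟙 (exception v ≈? x)
    counted x v (inj₁ m) = ≤-trans (≤-reflexive (sym (𝟙-true (dec Z x) m))) (m≤m+n _ _)
    counted x v (inj₂ e) = ≤-trans (≤-reflexive (sym (𝟙-true (exception v ≈? x) e))) (m≤n+m _ (χ Z x))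

    one-translate : ∀ v → v ∈ B′ → card A′ ≤ card Z + 1
    one-translate v vB = begin
      card A′                                        ≡⟨ sym (S-shift (χ-per A′) (⊖ v)) ⟩
      S (λ x → χ A′ (x ⊝ v))                         ≤⟨ S-mono (λ x → point x (dec A′ (x ⊝ v))) ⟩
      S (λ x → χ Z x + 𝟙 (exception v ≈? x))         ≡⟨ trans (∑-+ p _ _) (cong (_+_ (card Z)) (δ-total (exception v))) ⟩
      card Z + 1                                     ∎
      where
      open ℕₚ.≤-Reasoning
      point : ∀ x (d : Dec (x ⊝ v ∈ A′)) → 𝟙 d ≤ χ Z x + 𝟙 (exception v ≈? x)
      point x (no _)  = z≤n
      point x (yes m) = counted x v (translate⊆ v vB x m)

    -- A + v and the part of A + w outside it are disjoint, the latter has λ(w - v) elements, and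
    -- each translate loses at most one sum to τ.
    two-translates : ∀ v w → v ∈ B′ → w ∈ B′ → card A′ + lam A′ (w ⊝ v) ≤ card Z + 2
    two-translates v w vB wB = begin
      card A′ + lam A′ (w ⊝ v)
        ≡⟨ sym (cong₂ _+_ (S-shift (χ-per A′) (⊖ v)) (S-shift (χ-per (leaving A′ (w ⊝ v))) (⊖ w))) ⟩
      S (λ x → χ A′ (x ⊝ v)) + S (λ x → χ (leaving A′ (w ⊝ v)) (x ⊝ w))
        ≡⟨ sym (∑-+ p _ _) ⟩
      S (λ x → χ A′ (x ⊝ v) + χ (leaving A′ (w ⊝ v)) (x ⊝ w))
        ≤⟨ S-mono (λ x → point x (dec A′ (x ⊝ v)) (dec (leaving A′ (w ⊝ v)) (x ⊝ w))) ⟩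
      S (λ x → χ Z x + 𝟙 (exception v ≈? x) + 𝟙 (exception w ≈? x))
        ≡⟨ trans (∑-+ p _ _) (cong₂ _+_ (trans (∑-+ p _ _) (cong (_+_ (card Z)) (δ-total (exception v)))) (δ-total (exception w))) ⟩
      card Z + 1 + 1
        ≡⟨ +-assoc (card Z) 1 1 ⟩
      card Z + 2 ∎
      where
      open ℕₚ.≤-Reasoning
      aux : ∀ x v w → x ⊝ v ≡ x ⊝ w ⊹ (w ⊝ v)
      aux = ℤ-solve
      swap : ∀ a b c → a + c + b ≡ a + b + c
      swap = ℕ-solve
      point : ∀ x (d : Dec (x ⊝ v ∈ A′)) (e : Dec (x ⊝ w ∈ leaving A′ (w ⊝ v))) →
        𝟙 d + 𝟙 e ≤ χ Z x + 𝟙 (exception v ≈? x) + 𝟙 (exception w ≈? x)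
      point x (yes m) (yes (_ , ∉)) = ⊥-elim (∉ (resp A′ (≡⇒≈ (aux x v w)) m))
      point x (yes m) (no _)        = ≤-trans (counted x v (translate⊆ v vB x m)) (m≤m+n _ _)
      point x (no _)  (yes (m , _)) = ≤-trans (counted x w (translate⊆ w wB x m)) (≤-trans (m≤m+n _ (𝟙 (exception v ≈? x)))
        (≤-reflexive (swap (χ Z x) (𝟙 (exception v ≈? x)) (𝟙 (exception w ≈? x)))))
      point x (no _)  (no _)        = z≤n

    −B D : ZSet
    −B = zset (λ y → + 0 ⊝ y ∈ B′) (λ y → dec B′ (+ 0 ⊝ y)) (λ e → resp B′ (≈-−ˡ (+ 0) e))
    D  = B′ ⊞ −B

    card-−B : card −B ≡ card B′
    card-−B = S-reflect (χ-per B′) (+ 0)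

    0∈D : ∀ b → b ∈ B′ → + 0 ∈ D
    0∈D b m = ⊖ b , resp B′ (≡⇒≈ (aux b)) m , resp B′ (≡⇒≈ (aux b)) m
      where
      aux : ∀ b → b ≡ + 0 ⊝ ⊖ b
      aux = ℤ-solve

    neg∈D : ∀ d → d ∈ D → ⊖ d ∈ D
    neg∈D d (y , a , b) = y ⊝ d , resp B′ (≡⇒≈ (aux₁ d y)) b , resp B′ (≡⇒≈ (aux₂ d y)) a
      where
      aux₁ : ∀ d y → d ⊝ y ≡ + 0 ⊝ (y ⊝ d)
      aux₁ = ℤ-solve
      aux₂ : ∀ d y → + 0 ⊝ y ≡ ⊖ d ⊝ (y ⊝ d)
      aux₂ = ℤ-solve

    lam-D : ∀ d → d ∈ D → card A′ + lam A′ d ≤ card Z + 2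
    lam-D d (y , a , b) = subst (λ t → card A′ + lam A′ t ≤ card Z + 2) (aux d y) (two-translates (+ 0 ⊝ y) (d ⊝ y) a b)
      where
      aux : ∀ d y → d ⊝ y ⊝ (+ 0 ⊝ y) ≡ d
      aux = ℤ-solve

    card-D : ∀ u → ∣ B ∣ ≡ suc u → 8 * (∣ B ∣ * ∣ B ∣) < p → 2 * u + 1 ≤ card D
    card-D u m≡ 8m²<p = conclude (cauchy-davenport B′ −B 0<B (≤-trans 0<B (≤-reflexive (sym card-−B))))
      where
      card-B′ : card B′ ≡ suc u
      card-B′ = trans (card-lift B) m≡
      0<B : 0 < card B′
      0<B = subst (0 <_) (sym card-B′) (s≤s z≤n)
      arith : ∀ u d → 2 * u + 1 + (d + 1) + 0 ≡ d + (suc u + suc u)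
      arith = ℕ-solve
      arith′ : ∀ u → 2 * u + 1 + (8 * (u * u) + 14 * u + 7) ≡ 8 * (suc u * suc u)
      arith′ = ℕ-solve
      conclude : card B′ + card −B ≤ card D + 1 ⊎ p ≤ card D → 2 * u + 1 ≤ card D
      conclude (inj₁ le) = ≤-cancel 0 (subst (_≤ card D + 1) (cong₂ _+_ card-B′ (trans card-−B card-B′)) le) (arith u (card D))
      -- If D is everything, 2u + 1 ≤ 8|B|² < p is enough.
      conclude (inj₂ le) = ≤-trans (≤-trans (m≤m+n (2 * u + 1) (8 * (u * u) + 14 * u + 7)) (≤-reflexive (arith′ u)))
        (≤-trans (≤-trans (≤-reflexive (cong (λ t → 8 * (t * t)) (sym m≡))) (<⇒≤ 8m²<p)) le)

    n≡ : card A′ ≡ ∣ A ∣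
    n≡ = card-lift A

  -- One translate of A, less one exception, already suffices here; the main argument may then
  -- assume u > 0.
  small-B : ∣ B ∣ ≤ 2 → 0 < ∣ B ∣ → ∣ A ∣ + ∣ B ∣ ≤ ∣ restrictedSumset A B τ ∣ + 3
  small-B m≤2 0<m = ≤-trans (+-mono-≤ (subst₂ (λ a z → a ≤ z + 1) n≡ (card-lift (restrictedSumset A B τ))
      (one-translate (proj₁ b) (proj₂ b))) m≤2) (≤-reflexive (+-assoc ∣ restrictedSumset A B τ ∣ 1 2))
    where
    b : ∃ λ x → x ∈ B′
    b = card-witness B′ (subst (0 <_) (sym (card-lift B)) 0<m)

  module Large (I E J k u : ℕ) (m≡ : ∣ B ∣ ≡ suc u) (0<u : 0 < u)
    (496≤I : 496 ≤ I) (E≡ : E ≡ 128 * 496 * I) (2E≤I² : 2 * E ≤ I * I) (J≡ : J ≡ 3976 * I) (9240≤J : 9240 ≤ J)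
    (growth : 8 * (496 * u) * E ^ k < (E + 1) ^ k) (8m²<p : 8 * (∣ B ∣ * ∣ B ∣) < p) (2n<p : 2 * ∣ A ∣ < p)
    (big : (2 * (496 + J) + 1) * (3 * (496 + J) + 1) * u < ∣ A ∣) (wide : 98 * J * u ≤ ∣ A ∣)
    (large : 48 * (2 * k + 1) * (496 * u) < ∣ A ∣) (4Iu≤n : 4 * I * u ≤ ∣ A ∣) where

    private
      b : ∃ λ x → x ∈ B′
      b = card-witness B′ (subst (0 <_) (sym (trans (card-lift B) m≡)) (s≤s z≤n))

      8u²<p : 8 * (u * u) < p
      8u²<p = ≤-<-trans (*-monoʳ-≤ 8 (*-mono-≤ u≤m u≤m)) 8m²<p
        where
        u≤m : u ≤ ∣ B ∣
        u≤m = ≤-trans (n≤1+n u) (≤-reflexive (sym m≡))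

    conclusion : ∣ A ∣ + ∣ B ∣ ≤ ∣ restrictedSumset A B τ ∣ + 3
    conclusion = ≮⇒≥ λ lt → PopularDifferences.Refute.contradiction p pr D (0∈D (proj₁ b) (proj₂ b)) neg∈D A′ u I E J k
      0<u 496≤I E≡ 2E≤I² J≡ 9240≤J growth 8u²<p
      (card-D u m≡ 8m²<p) (λ d m → lam<u lt d m) (subst (λ t → 2 * t < p) (sym n≡) 2n<p) (subst (_ <_) (sym n≡) big) (subst (_ ≤_) (sym n≡) wide)
      (subst (_ <_) (sym n≡) large) (subst (_ ≤_) (sym n≡) 4Iu≤n)
      where
      lam<u : ∣ restrictedSumset A B τ ∣ + 3 < ∣ A ∣ + ∣ B ∣ → ∀ d → d ∈ D → lam A′ d < u
      -- The 3 of the theorem is 1 from |B| = u + 1 and 2 from the two exceptions.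
      lam<u lt d m = ≤-cancel 0 (+-mono-≤ (subst₂ (λ a z → a + lam A′ d ≤ z + 2) n≡ (card-lift (restrictedSumset A B τ)) (lam-D d m))
          (subst (λ t → ∣ restrictedSumset A B τ ∣ + 3 < ∣ A ∣ + t) m≡ lt)) (arith (lam A′ d) ∣ restrictedSumset A B τ ∣ ∣ A ∣ u)
        where
        arith : ∀ l z a u → suc l + (z + 2 + (a + suc u)) + 0 ≡ u + (a + l + suc (z + 3))
        arith = ℕ-solve

-- Choice of the constants

private
  part₁ : ∀ a b c d → a ≤ a + b + c + d
  part₁ a b c d = ≤-trans (m≤m+n a b) (≤-trans (m≤m+n (a + b) c) (m≤m+n (a + b + c) d))

  part₂ : ∀ a b c d → b ≤ a + b + c + d
  part₂ a b c d = ≤-trans (m≤n+m b a) (≤-trans (m≤m+n (a + b) c) (m≤m+n (a + b + c) d))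

  part₃ : ∀ a b c d → c ≤ a + b + c + d
  part₃ a b c d = ≤-trans (m≤n+m c (a + b)) (m≤m+n (a + b + c) d)

  part₄ : ∀ a b c d → d ≤ a + b + c + d
  part₄ a b c d = m≤n+m d (a + b + c)

-- 496 = 6 + 49 · 10 is the radius of the ball of interval∈B, and 3976 = 4 · 994 makes ℓ₀-bound yield
-- 8 I ℓ₀ ≤ (8 I + 1) u. The values are abstract so that they are never computed.
abstract
  I E J c₁ C : ℕ
  I  = 257 * 496
  E  = 128 * 496 * I
  J  = 3976 * I
  c₁ = (2 * (496 + J) + 1) * (3 * (496 + J) + 1)
  C  = c₁ + 98 * J + 48 * 29 * 496 * E + 4 * I

  496≤I : 496 ≤ I
  496≤I = m≤n*m 496 257

  E≡ : E ≡ 128 * 496 * I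
  E≡ = refl

  J≡ : J ≡ 3976 * I
  J≡ = refl

  c₁≡ : c₁ ≡ (2 * (496 + J) + 1) * (3 * (496 + J) + 1)
  c₁≡ = refl

  c₁≤C : c₁ ≤ C
  c₁≤C = part₁ c₁ (98 * J) (48 * 29 * 496 * E) (4 * I)

  98J≤C : 98 * J ≤ C
  98J≤C = part₂ c₁ (98 * J) (48 * 29 * 496 * E) (4 * I)

  steps≤C : 48 * 29 * 496 * E ≤ C
  steps≤C = part₃ c₁ (98 * J) (48 * 29 * 496 * E) (4 * I)

  4I≤C : 4 * I ≤ C
  4I≤C = part₄ c₁ (98 * J) (48 * 29 * 496 * E) (4 * I)

  -- After division by I this is 256 · 496 ≤ I, which I = 257 · 496 satisfies.
  2E≤I² : 2 * E ≤ I * I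
  2E≤I² = ≤-trans (≤-reflexive (arith 496 I)) (*-monoˡ-≤ I (*-monoˡ-≤ 496 (n≤1+n 256)))
    where
    arith : ∀ r I → 2 * (128 * r * I) ≡ 256 * r * I
    arith = ℕ-solve

  9240≤J : 9240 ≤ J
  9240≤J = ≤-trans (m≤m+n 9240 2688) (*-monoʳ-≤ 3976 (≤-trans (m≤m+n 3 493) 496≤I))

0<I : 0 < I
0<I = ≤-trans (s≤s z≤n) 496≤I

0<E : 0 < E
0<E = subst (0 <_) (sym E≡) (≤-trans 0<I (m≤n*m I (128 * 496)))

0<C : 0 < C
0<C = ≤-trans (≤-trans 0<I (m≤n*m I 4)) 4I≤C

module Thresholds (a u m n : ℕ) (0<a : 0 < a) (u≤m : u ≤ m) (Cam<n : C * a * m < n) where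

  private
    bound : ∀ c → c ≤ C → c * a * u < n
    bound c c≤ = ≤-<-trans (*-mono-≤ (*-monoˡ-≤ a c≤) u≤m) Cam<n

    bound′ : ∀ c → c ≤ C → c * u < n
    bound′ c c≤ = ≤-<-trans (*-monoˡ-≤ u (m≤m*n c a {{ℕ.>-nonZero 0<a}})) (bound c c≤)

  big : (2 * (496 + J) + 1) * (3 * (496 + J) + 1) * u < n
  big = subst (λ c → c * u < n) c₁≡ (bound′ c₁ c₁≤C)

  wide : 98 * J * u ≤ n
  wide = <⇒≤ (bound′ (98 * J) 98J≤C)

  4Iu≤n : 4 * I * u ≤ n
  4Iu≤n = <⇒≤ (bound′ (4 * I) 4I≤C)

  -- For k = E(2a + 12), 2k + 1 ≤ 2E(2a + 12a) + Ea = 29Ea; the factor a is the logarithm that the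
  -- hypothesis on |B| pays for.
  large : 48 * (2 * (E * (2 * a + 12)) + 1) * (496 * u) < n
  large = ≤-<-trans (begin
      48 * (2 * (E * (2 * a + 12)) + 1) * (496 * u)     ≤⟨ *-monoˡ-≤ (496 * u) (*-monoʳ-≤ 48 steps) ⟩
      48 * (29 * (E * a)) * (496 * u)                   ≡⟨ arith₂ E a u 496 ⟩
      48 * 29 * 496 * E * a * u                         ∎)
    (bound (48 * 29 * 496 * E) steps≤C)
    where
    open ℕₚ.≤-Reasoning
    arith₁ : ∀ E a → 2 * (E * (2 * a + 12 * a)) + E * a ≡ 29 * (E * a)
    arith₁ = ℕ-solve
    arith₂ : ∀ E a u r → 48 * (29 * (E * a)) * (r * u) ≡ 48 * 29 * r * E * a * u
    arith₂ = ℕ-solve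
    steps : 2 * (E * (2 * a + 12)) + 1 ≤ 29 * (E * a)
    steps = ≤-trans (+-mono-≤ (*-monoʳ-≤ 2 (*-monoʳ-≤ E (+-monoʳ-≤ (2 * a) (*-monoʳ-≤ 12 0<a)))) (*-mono-≤ 0<E 0<a))
      (≤-reflexive (arith₁ E a))

-- 8 · 496 ≤ 2^12 and u < 2^(2a), so 2a + 12 doublings suffice, and `doubling` takes E steps for
-- each.
growth-bound : ∀ a u → u < 2 ^ (2 * a) → 8 * (496 * u) * E ^ (E * (2 * a + 12)) < (E + 1) ^ (E * (2 * a + 12))
growth-bound a u u< = <-≤-trans (*-monoˡ-< (E ^ k) {{ℕ.>-nonZero (m^n>0 E {{ℕ.>-nonZero 0<E}} k)}} (begin-strict
    8 * (496 * u)               ≡⟨ sym (*-assoc 8 496 u) ⟩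
    3968 * u                    ≤⟨ *-monoˡ-≤ u (m≤m+n 3968 128) ⟩
    4096 * u                    <⟨ *-monoʳ-< 4096 u< ⟩
    4096 * 2 ^ (2 * a)          ≡⟨ *-comm 4096 (2 ^ (2 * a)) ⟩
    2 ^ (2 * a) * 2 ^ 12        ≡⟨ sym (^-distribˡ-+-* 2 (2 * a) 12) ⟩
    2 ^ (2 * a + 12)            ∎)) (doubling E 0<E (2 * a + 12))
  where
  open ℕₚ.≤-Reasoning
  k : ℕ
  k = E * (2 * a + 12)

open import Data.Fin.Subset using (_∈_)

theorem6 : Σ ℕ λ q → (0 < q) ×
    (∀ (p : ℕ) .{{_ : NonZero p}} → Prime p →
    ∀ (A B : Subset p) →
    1 < ∣ A ∣ → 2 * ∣ A ∣ < p →
    0 < ∣ B ∣ → 8 * (∣ B ∣ * ∣ B ∣) < p →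
    (∣ A ∣ ^ (q * ∣ B ∣)) <exp ∣ A ∣ →
    ∀ (τ : Fin p → Fin p) → (∀ b → b ∈ B → τ b ∈ A) →
    ∣ A ∣ + ∣ B ∣ ≤ ∣ restrictedSumset A B τ ∣ + 3)
-- q plays the part of 1 / c: the exponential hypothesis says q |B| ln |A| < |A|. The factor 5 pays
-- for the comparison of e^n with 2^(5n).
theorem6 = 5 * C , *-mono-≤ {1} {5} (s≤s z≤n) 0<C , main
  where
  main : ∀ (p : ℕ) .{{_ : NonZero p}} → Prime p → ∀ (A B : Subset p) → 1 < ∣ A ∣ → 2 * ∣ A ∣ < p →
    0 < ∣ B ∣ → 8 * (∣ B ∣ * ∣ B ∣) < p → (∣ A ∣ ^ (5 * C * ∣ B ∣)) <exp ∣ A ∣ →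
    ∀ (τ : Fin p → Fin p) → (∀ b → b ∈ B → τ b ∈ A) → ∣ A ∣ + ∣ B ∣ ≤ ∣ restrictedSumset A B τ ∣ + 3
  main p pr A B 1<n 2n<p 0<m 8m²<p h τ _ = decide (∣ B ∣ ℕₚ.≤? 2)
    where
    u : ℕ
    u = ∣ B ∣ ∸ 1
    m≡ : ∣ B ∣ ≡ suc u
    m≡ = sym (m+[n∸m]≡n 0<m)
    u≤m : u ≤ ∣ B ∣
    u≤m = m∸n≤m ∣ B ∣ 1
    onLog : ¬ ∣ B ∣ ≤ 2 → (∃ λ a → 0 < a × ∣ A ∣ < 2 ^ (2 * a) × C * a * ∣ B ∣ < ∣ A ∣) → ∣ A ∣ + ∣ B ∣ ≤ ∣ restrictedSumset A B τ ∣ + 3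
    onLog m≰2 (a , 0<a , n< , Cam<n) = Reduction.Large.conclusion p pr A B τ I E J (E * (2 * a + 12)) u m≡
        (m<n⇒0<n∸m (<-trans (n<1+n 1) (≰⇒> m≰2)))
        496≤I E≡ 2E≤I² J≡ 9240≤J (growth-bound a u (≤-<-trans u≤n n<)) 8m²<p 2n<p big wide large 4Iu≤n
      where
      open Thresholds a u ∣ B ∣ ∣ A ∣ 0<a u≤m Cam<n
      u≤n : u ≤ ∣ A ∣
      u≤n = ≤-trans (m≤n*m u (4 * I) {{ℕ.>-nonZero (≤-trans 0<I (m≤n*m I 4))}}) 4Iu≤n
    decide : Dec (∣ B ∣ ≤ 2) → ∣ A ∣ + ∣ B ∣ ≤ ∣ restrictedSumset A B τ ∣ + 3
    decide (yes m≤2) = Reduction.small-B p pr A B τ m≤2 0<m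
    decide (no m≰2)  = onLog m≰2 (log-bound C ∣ A ∣ ∣ B ∣ 1<n h)
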